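{- Let $n\ge2$ and $\varepsilon\in\{\pm1\}^n$. Given any cluster $\{M_1,\dots,M_{n-1}\}$ in the cluster category for $Q_\varepsilon$, with associated cluster matrix $V$, there is a unique (up to isomorphism) mixed cobinary tree $T$ with $\varepsilon(T)=\varepsilon$ having the property that $$\overline R(T)=F^{ -1}\big(E_\varepsilon^t\,S(V)\big).$$
   Context: A mixed cobinary tree (MCT) with $n$ internal nodes is a finite tree $T$ linearly embedded in the $xy$-plane (vertices are points, edges are straight segments meeting only in common endpoints) such that: (1) $T$ has no horizontal edges. (2) The internal nodes (the vertices which are not leaves, a leaf being a vertex of degree one) have distinct $x$-coordinates, which are $1,2,\dots,n$; denote by $t_i$ the internal node with $x$-coordinate $i$. A neighbour (internal or leaf) of an internal node lying higher is called a parent of it, one lying lower a child of it. (3) Each internal node is either of positive type (a $\Lambda$-node), with two children and one parent, or of negative type (a V-node), with one child and two parents. (4) If $(x,y)$ is a positive node, then the vertical wall $\{(x,z): z<y\}$ is disjoint from $T$ and separates the two children of the node (one is to its left, one to its right). (5) If $(x,y)$ is a negative node, then the vertical wall $\{(x,z): z>y\}$ is disjoint from $T$ and separates the two parents of the node. The sign vector is $\varepsilon(T)=(\varepsilon_1,\dots,\varepsilon_n)$ with $\varepsilon_i=1$ if $t_i$ is a $\Lambda$-node and $\varepsilon_i=-1$ if $t_i$ is a V-node. The bottom-to-top partial order on the internal nodes is the one generated by "each child is below its parent". Two MCTs with the same sign vector are isomorphic if their underlying trees are isomorphic by an isomorphism under which corresponding internal nodes have the same left-to-right total order (i.e. $t_i\mapsto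 t_i$) and the same bottom-to-top partial order. The $n-1$ internal edges of $T$ (edges joining two internal nodes) are numbered $\ell_1,\dots,\ell_{n-1}$; $\ell_i$ joins $t_{p_i}$ to $t_{q_i}$ with $p_i<q_i$, and $\mathrm{sgn}(\ell_i)=\pm1$ is the sign of its slope. Put $R(T)=\{x\in\mathbb R^n: \mathrm{sgn}(\ell_i)(x_{q_i}-x_{p_i})>0 \text{ for } 1\le i\le n-1\}$ and let $\overline R(T)$ be its closure. Let $F:\mathbb R^n\to\mathbb R^{n-1}$, $F(x)=(x_2-x_1,x_3-x_2,\dots,x_n-x_{n-1})$. The quiver $Q_\varepsilon$ has vertices $1,\dots,n-1$ and, for $1\le i\le n-2$, one arrow between $i$ and $i+1$, which is $i+1\to i$ if $\varepsilon_{i+1}=1$ and $i\to i+1$ if $\varepsilon_{i+1}=-1$. Its Euler matrix $E_\varepsilon$ is the $(n-1)\times(n-1)$ matrix with $1$'s on the diagonal, $(i,j)$ entry $-1$ whenever there is an arrow $i\to j$, and all other entries $0$. The positive roots are $\beta_{pq}=\sum_{i=p}^{q-1}e_i\in\mathbb Z^{n-1}$, $1\le p<q\le n$ (the dimension vectors of the indecomposable representations of $Q_\varepsilon$). The projective roots $\pi_1,\dots,\pi_{n-1}$ are the rows of $E_\varepsilon^{ -1}$ (dimension vectors of the indecomposable projectives $P_i$). An almost positive root is a positive root or a negative projective root $-\pi_i$. The indecomposable objects of the cluster category are the indecomposable representations of $Q_\varepsilon$ and the shifted projectives $P_i[1]$, with dimension vectors $-\pi_i$; objects are identified with their dimension vectors.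 A cluster is a set of $n-1$ distinct such objects $M_1,\dots,M_{n-1}$ with $\mathrm{Ext}^1(M_i,M_j)=0$ for all $i,j$; numerically: a set of $n-1$ distinct almost positive roots $v_1,\dots,v_{n-1}$ such that $v_i^tE_\varepsilon v_j\ge0$ for all $i,j$ for which $v_j$ is a positive root. The cluster matrix $V$ is the $(n-1)\times(n-1)$ matrix with columns $v_1,\dots,v_{n-1}$ (in some order). $S(V)\subseteq\mathbb R^{n-1}$ is the set of all $\sum_i a_iv_i$ with all $a_i\ge0$, and $E_\varepsilon^tS(V)=\{E_\varepsilon^tv:v\in S(V)\}$. -}

module Defs where

open import Algebra.Apartness.Bundles using (HeytingField; HeytingCommutativeRing)
import Algebra.Definitions.RawMonoid as RawMonoidDefs
open import Algebra.Bundles using (CommutativeRing)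
open import Data.Bool.Base using (if_then_else_)
open import Data.Fin.Base as Fin using (Fin; zero; suc; toℕ; inject₁)
import Data.Fin.Properties as Fin
open import Data.Integer.Base as ℤ using (ℤ; 0ℤ; 1ℤ; -1ℤ; +_; -[1+_])
import Data.Integer.Properties as ℤ
open import Data.Nat.Base as ℕ using (ℕ)
import Data.Nat.Properties as ℕ
open import Data.Product.Base using (Σ-syntax; ∃; ∃₂; _×_; _,_; proj₁; proj₂)
open import Data.Product using (∃!)
open import Data.Sign.Base as Sign using (Sign)
import Data.Sign.Properties as Sign
open import Data.Sum.Base using (_⊎_; [_,_]′)
open import Data.Vec.Functional using (Vector)
open import Function.Base using (const)
open import Function.Bundles using (_⇔_; _↔_; module Equivalence; module Inverse)
open import Function.Definitions using (Injective)
open import Level using (0ℓ; _⊔_) renaming (suc to lsuc)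
open import Relation.Binary.Construct.Closure.ReflexiveTransitive using (Star)
open import Relation.Binary.Core using (Rel)
open import Relation.Binary.Definitions using (Decidable; Irreflexive; Symmetric)
open import Relation.Binary.PropositionalEquality.Core using (_≡_; _≢_; _≗_)
open import Relation.Binary.Structures using (IsStrictPartialOrder)
open import Relation.Nullary.Decidable using (does; _×-dec_; _⊎-dec_)
open import Relation.Nullary.Negation using (¬_)
open import Relation.Unary using (Pred; _∈_)

-- Throughout m = n - 1.  Indices are 0-based: k : Fin n stands for the
-- index k + 1, and likewise for k : Fin m.

Matrix : ℕ → Set
Matrix m = Fin m → Fin m → ℤ

Σℤ : ∀ {m} → Vector ℤ m → ℤ
Σℤ = RawMonoidDefs.sum ℤ.+-0-rawMonoid

-- The sign governing the arrow between vertices i and i + 1 is ε_{i+1};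
-- with 0-based indices, this is the entry of ε at the larger vertex.
Arrow : ∀ {m} → Vector Sign (ℕ.suc m) → Rel (Fin m) 0ℓ
Arrow ε i j =
    (toℕ i ≡ ℕ.suc (toℕ j) × ε (inject₁ i) ≡ Sign.+)
  ⊎ (toℕ j ≡ ℕ.suc (toℕ i) × ε (inject₁ j) ≡ Sign.-)

arrow? : ∀ {m} (ε : Vector Sign (ℕ.suc m)) → Decidable (Arrow ε)
arrow? ε i j =
    (toℕ i ℕ.≟ ℕ.suc (toℕ j) ×-dec ε (inject₁ i) Sign.≟ Sign.+)
  ⊎-dec (toℕ j ℕ.≟ ℕ.suc (toℕ i) ×-dec ε (inject₁ j) Sign.≟ Sign.-)

identity : ∀ {m} → Matrix m
identity i j = if does (i Fin.≟ j) then 1ℤ else 0ℤ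

euler : ∀ {m} → Vector Sign (ℕ.suc m) → Matrix m
euler ε i j =
  if does (i Fin.≟ j) then 1ℤ else
  if does (arrow? ε i j) then -1ℤ else 0ℤ

_⊗_ : ∀ {m} → Matrix m → Matrix m → Matrix m
(A ⊗ B) i j = Σℤ λ k → A i k ℤ.* B k j

IsInverse : ∀ {m} → Matrix m → Matrix m → Set
IsInverse A B =
  (∀ i j → (A ⊗ B) i j ≡ identity i j) × (∀ i j → (B ⊗ A) i j ≡ identity i j)

eulerForm : ∀ {m} → Vector Sign (ℕ.suc m) → Vector ℤ m → Vector ℤ m → ℤ
eulerForm ε v w = Σℤ λ i → Σℤ λ j → v i ℤ.* euler ε i j ℤ.* w j

-- β p q = e_p + ... + e_{q-1}
β : ∀ {m} → Fin (ℕ.suc m) → Fin (ℕ.suc m) → Vector ℤ m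
β p q i =
  if does (toℕ p ℕ.≤? toℕ i ×-dec toℕ i ℕ.<? toℕ q) then 1ℤ else 0ℤ

IsPositiveRoot : ∀ {m} → Vector ℤ m → Set
IsPositiveRoot v = ∃₂ λ p q → p Fin.< q × v ≗ β p q

IsNegativeProjectiveRoot : ∀ {m} → Vector Sign (ℕ.suc m) → Vector ℤ m → Set
IsNegativeProjectiveRoot {m} ε v =
  Σ[ Π ∈ Matrix m ] IsInverse (euler ε) Π × (∃ λ i → ∀ j → v j ≡ ℤ.- Π i j)

IsAlmostPositiveRoot : ∀ {m} → Vector Sign (ℕ.suc m) → Vector ℤ m → Set
IsAlmostPositiveRoot ε v = IsPositiveRoot v ⊎ IsNegativeProjectiveRoot ε v

-- v 0, ..., v (m - 1) are the columns of the cluster matrix.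
record IsCluster {m} (ε : Vector Sign (ℕ.suc m)) (v : Fin m → Vector ℤ m) : Set where
  field
    almostPositive : ∀ i → IsAlmostPositiveRoot ε (v i)
    distinct       : Injective _≡_ _≗_ v
    compatible     : ∀ i j → IsPositiveRoot (v j) → 0ℤ ℤ.≤ eulerForm ε (v i) (v j)

record OrderedField c ℓ₁ ℓ₂ : Set (lsuc (c ⊔ ℓ₁ ⊔ ℓ₂)) where
  infix 4 _<_ _≤_

  field
    heytingField : HeytingField c ℓ₁ ℓ₂

  open HeytingField heytingField public

  field
    _<_                  : Rel Carrier ℓ₂
    isStrictPartialOrder : IsStrictPartialOrder _≈_ _<_
    #⇔<⊎>                : ∀ {x y} → x # y ⇔ (x < y ⊎ y < x)
    +-monoˡ-<            : ∀ {x y} z → x < y → x + z < y + z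
    *-pos                : ∀ {x y} → 0# < x → 0# < y → 0# < x * y

  _≤_ : Rel Carrier ℓ₂
  x ≤ y = ¬ (y < x)

  commutativeRing : CommutativeRing c ℓ₁
  commutativeRing = HeytingCommutativeRing.commutativeRing heytingCommutativeRing

  open RawMonoidDefs (CommutativeRing.+-rawMonoid commutativeRing)
    using () renaming (sum to ∑; _×_ to _·_) public

  fromℕ : ℕ → Carrier
  fromℕ k = k · 1#

  fromℤ : ℤ → Carrier
  fromℤ (+ k)    = fromℕ k
  fromℤ -[1+ k ] = - fromℕ (ℕ.suc k)

  -- |x - y| < δ
  Within : Carrier → Rel Carrier ℓ₂
  Within δ x y = (x - y < δ) × (y - x < δ)

  IsCauchy : (ℕ → Carrier) → Set (c ⊔ ℓ₂)
  IsCauchy s = ∀ δ → 0# < δ →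
    ∃ λ N → ∀ i j → N ℕ.≤ i → N ℕ.≤ j → Within δ (s i) (s j)

  ConvergesTo : (ℕ → Carrier) → Carrier → Set (c ⊔ ℓ₂)
  ConvergesTo s x = ∀ δ → 0# < δ → ∃ λ N → ∀ i → N ℕ.≤ i → Within δ (s i) x

-- ℝ, as a Cauchy complete Archimedean ordered field.  Classically these
-- axioms determine ℝ up to unique isomorphism; decidability of the order is
-- not assumed, so that they also hold of the usual constructive reals.
record RealNumbers c ℓ₁ ℓ₂ : Set (lsuc (c ⊔ ℓ₁ ⊔ ℓ₂)) where
  field
    orderedField : OrderedField c ℓ₁ ℓ₂

  open OrderedField orderedField public

  field
    archimedean : ∀ x → ∃ λ k → x < fromℕ k
    complete    : ∀ s → IsCauchy s → ∃ λ x → ConvergesTo s x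

module _ {c ℓ₁ ℓ₂} (𝓡 : RealNumbers c ℓ₁ ℓ₂) where
  open RealNumbers 𝓡 hiding (zero) renaming (Carrier to ℝ)

  Point : Set c
  Point = ℝ × ℝ

  infix 4 _≈ₚ_
  _≈ₚ_ : Rel Point ℓ₁
  (x , y) ≈ₚ (x′ , y′) = (x ≈ x′) × (y ≈ y′)

  Segment : Point → Point → Pred Point (c ⊔ ℓ₁ ⊔ ℓ₂)
  Segment (x , y) (x′ , y′) P = ∃ λ s → (0# ≤ s) × (s ≤ 1#) ×
    P ≈ₚ ((1# - s) * x + s * x′ , (1# - s) * y + s * y′)

  ExactlyTwo : ∀ {a ℓ} {A : Set a} → Pred A ℓ → Set (a ⊔ ℓ)
  ExactlyTwo P = ∃₂ λ a b → a ≢ b × P a × P b × (∀ {w} → P w → w ≡ a ⊎ w ≡ b)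

  record PlaneTree : Set (c ⊔ ℓ₁ ⊔ ℓ₂ ⊔ lsuc 0ℓ) where
    field
      order     : ℕ

    Vertex : Set
    Vertex = Fin order

    field
      Adj       : Rel Vertex 0ℓ
      adj?      : Decidable Adj
      symmetric : Symmetric Adj
      loopless  : Irreflexive _≡_ Adj
      connected : ∀ u v → Star Adj u v
      -- No cycle z₀, ..., z_{k+2} of length at least 3.
      acyclic   : ∀ {k} (z : Fin (3 ℕ.+ k) → Vertex) → Injective _≡_ _≡_ z →
                  (∀ i → Adj (z (inject₁ i)) (z (suc i))) →
                  ¬ Adj (z (Fin.fromℕ (2 ℕ.+ k))) (z zero)

      point     : Vertex → Point
      point-injective : Injective _≡_ _≈ₚ_ point
      edges-meet      : ∀ {u v u′ v′} → Adj u v → Adj u′ v′ →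
                        ¬ ((u ≡ u′ × v ≡ v′) ⊎ (u ≡ v′ × v ≡ u′)) →
                        ∀ P → P ∈ Segment (point u) (point v) →
                              P ∈ Segment (point u′) (point v′) →
                        ∃ λ w → (w ≡ u ⊎ w ≡ v) × (w ≡ u′ ⊎ w ≡ v′) × P ≈ₚ point w

    X Y : Vertex → ℝ
    X v = proj₁ (point v)
    Y v = proj₂ (point v)

    Drawing : Pred Point (c ⊔ ℓ₁ ⊔ ℓ₂)
    Drawing P =
        (∃ λ v → P ≈ₚ point v)
      ⊎ (∃₂ λ u v → Adj u v × P ∈ Segment (point u) (point v))

    Leaf Internal : Pred Vertex 0ℓ
    Leaf v     = ∃! _≡_ (Adj v)
    Internal v = ¬ Leaf v

    Parent Child : Vertex → Pred Vertex ℓ₂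
    Parent v w = Adj v w × (Y v < Y w)
    Child  v w = Adj v w × (Y w < Y v)

    IsΛ IsV : Pred Vertex ℓ₂
    IsΛ v = ExactlyTwo (Child v) × ∃! _≡_ (Parent v)
    IsV v = ∃! _≡_ (Child v) × ExactlyTwo (Parent v)

  record MCT (n : ℕ) : Set (c ⊔ ℓ₁ ⊔ ℓ₂ ⊔ lsuc 0ℓ) where
    field
      tree : PlaneTree

    open PlaneTree tree public

    field
      non-horizontal : ∀ {u v} → Adj u v → Y u # Y v

      t          : Fin n → Vertex
      t-internal : ∀ i → Internal (t i)
      t-onto     : ∀ v → Internal v → ∃ λ i → t i ≡ v
      t-abscissa : ∀ i → X (t i) ≈ fromℕ (ℕ.suc (toℕ i))

      node-type  : ∀ i → IsΛ (t i) ⊎ IsV (t i)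

      Λ-wall     : ∀ i → IsΛ (t i) → ∀ z → z < Y (t i) → ¬ Drawing (X (t i) , z)
      Λ-separate : ∀ i → IsΛ (t i) → ∃₂ λ a b → Child (t i) a × Child (t i) b ×
                   (X a < X (t i)) × (X (t i) < X b)

      V-wall     : ∀ i → IsV (t i) → ∀ z → Y (t i) < z → ¬ Drawing (X (t i) , z)
      V-separate : ∀ i → IsV (t i) → ∃₂ λ a b → Parent (t i) a × Parent (t i) b ×
                   (X a < X (t i)) × (X (t i) < X b)

    signVector : Vector Sign n
    signVector i = [ const Sign.+ , const Sign.- ]′ (node-type i)

    infix 4 _⊑_
    _⊑_ : Rel (Fin n) ℓ₂
    _⊑_ = Star λ i j → Child (t j) (t i)

    -- For p < q the edge from t p to t q has positive run (toℕ q - toℕ p),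
    -- so the sign of its slope is the sign of its rise Y (t q) - Y (t p).
    slopeSign : ∀ {p q} → Adj (t p) (t q) → Sign
    slopeSign e = [ const Sign.+ , const Sign.- ]′
      (Equivalence.to #⇔<⊎> (non-horizontal e))

  record Isomorphic {n} (T T′ : MCT n) : Set ℓ₂ where
    private
      module T  = MCT T
      module T′ = MCT T′
    field
      φ         : T.Vertex ↔ T′.Vertex
    open Inverse φ using (to)
    field
      adjacency : ∀ u v → T.Adj u v ⇔ T′.Adj (to u) (to v)
      leftRight : ∀ i → to (T.t i) ≡ T′.t i
      bottomTop : ∀ i j → (i T.⊑ j) ⇔ (i T′.⊑ j)

  _⊙_ : Sign → ℝ → ℝ
  Sign.+ ⊙ x = x
  Sign.- ⊙ x = - x

  R : ∀ {n} → MCT n → Pred (Vector ℝ n) ℓ₂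
  R T x = ∀ {p q} → p Fin.< q → (ℓ : Adj (t p) (t q)) →
          0# < slopeSign ℓ ⊙ (x q - x p)
    where open MCT T

  -- The product topology, by sup-norm balls.
  closure : ∀ {n ℓ} → Pred (Vector ℝ n) ℓ → Pred (Vector ℝ n) (c ⊔ ℓ₂ ⊔ ℓ)
  closure A x = ∀ δ → 0# < δ → ∃ λ y → y ∈ A × (∀ i → Within δ (x i) (y i))

  F : ∀ {m} → Vector ℝ (ℕ.suc m) → Vector ℝ m
  F x i = x (suc i) - x (inject₁ i)

  S : ∀ {m} → (Fin m → Vector ℤ m) → Pred (Vector ℝ m) (c ⊔ ℓ₁ ⊔ ℓ₂)
  S v w = ∃ λ (a : Vector ℝ _) →
    (∀ i → 0# ≤ a i) × (∀ j → w j ≈ ∑ λ i → a i * fromℤ (v i j))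

  _ᵗ∙_ : ∀ {m} → Matrix m → Vector ℝ m → Vector ℝ m
  (A ᵗ∙ w) j = ∑ λ i → fromℤ (A i j) * w i

  EᵗS : ∀ {m} → Vector Sign (ℕ.suc m) → (Fin m → Vector ℤ m) →
        Pred (Vector ℝ m) (c ⊔ ℓ₁ ⊔ ℓ₂)
  EᵗS ε v y = ∃ λ w → w ∈ S v × (∀ j → y j ≈ (euler ε ᵗ∙ w) j)

{-# OPTIONS --safe #-}
module Submission where

-- Under E^t every almost positive root becomes F of the indicator of a set U
-- of nodes, the nodes above a diagonal (a gap between two walls at some level),
-- and the pairing of v_i with β r s becomes 1_U(s) - 1_U(r).  Compatibility of
-- the roots therefore says that the diagonals do not cross, and then
-- i ↦ #{ j : i ∈ U_j } (with ties broken from left to right) is a height function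
-- for which the nodes next to each diagonal are on the correct side of it.
-- Given heights, the tree is found by sweeping a horizontal line upwards over
-- the walls: the line is cut into gaps, a Λ-node merges and a V-node splits
-- them, and the gaps, followed through time, are the edges.  Two different
-- edges over a common column have disjoint ranges of heights, which gives
-- planarity.  Removing an edge splits the nodes into U and its complement; the
-- m diagonals of the cluster are m different edges, hence all of them, and the
-- indicators of their sets span the closed region of the tree, which is the
-- simplicial cone of the cluster.
-- Uniqueness: the closed region determines the bottom-to-top order through the
-- indicators of up-sets, the internal edges are the covering relations of this
-- order, and each leaf is determined by the empty place it occupies at its node.

open import Defs
import Algebra.Apartness.Properties.HeytingCommutativeRing as ApartnessProperties
open import Algebra.Bundles using (CommutativeRing)
import Algebra.Properties.AbelianGroup as GroupProperties
import Algebra.Properties.Ring as RingProperties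
import Algebra.Properties.Semiring.Mult as SemiringMult
import Algebra.Properties.Semiring.Sum as SemiringSum
import Algebra.Solver.Ring as RingSolver
open import Algebra.Solver.Ring.AlmostCommutativeRing using (fromCommutativeRing; _-Raw-AlmostCommutative⟶_)
open import Data.Bool.Base using (Bool; true; false; not; T; if_then_else_)
import Data.Bool.Properties as Bool
open import Data.Empty using (⊥)
open import Data.Fin.Base as Fin using (Fin; zero; suc; toℕ; inject₁; fromℕ<)
import Data.Fin.Induction as Fin
open import Data.Fin.Patterns using (0F; 1F; 2F)
import Data.Fin.Properties as Fin
open import Data.Integer.Base as ℤ using (ℤ; 0ℤ; 1ℤ; -1ℤ; +_; -[1+_]; _⊖_)
import Data.Integer.Properties as ℤ
open import Data.Integer.Tactic.RingSolver using (solve-∀)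
open import Data.Maybe.Base using (Maybe; just; nothing)
open import Data.Nat.Base as ℕ using (ℕ; zero; suc; z≤n; s≤s)
open import Data.Nat.Induction using (<-wellFounded; Acc; acc)
import Data.Nat.Properties as ℕ
open import Data.Product using (Σ; ∃; ∃₂; ∃!; _×_; _,_; proj₁; proj₂)
open import Data.Sign.Base as Sign using (Sign; opposite)
import Data.Sign.Properties as Sign
open import Data.Sum.Base as Sum using (_⊎_; inj₁; inj₂; [_,_]′)
open import Data.Unit.Base using (⊤; tt)
open import Data.Vec.Functional using (Vector)
open import Function.Base using (_∘_; case_of_; const; id)
open import Function.Bundles using (_↔_; mk⇔; mk↔ₛ′; module Equivalence; module Inverse)
open import Function.Definitions using (Injective)
open import Function.Properties.Inverse using (↔-trans)
open import Level as Level using (0ℓ)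
open import Relation.Binary.Construct.Closure.ReflexiveTransitive as Star using (Star; _◅_; _◅◅_) renaming (ε to nil)
open import Relation.Binary.Core using (Rel)
open import Relation.Binary.Definitions using (Decidable; Tri; tri<; tri≈; tri>)
open import Relation.Binary.PropositionalEquality as ≡ using (_≡_; _≢_; _≗_; cong; cong₂; subst; subst₂; module ≡-Reasoning)
open import Relation.Binary.Structures using (IsStrictPartialOrder)
open import Relation.Nullary.Decidable
open import Relation.Nullary.Negation using (¬_; contradiction)
open import Relation.Unary as U using (_∈_; _⊆_; _≐_; _⊢_)

-- The tree of a height function

-- Two obstacles shape the construction. The order of the reals is not decidable, so the case
-- distinctions are made on natural numbers: the tree is at first a combinatorial object, given by
-- heights, levels and columns, and its vertices receive real coordinates only at the end, integral
-- up to a factor of 1/3 in the abscissae. Moreover the edges have to be straight, although a gap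
-- may wind between several nodes. This is harmless because a gap that passes a Λ-node runs above it
-- and one that passes a V-node runs below it, so that the heights of the two ends already keep the
-- segment off the wall. Every question of planarity is then settled by a horizontal or a vertical
-- line. The cuts serve several purposes. A cut changes along one edge only; hence a cycle cannot
-- close, cuts of the same edge agree, and the coefficient of a diagonal in the cone is the
-- difference of the coordinates along its edge.

module _ {p} {n : ℕ} {P : Fin n → Set p} (P? : U.Decidable P) where

  -- The value A = 0 means that nothing was found, and then the condition on `suc (toℕ i) ≡ A` is
  -- vacuous. The unbounded end of a horizontal line thus needs no case of its own.
  nearestˡ : ∀ c → c ℕ.≤ n → ∃ λ A → A ℕ.≤ c ×
    (∀ i → A ℕ.≤ toℕ i → toℕ i ℕ.< c → ¬ P i) × (∀ i → suc (toℕ i) ≡ A → P i)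
  nearestˡ zero    c≤n = 0 , z≤n , (λ _ _ ()) , (λ _ ())
  nearestˡ (suc c) c<n with P? (fromℕ< c<n)
  ... | yes Pc = suc c , ℕ.≤-refl , (λ i A≤i i<c _ → ℕ.<⇒≱ i<c A≤i) ,
          λ i i≡c → subst P (Fin.toℕ-injective (≡.trans (Fin.toℕ-fromℕ< c<n) (≡.sym (ℕ.suc-injective i≡c)))) Pc
  ... | no ¬Pc with nearestˡ c (ℕ.<⇒≤ c<n)
  ...   | A , A≤c , inner , bound = A , ℕ.m≤n⇒m≤1+n A≤c , inner′ , bound
    where
    inner′ : ∀ i → A ℕ.≤ toℕ i → toℕ i ℕ.< suc c → ¬ P i
    inner′ i A≤i (s≤s i≤c) with ℕ.m≤n⇒m<n∨m≡n i≤c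
    ... | inj₁ i<c = inner i A≤i i<c
    ... | inj₂ i≡c = ¬Pc ∘ subst P (Fin.toℕ-injective (≡.trans i≡c (≡.sym (Fin.toℕ-fromℕ< c<n))))

  nearestʳ : ∀ k c → c ℕ.+ k ≡ n → ∃ λ B → c ℕ.≤ B × B ℕ.≤ n ×
    (∀ i → c ℕ.≤ toℕ i → toℕ i ℕ.< B → ¬ P i) × (∀ i → toℕ i ≡ B → P i)
  nearestʳ zero    c eq = n , ℕ.≤-reflexive c≡n , ℕ.≤-refl ,
    (λ i c≤i i<n _ → ℕ.<⇒≱ i<n (subst (ℕ._≤ toℕ i) c≡n c≤i)) ,
    λ i i≡n → contradiction i≡n (ℕ.<⇒≢ (Fin.toℕ<n i))
    where
    c≡n : c ≡ n
    c≡n = ≡.trans (≡.sym (ℕ.+-identityʳ c)) eq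
  nearestʳ (suc k) c eq with c<n ← subst (c ℕ.<_) eq (ℕ.m<m+n c ℕ.z<s) | P? (fromℕ< c<n)
  ... | yes Pc = c , ℕ.≤-refl , ℕ.<⇒≤ c<n , (λ i c≤i i<c _ → ℕ.<⇒≱ i<c c≤i) ,
          λ i i≡c → subst P (Fin.toℕ-injective (≡.trans (Fin.toℕ-fromℕ< c<n) (≡.sym i≡c))) Pc
  ... | no ¬Pc with nearestʳ k (suc c) (≡.trans (≡.sym (ℕ.+-suc c k)) eq)
  ...   | B , c<B , B≤n , inner , bound = B , ℕ.<⇒≤ c<B , B≤n , inner′ , bound
    where
    inner′ : ∀ i → c ℕ.≤ toℕ i → toℕ i ℕ.< B → ¬ P i
    inner′ i c≤i i<B with ℕ.m≤n⇒m<n∨m≡n c≤i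
    ... | inj₁ c<i = inner i c<i i<B
    ... | inj₂ c≡i = ¬Pc ∘ subst P (Fin.toℕ-injective (≡.trans (≡.sym c≡i) (≡.sym (Fin.toℕ-fromℕ< c<n))))

least : ∀ {p} {n} {P : Fin n → Set p} → U.Decidable P → (f : Fin n → ℕ) →
        (∀ i → ¬ P i) ⊎ ∃ λ i → P i × (∀ k → P k → f i ℕ.≤ f k)
least {n = zero}  P? f = inj₁ λ ()
least {n = suc n} P? f with P? zero | least (P? ∘ suc) (f ∘ suc)
... | no ¬P₀ | inj₁ none = inj₁ λ { zero → ¬P₀ ; (suc i) → none i }
... | no ¬P₀ | inj₂ (i , Pi , min) =
      inj₂ (suc i , Pi , λ { zero P₀ → contradiction P₀ ¬P₀ ; (suc k) → min k })
... | yes P₀ | inj₁ none =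
      inj₂ (zero , P₀ , λ { zero _ → ℕ.≤-refl ; (suc k) Pk → contradiction Pk (none k) })
... | yes P₀ | inj₂ (i , Pi , min) with ℕ.≤-total (f zero) (f (suc i))
...   | inj₁ le = inj₂ (zero , P₀ , λ { zero _ → ℕ.≤-refl ; (suc k) Pk → ℕ.≤-trans le (min k Pk) })
...   | inj₂ ge = inj₂ (suc i , Pi , λ { zero _ → ge ; (suc k) → min k })

greatest : ∀ {p} {n} {P : Fin n → Set p} → U.Decidable P → (f : Fin n → ℕ) →
           (∀ i → ¬ P i) ⊎ ∃ λ i → P i × (∀ k → P k → f k ℕ.≤ f i)
greatest {n = zero}  P? f = inj₁ λ ()
greatest {n = suc n} P? f with P? zero | greatest (P? ∘ suc) (f ∘ suc)
... | no ¬P₀ | inj₁ none = inj₁ λ { zero → ¬P₀ ; (suc i) → none i }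
... | no ¬P₀ | inj₂ (i , Pi , max) =
      inj₂ (suc i , Pi , λ { zero P₀ → contradiction P₀ ¬P₀ ; (suc k) → max k })
... | yes P₀ | inj₁ none =
      inj₂ (zero , P₀ , λ { zero _ → ℕ.≤-refl ; (suc k) Pk → contradiction Pk (none k) })
... | yes P₀ | inj₂ (i , Pi , max) with ℕ.≤-total (f (suc i)) (f zero)
...   | inj₁ le = inj₂ (zero , P₀ , λ { zero _ → ℕ.≤-refl ; (suc k) Pk → ℕ.≤-trans (max k Pk) le })
...   | inj₂ ge = inj₂ (suc i , Pi , λ { zero _ → ge ; (suc k) → max k })

-- A horizontal line at level h (just below the height h) meets the wall of a
-- node of height y below the node if it is a Λ-node and above it if it is a
-- V-node.
Wall : Sign → ℕ → ℕ → Set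
Wall Sign.+ h y = h ℕ.≤ y
Wall Sign.- h y = y ℕ.< h

wall? : ∀ s h y → Dec (Wall s h y)
wall? Sign.+ h y = h ℕ.≤? y
wall? Sign.- h y = y ℕ.<? h

-- A wall changes its state exactly when the level passes its node. Equal states at both levels
-- therefore exclude h₁ ≤ y < h₂; the sign decides which of the two levels has to be consulted.
¬wall-persist : ∀ s {h₁ h₂ y} → ¬ Wall s h₁ y → ¬ Wall s h₂ y → y ℕ.< h₁ ⊎ h₂ ℕ.≤ y
¬wall-persist Sign.+ ¬w₁ ¬w₂ = inj₁ (ℕ.≰⇒> ¬w₁)
¬wall-persist Sign.- ¬w₁ ¬w₂ = inj₂ (ℕ.≮⇒≥ ¬w₂)

wall-persist : ∀ s {h₁ h₂ y} → Wall s h₁ y → Wall s h₂ y → y ℕ.< h₁ ⊎ h₂ ℕ.≤ y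
wall-persist Sign.+ w₁ w₂ = inj₂ w₂
wall-persist Sign.- w₁ w₂ = inj₁ w₁

wall-stable : ∀ s {h₁ h₂ y} → (y ℕ.< h₁ × y ℕ.< h₂) ⊎ (h₁ ℕ.≤ y × h₂ ℕ.≤ y) → Wall s h₁ y → Wall s h₂ y
wall-stable Sign.+ (inj₁ (y<h₁ , _)) w = contradiction w (ℕ.<⇒≱ y<h₁)
wall-stable Sign.+ (inj₂ (_ , h₂≤y)) w = h₂≤y
wall-stable Sign.- (inj₁ (_ , y<h₂)) w = y<h₂
wall-stable Sign.- (inj₂ (h₁≤y , _)) w = contradiction w (ℕ.≤⇒≯ h₁≤y)

module Gaps {m : ℕ} (ε : Vector Sign (suc m)) (Y : Fin (suc m) → ℕ) (Y-injective : Injective _≡_ _≡_ Y) where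

  n : ℕ
  n = suc m

  WallAt : ℕ → Fin n → Set
  WallAt h i = Wall (ε i) h (Y i)

  -- Column c lies between the nodes c - 1 and c.  A gap consists of the
  -- columns between two consecutive walls at level h.
  record Gap (h A B : ℕ) : Set where
    constructor gap
    field
      A≤B   : A ℕ.≤ B
      B≤n   : B ℕ.≤ n
      inner : ∀ i → A ℕ.≤ toℕ i → toℕ i ℕ.< B → ¬ WallAt h i
      left  : ∀ i → suc (toℕ i) ≡ A → WallAt h i
      right : ∀ i → toℕ i ≡ B → WallAt h i

  open Gap public

  gap? : ∀ h A B → Dec (Gap h A B)
  gap? h A B = map′ (λ { (a , b , c , d , e) → gap a b c d e }) (λ { (gap a b c d e) → a , b , c , d , e })
    (A ℕ.≤? B ×-dec B ℕ.≤? n ×-dec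
     Fin.all? (λ i → A ℕ.≤? toℕ i →-dec (toℕ i ℕ.<? B →-dec ¬? (wall? (ε i) h (Y i)))) ×-dec
     Fin.all? (λ i → suc (toℕ i) ℕ.≟ A →-dec wall? (ε i) h (Y i)) ×-dec
     Fin.all? (λ i → toℕ i ℕ.≟ B →-dec wall? (ε i) h (Y i)))

  -- Besides the nodes inside the gap this admits A - 1 and B, whose walls bound it: the gap can
  -- only end at a level where one of these nodes is passed.
  Touch : ℕ → ℕ → Fin n → Set
  Touch A B i = A ℕ.≤ suc (toℕ i) × toℕ i ℕ.≤ B

  touch? : ∀ A B i → Dec (Touch A B i)
  touch? A B i = A ℕ.≤? suc (toℕ i) ×-dec toℕ i ℕ.≤? B

  touch-cases : ∀ {A B i} → Touch A B i →
    (A ℕ.≤ toℕ i × toℕ i ℕ.< B) ⊎ suc (toℕ i) ≡ A ⊎ toℕ i ≡ B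
  touch-cases (A≤1+i , i≤B) with ℕ.m≤n⇒m<n∨m≡n A≤1+i | ℕ.m≤n⇒m<n∨m≡n i≤B
  ... | inj₂ eq | _        = inj₂ (inj₁ (≡.sym eq))
  ... | inj₁ _  | inj₂ eq  = inj₂ (inj₂ eq)
  ... | inj₁ (s≤s A≤i) | inj₁ i<B = inj₁ (A≤i , i<B)

  gap-search : ∀ h c → c ℕ.≤ n → ∃₂ λ A B → A ℕ.≤ c × c ℕ.≤ B × Gap h A B
  gap-search h c c≤n
    with nearestˡ (λ i → wall? (ε i) h (Y i)) c c≤n
       | nearestʳ (λ i → wall? (ε i) h (Y i)) (n ℕ.∸ c) c (ℕ.m+[n∸m]≡n c≤n)
  ... | A , A≤c , innerˡ , left | B , c≤B , B≤n , innerʳ , right =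
    A , B , A≤c , c≤B , gap (ℕ.≤-trans A≤c c≤B) B≤n
      (λ i A≤i i<B → case toℕ i ℕ.<? c of λ where
        (yes i<c) → innerˡ i A≤i i<c
        (no  i≮c) → innerʳ i (ℕ.≮⇒≥ i≮c) i<B)
      left right

  private
    gap-left≮ : ∀ {h A B A′ B′ c} → Gap h A B → Gap h A′ B′ → c ℕ.≤ B → A′ ℕ.≤ c → ¬ A ℕ.< A′
    gap-left≮ {A = A} {A′ = suc a} g g′ c≤B a<c (s≤s A≤a) =
      inner g (fromℕ< a<n) (subst (A ℕ.≤_) (≡.sym eq) A≤a) (subst (ℕ._< _) (≡.sym eq) (ℕ.≤-trans a<c c≤B))
        (left g′ _ (cong suc eq))
      where
      a<n = ℕ.≤-trans a<c (ℕ.≤-trans c≤B (B≤n g))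
      eq  = Fin.toℕ-fromℕ< a<n

    gap-right≮ : ∀ {h A B A′ B′ c} → Gap h A B → Gap h A′ B′ → A ℕ.≤ c → c ℕ.≤ B′ → ¬ B′ ℕ.< B
    gap-right≮ {B = B} {B′ = b} g g′ A≤c c≤b b<B =
      inner g (fromℕ< b<n) (subst (_ ℕ.≤_) (≡.sym eq) (ℕ.≤-trans A≤c c≤b)) (subst (ℕ._< B) (≡.sym eq) b<B)
        (right g′ _ eq)
      where
      b<n = ℕ.≤-trans b<B (B≤n g)
      eq  = Fin.toℕ-fromℕ< b<n

  -- If two ends differed, the wall at one of them would stand inside the other gap, since both gaps
  -- contain the column c.
  gap-unique : ∀ {h A B A′ B′} c → Gap h A B → A ℕ.≤ c → c ℕ.≤ B → Gap h A′ B′ → A′ ℕ.≤ c → c ℕ.≤ B′ →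
               A ≡ A′ × B ≡ B′
  gap-unique c g A≤c c≤B g′ A′≤c c≤B′ =
    ℕ.≤-antisym (ℕ.≮⇒≥ (gap-left≮ g′ g c≤B′ A≤c)) (ℕ.≮⇒≥ (gap-left≮ g g′ c≤B A′≤c)) ,
    ℕ.≤-antisym (ℕ.≮⇒≥ (gap-right≮ g g′ A≤c c≤B′)) (ℕ.≮⇒≥ (gap-right≮ g′ g A′≤c c≤B))

  gap-touch : ∀ {h₁ h₂ A B} → Gap h₁ A B → Gap h₂ A B → ∀ {i} → Touch A B i → Y i ℕ.< h₁ ⊎ h₂ ℕ.≤ Y i
  gap-touch g₁ g₂ {i} t with touch-cases t
  ... | inj₁ (A≤i , i<B) = ¬wall-persist (ε i) (inner g₁ i A≤i i<B) (inner g₂ i A≤i i<B)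
  ... | inj₂ (inj₁ eq)   = wall-persist (ε i) (left g₁ i eq) (left g₂ i eq)
  ... | inj₂ (inj₂ eq)   = wall-persist (ε i) (right g₁ i eq) (right g₂ i eq)

  gap-move : ∀ {h₁ h₂ A B} → Gap h₁ A B →
             (∀ {i} → Touch A B i → (Y i ℕ.< h₁ × Y i ℕ.< h₂) ⊎ (h₁ ℕ.≤ Y i × h₂ ℕ.≤ Y i)) → Gap h₂ A B
  gap-move {A = A} {B} g side = gap (A≤B g) (B≤n g)
    (λ i A≤i i<B w → inner g i A≤i i<B (wall-stable (ε i) ([ (λ (a , b) → inj₁ (b , a)) , (λ (a , b) → inj₂ (b , a)) ]′ (side (ℕ.m≤n⇒m≤1+n A≤i , ℕ.<⇒≤ i<B))) w))
    (λ i eq → wall-stable (ε i) (side (ℕ.≤-reflexive (≡.sym eq) , ℕ.≤-trans (ℕ.n≤1+n _) (subst (ℕ._≤ B) (≡.sym eq) (A≤B g)))) (left g i eq))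
    (λ i eq → wall-stable (ε i) (side (ℕ.≤-trans (A≤B g) (ℕ.m≤n⇒m≤1+n (ℕ.≤-reflexive (≡.sym eq))) , ℕ.≤-reflexive eq)) (right g i eq))

  gap-between : ∀ {h₁ h h₂ A B} → Gap h₁ A B → Gap h₂ A B → h₁ ℕ.≤ h → h ℕ.≤ h₂ → Gap h A B
  gap-between g₁ g₂ h₁≤h h≤h₂ = gap-move g₁ λ t → case gap-touch g₁ g₂ t of λ where
    (inj₁ y<h₁) → inj₁ (y<h₁ , ℕ.<-≤-trans y<h₁ h₁≤h)
    (inj₂ h₂≤y) → inj₂ (ℕ.≤-trans h₁≤h (ℕ.≤-trans h≤h₂ h₂≤y) , ℕ.≤-trans h≤h₂ h₂≤y)

  -- No touching node has a height from h up to that of the lowest candidate q, so nothing disturbs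
  -- the gap before q.
  next-above : ∀ {h A B} → Gap h A B → (∀ i → Touch A B i → Y i ℕ.< h) ⊎
    ∃ λ q → Touch A B q × h ℕ.≤ Y q × (∀ i → Touch A B i → h ℕ.≤ Y i → Y q ℕ.≤ Y i) × Gap (Y q) A B
  next-above {h} {A} {B} g with least (λ i → touch? A B i ×-dec h ℕ.≤? Y i) Y
  ... | inj₁ none = inj₁ λ i t → ℕ.≰⇒> λ h≤y → none i (t , h≤y)
  ... | inj₂ (q , (t , h≤q) , min) = inj₂ (q , t , h≤q , (λ i t′ h≤y → min i (t′ , h≤y)) , gap-move g side)
    where
    side : ∀ {i} → Touch A B i → (Y i ℕ.< h × Y i ℕ.< Y q) ⊎ (h ℕ.≤ Y i × Y q ℕ.≤ Y i)
    side {i} t′ with h ℕ.≤? Y i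
    ... | yes h≤y = inj₂ (h≤y , min i (t′ , h≤y))
    ... | no  h≰y = inj₁ (ℕ.≰⇒> h≰y , ℕ.<-≤-trans (ℕ.≰⇒> h≰y) h≤q)

  -- A gap which persists from just above p to just below q.
  record Edge (p q : Fin n) : Set where
    constructor edge
    field
      {A B} : ℕ
      lower : Gap (suc (Y p)) A B
      upper : Gap (Y q) A B
      start : Touch A B p
      end   : Touch A B q
      rise  : Y p ℕ.< Y q

  open Edge public

  -- The ends of a gap are at most n, which makes the search finite.
  edge? : Decidable Edge
  edge? p q = map′
    (λ { (a , b , l , u , s , e , r) → edge l u s e r })
    (λ { (edge {A} {B} l u s e r) →
      fromℕ< (s≤s (ℕ.≤-trans (A≤B l) (B≤n l))) , fromℕ< (s≤s (B≤n l)) ,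
      transport (s≤s (ℕ.≤-trans (A≤B l) (B≤n l))) (s≤s (B≤n l)) (l , u , s , e , r) })
    (Fin.any? λ a → Fin.any? λ b →
      gap? (suc (Y p)) (toℕ a) (toℕ b) ×-dec gap? (Y q) (toℕ a) (toℕ b) ×-dec
      touch? (toℕ a) (toℕ b) p ×-dec touch? (toℕ a) (toℕ b) q ×-dec Y p ℕ.<? Y q)
    where
    Via : ℕ → ℕ → Set
    Via a b = Gap (suc (Y p)) a b × Gap (Y q) a b × Touch a b p × Touch a b q × Y p ℕ.< Y q
    transport : ∀ {A B} (lA : A ℕ.< suc n) (lB : B ℕ.< suc n) →
      Via A B → Via (toℕ (fromℕ< lA)) (toℕ (fromℕ< lB))
    transport lA lB rewrite Fin.toℕ-fromℕ< lA | Fin.toℕ-fromℕ< lB = λ z → z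

  private
    lower-end : ∀ {p q p′ q′} (e : Edge p q) (e′ : Edge p′ q′) → A e ≡ A e′ → B e ≡ B e′ →
                Y p ℕ.< Y q′ → Y p ℕ.≤ Y p′
    lower-end e e′ ≡.refl ≡.refl p<q′ with gap-touch (lower e′) (upper e′) (start e)
    ... | inj₁ (s≤s le) = le
    ... | inj₂ q′≤p     = contradiction q′≤p (ℕ.<⇒≱ p<q′)

    upper-end : ∀ {p q p′ q′} (e : Edge p q) (e′ : Edge p′ q′) → A e ≡ A e′ → B e ≡ B e′ →
                Y p′ ℕ.< Y q → Y q′ ℕ.≤ Y q
    upper-end e e′ ≡.refl ≡.refl p′<q with gap-touch (lower e′) (upper e′) (end e)
    ... | inj₁ (s≤s q≤p′) = contradiction q≤p′ (ℕ.<⇒≱ p′<q)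
    ... | inj₂ le         = le

  OnEdge : ∀ {p q} → Edge p q → ℕ → Set
  OnEdge e c = A e ℕ.≤ c × c ℕ.≤ B e

  -- At the level just above the higher of p and p′ both gaps are present and contain c, so they are
  -- the same gap. Then each end of one edge touches the gap of the other and cannot lie within its
  -- lifetime, which forces equal heights.
  edges-overlap : ∀ {p q p′ q′} (e : Edge p q) (e′ : Edge p′ q′) c → OnEdge e c → OnEdge e′ c →
                  Y p ℕ.< Y q′ → Y p′ ℕ.< Y q → p ≡ p′ × q ≡ q′
  edges-overlap {p} {q} {p′} {q′} e e′ c (A≤c , c≤B) (A′≤c , c≤B′) p<q′ p′<q
    with gap-unique c
           (gap-between (lower e) (upper e) (s≤s (ℕ.m≤m⊔n (Y p) (Y p′))) (ℕ.⊔-lub (rise e) p′<q)) A≤c c≤B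
           (gap-between (lower e′) (upper e′) (s≤s (ℕ.m≤n⊔m (Y p) (Y p′))) (ℕ.⊔-lub p<q′ (rise e′))) A′≤c c≤B′
  ... | A≡ , B≡ =
    Y-injective (ℕ.≤-antisym (lower-end e e′ A≡ B≡ p<q′) (lower-end e′ e (≡.sym A≡) (≡.sym B≡) p′<q)) ,
    Y-injective (ℕ.≤-antisym (upper-end e′ e (≡.sym A≡) (≡.sym B≡) p<q′) (upper-end e e′ A≡ B≡ p′<q))

  -- The wall of a Λ-node hangs below it, so just above the node it bounds nothing and the gap
  -- reaches over the node. All edges upwards from i then share the column i, which gives a single
  -- parent.
  upward : ∀ {i q} (e : Edge i q) → ε i ≡ Sign.+ → A e ℕ.≤ toℕ i
  upward {i} e Λ with touch-cases (start e)
  ... | inj₁ (A≤i , _)  = A≤i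
  ... | inj₂ (inj₁ eq)  = contradiction (subst (λ s → Wall s _ _) Λ (left (lower e) i eq)) ℕ.1+n≰n
  ... | inj₂ (inj₂ eq)  = contradiction (subst (λ s → Wall s _ _) Λ (right (lower e) i eq)) ℕ.1+n≰n

  downward : ∀ {q i} (e : Edge q i) → ε i ≡ Sign.- → A e ℕ.≤ toℕ i
  downward {i = i} e V with touch-cases (end e)
  ... | inj₁ (A≤i , _)  = A≤i
  ... | inj₂ (inj₁ eq)  = contradiction (subst (λ s → Wall s _ _) V (left (upper e) i eq)) ℕ.1+n≰n
  ... | inj₂ (inj₂ eq)  = contradiction (subst (λ s → Wall s _ _) V (right (upper e) i eq)) ℕ.1+n≰n

  Λ-parent-unique : ∀ {i q q′} → ε i ≡ Sign.+ → Edge i q → Edge i q′ → q ≡ q′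
  Λ-parent-unique {i} Λ e e′ = proj₂ (edges-overlap e e′ (toℕ i)
    (upward e Λ , proj₂ (start e)) (upward e′ Λ , proj₂ (start e′)) (rise e′) (rise e))

  V-child-unique : ∀ {i q q′} → ε i ≡ Sign.- → Edge q i → Edge q′ i → q ≡ q′
  V-child-unique {i} V e e′ = proj₁ (edges-overlap e e′ (toℕ i)
    (downward e V , proj₂ (end e)) (downward e′ V , proj₂ (end e′)) (rise e) (rise e′))

  up-left-unique : ∀ {i q q′} → Edge i q → Edge i q′ → q Fin.< i → q′ Fin.< i → q ≡ q′
  up-left-unique {i} e e′ q<i q′<i = proj₂ (edges-overlap e e′ (toℕ i)
    (ℕ.≤-trans (proj₁ (end e)) q<i , proj₂ (start e))
    (ℕ.≤-trans (proj₁ (end e′)) q′<i , proj₂ (start e′)) (rise e′) (rise e))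

  up-right-unique : ∀ {i q q′} → Edge i q → Edge i q′ → i Fin.< q → i Fin.< q′ → q ≡ q′
  up-right-unique {i} e e′ i<q i<q′ = proj₂ (edges-overlap e e′ (suc (toℕ i))
    (proj₁ (start e) , ℕ.≤-trans i<q (proj₂ (end e)))
    (proj₁ (start e′) , ℕ.≤-trans i<q′ (proj₂ (end e′))) (rise e′) (rise e))

  down-left-unique : ∀ {i q q′} → Edge q i → Edge q′ i → q Fin.< i → q′ Fin.< i → q ≡ q′
  down-left-unique {i} e e′ q<i q′<i = proj₁ (edges-overlap e e′ (toℕ i)
    (ℕ.≤-trans (proj₁ (start e)) q<i , proj₂ (end e))
    (ℕ.≤-trans (proj₁ (start e′)) q′<i , proj₂ (end e′)) (rise e) (rise e′))

  down-right-unique : ∀ {i q q′} → Edge q i → Edge q′ i → i Fin.< q → i Fin.< q′ → q ≡ q′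
  down-right-unique {i} e e′ i<q i<q′ = proj₁ (edges-overlap e e′ (suc (toℕ i))
    (proj₁ (end e) , ℕ.≤-trans i<q (proj₂ (start e)))
    (proj₁ (end e′) , ℕ.≤-trans i<q′ (proj₂ (start e′))) (rise e) (rise e′))

  StrictlyBetween : Fin n → Fin n → Fin n → Set
  StrictlyBetween v w i = (v Fin.< i × i Fin.< w) ⊎ (w Fin.< i × i Fin.< v)

  between-inner : ∀ {A B v w i} → Touch A B v → Touch A B w → StrictlyBetween v w i →
                  A ℕ.≤ toℕ i × toℕ i ℕ.< B
  between-inner (A≤v , _) (_ , w≤B) (inj₁ (v<i , i<w)) = ℕ.≤-trans A≤v v<i , ℕ.<-≤-trans i<w w≤B
  between-inner (_ , v≤B) (A≤w , _) (inj₂ (w<i , i<v)) = ℕ.≤-trans A≤w w<i , ℕ.<-≤-trans i<v v≤B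

  -- A node inside the gap has no wall just above p, and a Λ-node without a wall is below the level.
  edge-above-Λ : ∀ {p q i} → Edge p q → StrictlyBetween p q i → ε i ≡ Sign.+ → Y i ℕ.< Y p
  edge-above-Λ {p} {q} {i} e b Λ with between-inner (start e) (end e) b
  ... | A≤i , i<B = ℕ.≤∧≢⇒< (ℕ.≤-pred (ℕ.≰⇒> (subst (λ s → ¬ Wall s _ _) Λ (inner (lower e) i A≤i i<B))))
    λ eq → case Y-injective eq of λ { ≡.refl → [ (λ (a , _) → ℕ.<-irrefl ≡.refl a) , (λ (_ , a) → ℕ.<-irrefl ≡.refl a) ]′ b }

  edge-below-V : ∀ {p q i} → Edge p q → StrictlyBetween p q i → ε i ≡ Sign.- → Y q ℕ.< Y i
  edge-below-V {p} {q} {i} e b V with between-inner (start e) (end e) b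
  ... | A≤i , i<B = ℕ.≤∧≢⇒< (ℕ.≮⇒≥ (subst (λ s → ¬ Wall s _ _) V (inner (upper e) i A≤i i<B)))
    λ eq → case Y-injective eq of λ { ≡.refl → [ (λ (_ , a) → ℕ.<-irrefl ≡.refl a) , (λ (a , _) → ℕ.<-irrefl ≡.refl a) ]′ b }

  Linked : Rel (Fin n) 0ℓ
  Linked i k = Edge i k ⊎ Edge k i

  linked-sym : ∀ {i k} → Linked i k → Linked k i
  linked-sym = [ inj₂ , inj₁ ]′

  Path : Rel (Fin n) 0ℓ
  Path = Star Linked

  path-sym : ∀ {i k} → Path i k → Path k i
  path-sym nil     = nil
  path-sym (l ◅ p) = path-sym p ◅◅ (linked-sym l ◅ nil)

  private
    wall-step : ∀ {r a} → a ≢ r → WallAt (suc (Y r)) a → WallAt (Y r) a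
    wall-step {r} {a} a≢r = wall-stable (ε a) (case ℕ.<-cmp (Y a) (Y r) of λ where
      (tri< y<r _ _) → inj₁ (ℕ.m≤n⇒m≤1+n y<r , y<r)
      (tri≈ _ y≡r _) → contradiction (Y-injective y≡r) a≢r
      (tri> _ _ r<y) → inj₂ (r<y , ℕ.<⇒≤ r<y))

    -- Passing r changes no wall but that of r. If the new gap stopped between c and r, the wall
    -- there would already have stood inside the old gap.
    touch-next : ∀ {r A B A′ B′ c} → Gap (Y r) A B → Touch A B r → A ℕ.≤ c → c ℕ.≤ B →
                 Gap (suc (Y r)) A′ B′ → A′ ℕ.≤ c → c ℕ.≤ B′ → Touch A′ B′ r
    touch-next {r} {A} {B} {A′} {B′} g (A≤1+r , r≤B) A≤c c≤B g′ A′≤c c≤B′ =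
      ℕ.≮⇒≥ (λ lt → lower′ A′ lt A′≤c (left g′)) , ℕ.≮⇒≥ upper′
      where
      lower′ : ∀ A′ → suc (toℕ r) ℕ.< A′ → A′ ℕ.≤ _ → (∀ i → suc (toℕ i) ≡ A′ → WallAt (suc (Y r)) i) → ⊥
      lower′ (suc a) (s≤s r<a) a<c wall =
        inner g i (subst (A ℕ.≤_) (≡.sym eq) (ℕ.≤-trans A≤1+r r<a)) (subst (ℕ._< B) (≡.sym eq) (ℕ.<-≤-trans a<c c≤B))
          (wall-step (λ i≡r → ℕ.<⇒≢ r<a (≡.trans (cong toℕ (≡.sym i≡r)) eq)) (wall i (cong suc eq)))
        where
        a<n = ℕ.<-≤-trans a<c (ℕ.≤-trans c≤B (B≤n g))
        i   = fromℕ< a<n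
        eq  = Fin.toℕ-fromℕ< a<n
      upper′ : ¬ B′ ℕ.< toℕ r
      upper′ b<r =
        inner g i (subst (A ℕ.≤_) (≡.sym eq) (ℕ.≤-trans A≤c c≤B′)) (subst (ℕ._< B) (≡.sym eq) (ℕ.<-≤-trans b<r r≤B))
          (wall-step (λ i≡r → ℕ.<⇒≢ b<r (≡.trans (≡.sym eq) (cong toℕ i≡r))) (right g′ i eq))
        where
        b<n = ℕ.<-trans b<r (Fin.toℕ<n r)
        i   = fromℕ< b<n
        eq  = Fin.toℕ-fromℕ< b<n

    -- Follow the column c upwards from p until q is met.
    climb : ∀ {A B c p q} → Acc ℕ._<_ (Y q ℕ.∸ Y p) → c ℕ.≤ n → Gap (suc (Y p)) A B → Touch A B p →
            A ℕ.≤ c → c ℕ.≤ B → c ≡ suc (toℕ q) ⊎ c ≡ toℕ q → Y p ℕ.< Y q → Path p q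
    climb {A} {B} {c} {p} {q} (acc rec) c≤n g tp A≤c c≤B beside p<q with next-above g
    ... | inj₁ none = contradiction p<q (ℕ.<⇒≯ (none′ beside))
      where
      none′ : c ≡ suc (toℕ q) ⊎ c ≡ toℕ q → Y q ℕ.< Y p
      none′ b = ℕ.≤∧≢⇒< (ℕ.≤-pred (none q (tq b))) (λ eq → ℕ.<⇒≢ p<q (≡.sym eq))
        where
        tq : c ≡ suc (toℕ q) ⊎ c ≡ toℕ q → Touch A B q
        tq (inj₁ ≡.refl) = A≤c , ℕ.≤-trans (ℕ.n≤1+n _) c≤B
        tq (inj₂ ≡.refl) = ℕ.m≤n⇒m≤1+n A≤c , c≤B
    ... | inj₂ (r , tr , p<r , min , g′) with Y r ℕ.<? Y q
    -- q touches the gap as well, because c is one of the two columns beside it; the lowest touching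
    -- node r is therefore q itself.
    ...   | no r≮q = inj₁ (edge g (subst (λ i → Gap (Y i) A B) r≡q g′) tp (tq beside) p<q) ◅ nil
      where
      tq : c ≡ suc (toℕ q) ⊎ c ≡ toℕ q → Touch A B q
      tq (inj₁ ≡.refl) = A≤c , ℕ.≤-trans (ℕ.n≤1+n _) c≤B
      tq (inj₂ ≡.refl) = ℕ.m≤n⇒m≤1+n A≤c , c≤B
      r≡q = Y-injective (ℕ.≤-antisym (min q (tq beside) p<q) (ℕ.≮⇒≥ r≮q))
    ...   | yes r<q with gap-search (suc (Y r)) c c≤n
    ...     | A′ , B′ , A′≤c , c≤B′ , g″ =
      inj₁ (edge g g′ tp tr p<r) ◅
      climb (rec (ℕ.∸-monoʳ-< p<r (ℕ.<⇒≤ r<q))) c≤n g″ (touch-next g′ tr A≤c c≤B g″ A′≤c c≤B′) A′≤c c≤B′ beside r<q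

  neighbours-connected : ∀ i k → toℕ k ≡ suc (toℕ i) → Path i k
  neighbours-connected i k k≡1+i with ℕ.<-cmp (Y i) (Y k)
  ... | tri≈ _ eq _ = case Y-injective eq of λ { ≡.refl → contradiction (≡.sym k≡1+i) ℕ.1+n≢n }
  ... | tri< i<k _ _ with gap-search (suc (Y i)) (suc (toℕ i)) (Fin.toℕ<n i)
  ...   | A , B , A≤c , c≤B , g =
    climb (<-wellFounded _) (Fin.toℕ<n i) g (A≤c , ℕ.<⇒≤ c≤B) A≤c c≤B (inj₂ (≡.sym k≡1+i)) i<k
  neighbours-connected i k k≡1+i | tri> _ _ k<i with gap-search (suc (Y k)) (suc (toℕ i)) (Fin.toℕ<n i)
  ...   | A , B , A≤c , c≤B , g =
    path-sym (climb (<-wellFounded _) (Fin.toℕ<n i) g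
      (ℕ.m≤n⇒m≤1+n (subst (A ℕ.≤_) (≡.sym k≡1+i) A≤c) , subst (ℕ._≤ B) (≡.sym k≡1+i) c≤B) A≤c c≤B (inj₁ ≡.refl) k<i)

  connected : ∀ i k → Path i k
  connected i k = path-sym (from-zero i) ◅◅ from-zero k
    where
    from-zero : ∀ i → Path zero i
    from-zero = Fin.<-weakInduction (Path zero) nil
      λ i p → p ◅◅ neighbours-connected (inject₁ i) (suc i) (cong suc (≡.sym (Fin.toℕ-inject₁ i)))

  -- χ is the indicator of the component above the edge e of the tree with e removed.
  record IsCut {p q} (e : Edge p q) (χ : Fin n → Bool) : Set where
    field
      near-above : ∀ i → Touch (A e) (B e) i → Y q ℕ.≤ Y i → χ i ≡ true
      near-below : ∀ i → Touch (A e) (B e) i → Y i ℕ.< Y q → χ i ≡ false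
      far-left   : ∀ i a → suc (toℕ a) ≡ A e → i Fin.≤ a → χ i ≡ χ a
      far-right  : ∀ i b → toℕ b ≡ B e → b Fin.≤ i → χ i ≡ χ b

  strictlyBetween-sym : ∀ {v w i} → StrictlyBetween v w i → StrictlyBetween w v i
  strictlyBetween-sym = [ inj₂ , inj₁ ]′

  module _ {p q} {e : Edge p q} {χ : Fin n → Bool} (cut : IsCut e χ) where
    open IsCut cut

    private
      Side : ℕ → Fin n → Set
      Side h i = (h ℕ.≤ Y i × χ i ≡ true) ⊎ (Y i ℕ.< h × χ i ≡ false)

      side : ∀ {i} → Touch (A e) (B e) i → Side (Y q) i
      side {i} t with Y q ℕ.≤? Y i
      ... | yes le = inj₁ (le , near-above i t le)
      ... | no ¬le = inj₂ (ℕ.≰⇒> ¬le , near-below i t (ℕ.≰⇒> ¬le))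

      touch-left : ∀ {a} → suc (toℕ a) ≡ A e → Touch (A e) (B e) a
      touch-left eq = ℕ.≤-reflexive (≡.sym eq) , ℕ.≤-trans (ℕ.n≤1+n _) (subst (ℕ._≤ B e) (≡.sym eq) (A≤B (lower e)))

      touch-right : ∀ {b} → toℕ b ≡ B e → Touch (A e) (B e) b
      touch-right eq = ℕ.≤-trans (A≤B (lower e)) (ℕ.m≤n⇒m≤1+n (ℕ.≤-reflexive (≡.sym eq))) , ℕ.≤-reflexive eq

      Same : ℕ → ℕ → ℕ → Set
      Same h y z = (h ℕ.≤ y × h ℕ.≤ z) ⊎ (y ℕ.< h × z ℕ.< h)

      -- An edge passes a node on the side away from its wall. If the wall meets the level h, the
      -- edge is either above a Λ-node which is itself above h, or below a V-node which is itself
      -- below h. In both cases its ends are on the same side of h as the node.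
      level : ∀ s {h h₁ h₂ y y₁ y₂} → h₁ ≡ suc y₁ → h₂ ≡ y₂ → y₁ ℕ.< y₂ → Wall s h y →
              ¬ Wall s h₁ y → ¬ Wall s h₂ y → Same h y y₁ × Same h y y₂
      level Sign.+ ≡.refl ≡.refl y₁<y₂ h≤y ¬w₁ _ =
        inj₁ (h≤y , ℕ.≤-trans h≤y (ℕ.≤-pred (ℕ.≰⇒> ¬w₁))) ,
        inj₁ (h≤y , ℕ.≤-trans h≤y (ℕ.≤-trans (ℕ.≤-pred (ℕ.≰⇒> ¬w₁)) (ℕ.<⇒≤ y₁<y₂)))
      level Sign.- ≡.refl ≡.refl y₁<y₂ y<h _ ¬w₂ =
        inj₂ (y<h , ℕ.<-trans (ℕ.<-≤-trans y₁<y₂ (ℕ.≮⇒≥ ¬w₂)) y<h) ,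
        inj₂ (y<h , ℕ.≤-<-trans (ℕ.≮⇒≥ ¬w₂) y<h)

      module _ {v w : Fin n} (e′ : Linked v w) where

        crossing : ∀ {a} → WallAt (Y q) a → StrictlyBetween v w a →
                   Same (Y q) (Y a) (Y v) × Same (Y q) (Y a) (Y w)
        crossing {a} wall b = go e′
          where
          go : Linked v w → _
          go (inj₁ e′) with between-inner (start e′) (end e′) b
          ... | A≤a , a<B = level (ε a) ≡.refl ≡.refl (rise e′) wall
                              (inner (lower e′) a A≤a a<B) (inner (upper e′) a A≤a a<B)
          go (inj₂ e′) with between-inner (start e′) (end e′) (strictlyBetween-sym b)
          ... | A≤a , a<B with level (ε a) ≡.refl ≡.refl (rise e′) wall
                              (inner (lower e′) a A≤a a<B) (inner (upper e′) a A≤a a<B)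
          ...   | same₁ , same₂ = same₂ , same₁

        same-χ : ∀ {i k} → Side (Y q) i → Side (Y q) k → Same (Y q) (Y i) (Y k) → χ i ≡ χ k
        same-χ (inj₁ (_ , a)) (inj₁ (_ , b)) _ = ≡.trans a (≡.sym b)
        same-χ (inj₂ (_ , a)) (inj₂ (_ , b)) _ = ≡.trans a (≡.sym b)
        same-χ (inj₁ (le , _)) (inj₂ (lt , _)) (inj₁ (_ , le′)) = contradiction le′ (ℕ.<⇒≱ lt)
        same-χ (inj₁ (le , _)) (inj₂ (lt , _)) (inj₂ (lt′ , _)) = contradiction le (ℕ.<⇒≱ lt′)
        same-χ (inj₂ (lt , _)) (inj₁ (le , _)) (inj₁ (le′ , _)) = contradiction le′ (ℕ.<⇒≱ lt)
        same-χ (inj₂ (lt , _)) (inj₁ (le , _)) (inj₂ (_ , lt′)) = contradiction le (ℕ.<⇒≱ lt′)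

        same-via : ∀ {i k l} → Same (Y q) (Y i) (Y l) → Same (Y q) (Y k) (Y l) → Same (Y q) (Y i) (Y k)
        same-via (inj₁ (a , _)) (inj₁ (b , _)) = inj₁ (a , b)
        same-via (inj₂ (a , _)) (inj₂ (b , _)) = inj₂ (a , b)
        same-via (inj₁ (_ , a)) (inj₂ (_ , b)) = contradiction a (ℕ.<⇒≱ b)
        same-via (inj₂ (_ , b)) (inj₁ (_ , a)) = contradiction a (ℕ.<⇒≱ b)

        a<b : ∀ {a b : Fin n} → suc (toℕ a) ≡ A e → toℕ b ≡ B e → a Fin.< b
        a<b eqᵃ eqᵇ = subst₂ ℕ._≤_ (≡.sym eqᵃ) (≡.sym eqᵇ) (A≤B (lower e))

        far-left-χ : ∀ a → suc (toℕ a) ≡ A e → v Fin.< a → χ v ≡ χ w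
        far-left-χ a eq v<a with toℕ w ℕ.≤? toℕ a
        ... | yes w≤a = ≡.trans (far-left v a eq (ℕ.<⇒≤ v<a)) (≡.sym (far-left w a eq w≤a))
        ... | no  w≰a = ≡.trans (far-left v a eq (ℕ.<⇒≤ v<a)) (χa≡χw (toℕ w ℕ.≤? B e))
          where
          a<w = ℕ.≰⇒> w≰a
          at-a = crossing (left (upper e) a eq) (inj₁ (v<a , a<w))
          χa≡χw : Dec (toℕ w ℕ.≤ B e) → χ a ≡ χ w
          χa≡χw (yes w≤B) = same-χ (side (touch-left eq)) (side (subst (ℕ._≤ _) eq (ℕ.m≤n⇒m≤1+n a<w) , w≤B)) (proj₂ at-a)
          -- The edge also passes the right wall; being on the same side as both wall nodes, it
          -- shows that these agree.
          χa≡χw (no w≰B) = ≡.trans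
            (same-χ (side (touch-left eq)) (side (touch-right b≡B))
              (same-via (proj₁ at-a) (proj₁ (crossing (right (upper e) b b≡B) (inj₁ (ℕ.<-trans v<a (a<b eq b≡B) , b<w))))))
            (≡.sym (far-right w b b≡B (ℕ.<⇒≤ b<w)))
            where
            B<n = ℕ.<-trans (ℕ.≰⇒> w≰B) (Fin.toℕ<n w)
            b   = fromℕ< B<n
            b≡B = Fin.toℕ-fromℕ< B<n
            b<w = subst (ℕ._< toℕ w) (≡.sym b≡B) (ℕ.≰⇒> w≰B)

        far-right-χ : ∀ b → toℕ b ≡ B e → b Fin.< v → χ v ≡ χ w
        far-right-χ b eq b<v with toℕ b ℕ.≤? toℕ w
        ... | yes b≤w = ≡.trans (far-right v b eq (ℕ.<⇒≤ b<v)) (≡.sym (far-right w b eq b≤w))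
        ... | no  b≰w = ≡.trans (far-right v b eq (ℕ.<⇒≤ b<v)) (χb≡χw (A e ℕ.≤? suc (toℕ w)))
          where
          w<b = ℕ.≰⇒> b≰w
          at-b = crossing (right (upper e) b eq) (inj₂ (w<b , b<v))
          χb≡χw : Dec (A e ℕ.≤ suc (toℕ w)) → χ b ≡ χ w
          χb≡χw (yes A≤w) = same-χ (side (touch-right eq)) (side (A≤w , subst (toℕ w ℕ.≤_) eq (ℕ.<⇒≤ w<b))) (proj₂ at-b)
          χb≡χw (no A≰w) = go (A e) ≡.refl
            where
            go : ∀ A′ → A′ ≡ A e → χ b ≡ χ w
            go zero A≡ = contradiction (subst (ℕ._≤ suc (toℕ w)) A≡ z≤n) A≰w
            go (suc a′) A≡ = ≡.trans
              (same-χ (side (touch-right eq)) (side (touch-left a≡A))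
                (same-via (proj₁ at-b) (proj₁ (crossing (left (upper e) a a≡A) (inj₂ (w<a , ℕ.<-trans (a<b a≡A eq) b<v))))))
              (≡.sym (far-left w a a≡A (ℕ.<⇒≤ w<a)))
              where
              a<n = ℕ.≤-trans (ℕ.≤-reflexive A≡) (ℕ.≤-trans (A≤B (lower e)) (B≤n (lower e)))
              a   = fromℕ< a<n
              a≡A = ≡.trans (cong suc (Fin.toℕ-fromℕ< a<n)) A≡
              w<a = ℕ.≤-pred (subst (suc (toℕ w) ℕ.<_) (≡.sym a≡A) (ℕ.≰⇒> A≰w))

      data Position (v : Fin n) : Set where
        near  : Touch (A e) (B e) v → Position v
        far-l : ∀ (a : Fin n) → suc (toℕ a) ≡ A e → v Fin.< a → Position v
        far-r : ∀ (b : Fin n) → toℕ b ≡ B e → b Fin.< v → Position v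

      position : ∀ v → Position v
      position v with A e ℕ.≤? suc (toℕ v) | toℕ v ℕ.≤? B e
      ... | yes A≤v | yes v≤B = near (A≤v , v≤B)
      ... | yes _   | no  v≰B = far-r (fromℕ< B<n) b≡B (subst (ℕ._< toℕ v) (≡.sym b≡B) (ℕ.≰⇒> v≰B))
        where
        B<n = ℕ.<-trans (ℕ.≰⇒> v≰B) (Fin.toℕ<n v)
        b≡B = Fin.toℕ-fromℕ< B<n
      ... | no  A≰v | _ = go (A e) ≡.refl
        where
        go : ∀ A′ → A′ ≡ A e → Position v
        go zero A≡ = contradiction (subst (ℕ._≤ suc (toℕ v)) A≡ z≤n) A≰v
        go (suc a′) A≡ = far-l (fromℕ< a<n) a≡A (ℕ.≤-pred (subst (suc (toℕ v) ℕ.<_) (≡.sym a≡A) (ℕ.≰⇒> A≰v)))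
          where
          a<n = ℕ.≤-trans (ℕ.≤-reflexive A≡) (ℕ.≤-trans (A≤B (lower e)) (B≤n (lower e)))
          a≡A = ≡.trans (cong suc (Fin.toℕ-fromℕ< a<n)) A≡

      shared-column : ∀ {p′ q′} (e′ : Edge p′ q′) → Touch (A e) (B e) p′ → Touch (A e) (B e) q′ →
                      ∃ λ c → OnEdge e c × OnEdge e′ c
      shared-column {p′} {q′} e′ tp tq with ℕ.<-cmp (toℕ p′) (toℕ q′)
      ... | tri< p<q _ _ = suc (toℕ p′) , (proj₁ tp , ℕ.≤-trans p<q (proj₂ tq)) ,
                           (proj₁ (start e′) , ℕ.≤-trans p<q (proj₂ (end e′)))
      ... | tri> _ _ q<p = suc (toℕ q′) , (proj₁ tq , ℕ.≤-trans q<p (proj₂ tp)) ,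
                           (proj₁ (end e′) , ℕ.≤-trans q<p (proj₂ (start e′)))
      ... | tri≈ _ eq _  = contradiction (cong Y (Fin.toℕ-injective eq)) (ℕ.<⇒≢ (rise e′))

    -- An edge with an end beyond a bounding wall either stays beyond it or passes the node of that
    -- wall, and `crossing` fixes its side. If both ends touch the gap and lie on different sides,
    -- the edge shares a column with e and overlaps it in height, so it is e.
    cut-constant : ∀ {p′ q′} → Edge p′ q′ → (p ≡ p′ × q ≡ q′) ⊎ χ p′ ≡ χ q′
    cut-constant {p′} {q′} e′ with position p′ | position q′
    ... | far-l a eq lt | _ = inj₂ (far-left-χ (inj₁ e′) a eq lt)
    ... | far-r b eq lt | _ = inj₂ (far-right-χ (inj₁ e′) b eq lt)
    ... | near _ | far-l a eq lt = inj₂ (≡.sym (far-left-χ (inj₂ e′) a eq lt))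
    ... | near _ | far-r b eq lt = inj₂ (≡.sym (far-right-χ (inj₂ e′) b eq lt))
    ... | near tp | near tq with side tp | side tq
    ...   | inj₁ (_ , a) | inj₁ (_ , b) = inj₂ (≡.trans a (≡.sym b))
    ...   | inj₂ (_ , a) | inj₂ (_ , b) = inj₂ (≡.trans a (≡.sym b))
    ...   | inj₁ (le , _) | inj₂ (lt , _) = contradiction (ℕ.<-≤-trans (rise e′) (ℕ.<⇒≤ lt)) (ℕ.≤⇒≯ le)
    ...   | inj₂ (lt , _) | inj₁ (le , _) with shared-column e′ tp tq
    ...     | c , on , on′ = inj₁ (edges-overlap e e′ c on on′ (ℕ.<-≤-trans (rise e) le) lt)

    cut-lower : χ p ≡ false
    cut-lower = near-below p (start e) (rise e)

    cut-upper : χ q ≡ true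
    cut-upper = near-above q (end e) ℕ.≤-refl

  -- The nearest node which touches the strand decides on which side a node lies.
  module _ {p q} (e : Edge p q) where

    private
      at : ℕ → Bool
      at k with k ℕ.<? n
      ... | yes k<n = does (Y q ℕ.≤? Y (fromℕ< k<n))
      ... | no  _   = false

      at-toℕ : ∀ i → at (toℕ i) ≡ does (Y q ℕ.≤? Y i)
      at-toℕ i with toℕ i ℕ.<? n
      ... | yes i<n = cong (λ k → does (Y q ℕ.≤? Y k)) (Fin.fromℕ<-toℕ i i<n)
      ... | no  i≮n = contradiction (Fin.toℕ<n i) i≮n

      -- The touching nodes run from A - 1 to B; for A = 0 the truncated difference is the first
      -- node. Clamping keeps the index of a node below n, so the default value of `at` is never
      -- taken.
      clamp : ℕ → ℕ
      clamp k = (A e ℕ.∸ 1) ℕ.⊔ (k ℕ.⊓ B e)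

      clamp-touch : ∀ {i} → Touch (A e) (B e) i → clamp (toℕ i) ≡ toℕ i
      clamp-touch (A≤1+i , i≤B) = ≡.trans (cong ((A e ℕ.∸ 1) ℕ.⊔_) (ℕ.m≤n⇒m⊓n≡m i≤B))
        (ℕ.m≤n⇒m⊔n≡n (ℕ.∸-monoˡ-≤ 1 A≤1+i))

      clamp-left : ∀ {i a : Fin n} → suc (toℕ a) ≡ A e → i Fin.≤ a → clamp (toℕ i) ≡ toℕ a
      clamp-left {i} {a} eq i≤a = ≡.trans (cong (λ k → (k ℕ.∸ 1) ℕ.⊔ (toℕ i ℕ.⊓ B e)) (≡.sym eq))
        (ℕ.m≥n⇒m⊔n≡m (ℕ.≤-trans (ℕ.m⊓n≤m (toℕ i) (B e)) i≤a))

      clamp-right : ∀ {i b : Fin n} → toℕ b ≡ B e → b Fin.≤ i → clamp (toℕ i) ≡ toℕ b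
      clamp-right {i} {b} eq b≤i = ≡.trans (cong ((A e ℕ.∸ 1) ℕ.⊔_) (ℕ.m≥n⇒m⊓n≡n (subst (ℕ._≤ toℕ i) eq b≤i)))
        (≡.trans (ℕ.m≤n⇒m⊔n≡n (ℕ.≤-trans (ℕ.m∸n≤m (A e) 1) (A≤B (lower e)))) (≡.sym eq))

    component : Fin n → Bool
    component i = at (clamp (toℕ i))

    component-isCut : IsCut e component
    component-isCut = record
      { near-above = λ i t le → ≡.trans (at-near t) (dec-true (Y q ℕ.≤? Y i) le)
      ; near-below = λ i t lt → ≡.trans (at-near t) (dec-false (Y q ℕ.≤? Y i) (ℕ.<⇒≱ lt))
      ; far-left   = λ i a eq i≤a → cong at (≡.trans (clamp-left eq i≤a) (≡.sym (clamp-left eq ℕ.≤-refl)))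
      ; far-right  = λ i b eq b≤i → cong at (≡.trans (clamp-right eq b≤i) (≡.sym (clamp-right eq ℕ.≤-refl)))
      }
      where
      at-near : ∀ {i} → Touch (A e) (B e) i → component i ≡ does (Y q ℕ.≤? Y i)
      at-near {i} t = ≡.trans (cong at (clamp-touch t)) (at-toℕ i)

-- Ordered fields

module OrderedFieldProperties {c ℓ₁ ℓ₂} (𝔽 : OrderedField c ℓ₁ ℓ₂) where

  open OrderedField 𝔽
  open CommutativeRing commutativeRing public using (ring; semiring; +-abelianGroup)
  open RingProperties ring public using (-0#≈0#; -‿distribˡ-*; -‿distribʳ-*)
  open GroupProperties +-abelianGroup public using (⁻¹-involutive; ⁻¹-∙-comm)
  open IsStrictPartialOrder isStrictPartialOrder public
    using () renaming (irrefl to <-irrefl; trans to <-trans; <-respʳ-≈ to <-respʳ; <-respˡ-≈ to <-respˡ)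
  open SemiringMult semiring public using (×-homo-+; ×1-homo-*)
  open SemiringSum semiring public using (sum-cong-≋; ∑-comm; *-distribˡ-sum; *-distribʳ-sum)

  private
    open import Relation.Binary.Reasoning.Setoid setoid

    cancel : ∀ x a b → (x + a) - (x + b) ≈ a - b
    cancel x a b = begin
      (x + a) + - (x + b)     ≈⟨ +-cong (+-comm x a) (sym (⁻¹-∙-comm x b)) ⟩
      (a + x) + (- x + - b)   ≈⟨ +-assoc a x _ ⟩
      a + (x + (- x + - b))   ≈⟨ +-congˡ (sym (+-assoc x _ _)) ⟩
      a + ((x + - x) + - b)   ≈⟨ +-congˡ (+-congʳ (-‿inverseʳ x)) ⟩
      a + (0# + - b)          ≈⟨ +-congˡ (+-identityˡ _) ⟩
      a - b                   ∎

    fromℤ-⊖ : ∀ m n → fromℤ (m ⊖ n) ≈ fromℕ m - fromℕ n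
    fromℤ-⊖ zero    zero    = sym (-‿inverseʳ _)
    fromℤ-⊖ zero    (suc n) = sym (+-identityˡ _)
    fromℤ-⊖ (suc m) zero    = sym (trans (+-congˡ -0#≈0#) (+-identityʳ _))
    fromℤ-⊖ (suc m) (suc n) = begin
      fromℤ (suc m ⊖ suc n)       ≡⟨ ≡.cong fromℤ (ℤ.[1+m]⊖[1+n]≡m⊖n m n) ⟩
      fromℤ (m ⊖ n)               ≈⟨ fromℤ-⊖ m n ⟩
      fromℕ m - fromℕ n           ≈⟨ sym (cancel 1# _ _) ⟩
      fromℕ (suc m) - fromℕ (suc n) ∎

  fromℕ-+ : ∀ m n → fromℕ (m ℕ.+ n) ≈ fromℕ m + fromℕ n
  fromℕ-+ = ×-homo-+ 1#

  fromℕ-* : ∀ m n → fromℕ (m ℕ.* n) ≈ fromℕ m * fromℕ n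
  fromℕ-* = ×1-homo-*

  fromℤ-neg : ∀ i → fromℤ (ℤ.- i) ≈ - fromℤ i
  fromℤ-neg (+ zero)  = sym -0#≈0#
  fromℤ-neg (+ suc n) = refl
  fromℤ-neg -[1+ n ]  = sym (⁻¹-involutive _)

  fromℤ-+ : ∀ i j → fromℤ (i ℤ.+ j) ≈ fromℤ i + fromℤ j
  fromℤ-+ (+ m)    (+ n)    = fromℕ-+ m n
  fromℤ-+ (+ m)    -[1+ n ] = fromℤ-⊖ m (suc n)
  fromℤ-+ -[1+ m ] (+ n)    = trans (fromℤ-⊖ n (suc m)) (+-comm _ _)
  fromℤ-+ -[1+ m ] -[1+ n ] = begin
    - fromℕ (suc (suc (m ℕ.+ n)))       ≡⟨ ≡.cong (λ k → - fromℕ (suc k)) (≡.sym (ℕ.+-suc m n)) ⟩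
    - fromℕ (suc m ℕ.+ suc n)           ≈⟨ -‿cong (fromℕ-+ (suc m) (suc n)) ⟩
    - (fromℕ (suc m) + fromℕ (suc n))   ≈⟨ sym (⁻¹-∙-comm _ _) ⟩
    - fromℕ (suc m) + - fromℕ (suc n)   ∎

  private
    fromℤ-*⁺ : ∀ m j → fromℤ (+ m ℤ.* j) ≈ fromℕ m * fromℤ j
    fromℤ-*⁺ m (+ n)    = trans (reflexive (≡.cong fromℤ (≡.sym (ℤ.pos-* m n)))) (fromℕ-* m n)
    fromℤ-*⁺ m -[1+ n ] = begin
      fromℤ (+ m ℤ.* ℤ.- (+ suc n))   ≡⟨ ≡.cong fromℤ (≡.sym (ℤ.neg-distribʳ-* (+ m) (+ suc n))) ⟩
      fromℤ (ℤ.- (+ m ℤ.* + suc n))   ≈⟨ fromℤ-neg (+ m ℤ.* + suc n) ⟩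
      - fromℤ (+ m ℤ.* + suc n)       ≈⟨ -‿cong (fromℤ-*⁺ m (+ suc n)) ⟩
      - (fromℕ m * fromℕ (suc n))     ≈⟨ -‿distribʳ-* _ _ ⟩
      fromℕ m * - fromℕ (suc n)       ∎

  fromℤ-* : ∀ i j → fromℤ (i ℤ.* j) ≈ fromℤ i * fromℤ j
  fromℤ-* (+ m)    j = fromℤ-*⁺ m j
  fromℤ-* -[1+ m ] j = begin
    fromℤ (ℤ.- (+ suc m) ℤ.* j)   ≡⟨ ≡.cong fromℤ (≡.sym (ℤ.neg-distribˡ-* (+ suc m) j)) ⟩
    fromℤ (ℤ.- (+ suc m ℤ.* j))   ≈⟨ fromℤ-neg (+ suc m ℤ.* j) ⟩
    - fromℤ (+ suc m ℤ.* j)       ≈⟨ -‿cong (fromℤ-*⁺ (suc m) j) ⟩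
    - (fromℕ (suc m) * fromℤ j)   ≈⟨ -‿distribˡ-* _ _ ⟩
    - fromℕ (suc m) * fromℤ j     ∎

  fromℤ-1 : fromℤ 1ℤ ≈ 1#
  fromℤ-1 = +-identityʳ 1#

  private
    fromℤ≟ : ∀ i j → Maybe (fromℤ i ≈ fromℤ j)
    fromℤ≟ i j with i ℤ.≟ j
    ... | yes ≡.refl = just refl
    ... | no  _      = nothing

    fromℤ-homomorphism : ℤ.+-*-rawRing -Raw-AlmostCommutative⟶ fromCommutativeRing commutativeRing
    fromℤ-homomorphism = record
      { ⟦_⟧ = fromℤ ; +-homo = fromℤ-+ ; *-homo = fromℤ-* ; -‿homo = fromℤ-neg
      ; 0-homo = refl ; 1-homo = fromℤ-1 }

  open RingSolver ℤ.+-*-rawRing (fromCommutativeRing commutativeRing) fromℤ-homomorphism fromℤ≟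
    public using (solve; _:=_; _:+_; _:*_; :-_; _:-_; con)

  <⇒# : ∀ {x y} → x < y → x # y
  <⇒# = Equivalence.from #⇔<⊎> ∘ inj₁

  <-asym : ∀ {x y} → x < y → ¬ y < x
  <-asym x<y y<x = <-irrefl refl (<-trans x<y y<x)

  <⇒≤ : ∀ {x y} → x < y → x ≤ y
  <⇒≤ = <-asym

  ≈⇒≤ : ∀ {x y} → x ≈ y → x ≤ y
  ≈⇒≤ x≈y y<x = <-irrefl (sym x≈y) y<x

  -- Cotransitivity of apartness, the substitute for trichotomy: one of two comparisons of z can
  -- always be decided.
  <-cotrans : ∀ {x y} → x < y → ∀ z → x < z ⊎ z < y
  <-cotrans x<y z with #-cotrans (<⇒# x<y) z
  ... | inj₁ x#z = [ inj₁ , (λ z<x → inj₂ (<-trans z<x x<y)) ]′ (Equivalence.to #⇔<⊎> x#z)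
  ... | inj₂ z#y = [ inj₂ , (λ y<z → inj₁ (<-trans x<y y<z)) ]′ (Equivalence.to #⇔<⊎> z#y)

  ≤-<-trans : ∀ {x y z} → x ≤ y → y < z → x < z
  ≤-<-trans {x} x≤y y<z = [ (λ y<x → contradiction y<x x≤y) , (λ x<z → x<z) ]′ (<-cotrans y<z x)

  <-≤-trans : ∀ {x y z} → x < y → y ≤ z → x < z
  <-≤-trans {z = z} x<y y≤z = [ (λ x<z → x<z) , (λ z<y → contradiction z<y y≤z) ]′ (<-cotrans x<y z)

  ≤-trans : ∀ {x y z} → x ≤ y → y ≤ z → x ≤ z
  ≤-trans x≤y y≤z z<x = y≤z (<-≤-trans z<x x≤y)

  ≤-antisym : ∀ {x y} → x ≤ y → y ≤ x → x ≈ y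
  ≤-antisym x≤y y≤x = proj₁ (tight _ _) λ x#y →
    [ y≤x , x≤y ]′ (Equivalence.to #⇔<⊎> x#y)

  x<y⇒0<y-x : ∀ {x y} → x < y → 0# < y - x
  x<y⇒0<y-x {x} x<y = <-respˡ (-‿inverseʳ x) (+-monoˡ-< (- x) x<y)

  0<y-x⇒x<y : ∀ {x y} → 0# < y - x → x < y
  0<y-x⇒x<y {x} {y} 0<y-x = <-respˡ (+-identityˡ x) (<-respʳ
    (solve 2 (λ x y → (y :- x) :+ x := y) refl x y) (+-monoˡ-< x 0<y-x))

  x≤y⇒0≤y-x : ∀ {x y} → x ≤ y → 0# ≤ y - x
  x≤y⇒0≤y-x {x} {y} x≤y y-x<0 = x≤y (0<y-x⇒x<y (<-respʳ
    (solve 2 (λ x y → con 0ℤ :- (y :- x) := x :- y) refl x y) (x<y⇒0<y-x y-x<0)))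

  0≤y-x⇒x≤y : ∀ {x y} → 0# ≤ y - x → x ≤ y
  0≤y-x⇒x≤y {x} {y} 0≤y-x y<x = 0≤y-x (0<y-x⇒x<y (<-respʳ
    (solve 2 (λ x y → x :- y := con 0ℤ :- (y :- x)) refl x y) (x<y⇒0<y-x y<x)))

  ≤-respʳ : ∀ {x y z} → y ≈ z → x ≤ y → x ≤ z
  ≤-respʳ y≈z x≤y z<x = x≤y (<-respˡ (sym y≈z) z<x)

  ≤-respˡ : ∀ {x y z} → y ≈ z → y ≤ x → z ≤ x
  ≤-respˡ y≈z y≤x x<z = y≤x (<-respʳ (sym y≈z) x<z)

  +-mono-< : ∀ {a b x y} → a < b → x < y → a + x < b + y
  +-mono-< {a} {b} {x} {y} a<b x<y = <-trans (+-monoˡ-< x a<b)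
    (<-respˡ (+-comm x b) (<-respʳ (+-comm y b) (+-monoˡ-< b x<y)))

  +-mono-<-≤ : ∀ {a b x y} → a < b → x ≤ y → a + x < b + y
  +-mono-<-≤ {a} {b} {x} {y} a<b x≤y = <-≤-trans (+-monoˡ-< x a<b)
    (0≤y-x⇒x≤y (≤-respʳ (solve 3 (λ b x y → y :- x := (b :+ y) :- (b :+ x)) refl b x y) (x≤y⇒0≤y-x x≤y)))

  +-mono-≤ : ∀ {a b x y} → a ≤ b → x ≤ y → a + x ≤ b + y
  +-mono-≤ {a} {b} {x} {y} a≤b x≤y lt = x≤y (0<y-x⇒x<y (<-respʳ
    (solve 2 (λ x y → x :- y := x :- y) refl x y)
    ([ (λ z → z) , (λ z → contradiction z (λ z → a≤b (0<y-x⇒x<y z))) ]′ split)))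
    where
    sum-pos : 0# < (a - b) + (x - y)
    sum-pos = <-respʳ (solve 4 (λ a b x y → (a :+ x) :- (b :+ y) := (a :- b) :+ (x :- y)) refl a b x y) (x<y⇒0<y-x lt)
    split : 0# < x - y ⊎ 0# < a - b
    split with <-cotrans sum-pos (a - b)
    ... | inj₁ p = inj₂ p
    ... | inj₂ p = inj₁ (<-respʳ (solve 4 (λ a b x y → ((a :- b) :+ (x :- y)) :- (a :- b) := x :- y) refl a b x y) (x<y⇒0<y-x p))

  +-nonneg : ∀ {x y} → 0# ≤ x → 0# ≤ y → 0# ≤ x + y
  +-nonneg 0≤x 0≤y = ≤-respˡ (+-identityˡ 0#) (+-mono-≤ 0≤x 0≤y)

  0<1 : 0# < 1#
  0<1 with Equivalence.to #⇔<⊎> (ApartnessProperties.1#0 heytingCommutativeRing)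
  ... | inj₂ 0<1 = 0<1
  ... | inj₁ 1<0 = <-respʳ (trans (solve 0 ((con 0ℤ :- con 1ℤ) :* (con 0ℤ :- con 1ℤ) := con 1ℤ) refl) fromℤ-1) (*-pos p p)
    where
    p : 0# < fromℤ 0ℤ - fromℤ 1ℤ
    p = <-respʳ (+-congˡ (-‿cong (sym fromℤ-1))) (x<y⇒0<y-x 1<0)

  private
    factor#0 : ∀ {x y} → x * y # 0# → x # 0#
    factor#0 {x} {y} xy#0 with #⇒invertible xy#0
    ... | z , _ , xyz≈1 = ApartnessProperties.invertibleʳ⇒# heytingCommutativeRing
      (y * z , trans (solve 3 (λ x y z → (x :- con 0ℤ) :* (y :* z) := (x :* y :- con 0ℤ) :* z) refl x y z) xyz≈1)

  -- The signs of x and y cannot be inspected. But a negative product is invertible, so both factors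
  -- are apart from 0, hence positive, and then so is the product.
  *-nonneg : ∀ {x y} → 0# ≤ x → 0# ≤ y → 0# ≤ x * y
  *-nonneg {x} {y} 0≤x 0≤y xy<0 = <-asym xy<0 (*-pos (pos 0≤x (factor#0 xy#0)) (pos 0≤y (factor#0 yx#0)))
    where
    xy#0 = <⇒# xy<0
    yx#0 = <⇒# (<-respˡ (*-comm x y) xy<0)
    pos : ∀ {x} → 0# ≤ x → x # 0# → 0# < x
    pos 0≤x x#0 = [ (λ x<0 → contradiction x<0 0≤x) , (λ z → z) ]′ (Equivalence.to #⇔<⊎> x#0)

  private
    reciprocal-positive : ∀ {x y} → 0# < x → x * y ≈ 1# → 0# < y
    reciprocal-positive {x} {y} 0<x xy≈1 =
      [ (λ y<0 → contradiction (xy<0 y<0) (<-asym 0<xy)) , (λ 0<y → 0<y) ]′ (Equivalence.to #⇔<⊎> y#0)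
      where
      0<xy : 0# < x * y
      0<xy = <-respʳ (sym xy≈1) 0<1
      y#0 : y # 0#
      y#0 = factor#0 (#-sym (<⇒# (<-respʳ (*-comm x y) 0<xy)))
      xy<0 : y < 0# → x * y < 0#
      xy<0 y<0 = 0<y-x⇒x<y (<-respʳ (solve 2 (λ x y → x :* (con 0ℤ :- y) := con 0ℤ :- x :* y) refl x y)
        (*-pos 0<x (x<y⇒0<y-x y<0)))

    inverse-of-apart : ∀ {x} → x # 0# → ∃ λ y → x * y ≈ 1#
    inverse-of-apart {x} x#0 with #⇒invertible x#0
    ... | y , _ , xy≈1 = y , trans (*-congʳ (sym (ApartnessProperties.x-0≈x heytingCommutativeRing x))) xy≈1

  abstract
    inverse : ∀ {x} → 0# < x → ∃ λ y → 0# < y × x * y ≈ 1#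
    inverse 0<x with inverse-of-apart (#-sym (<⇒# 0<x))
    ... | y , xy≈1 = y , reciprocal-positive 0<x xy≈1 , xy≈1

  *-monoʳ-< : ∀ {x y z} → 0# < z → x < y → x * z < y * z
  *-monoʳ-< {x} {y} {z} 0<z x<y = 0<y-x⇒x<y (<-respʳ
    (solve 3 (λ x y z → (y :- x) :* z := y :* z :- x :* z) refl x y z) (*-pos (x<y⇒0<y-x x<y) 0<z))

  fromℕ-nonneg : ∀ k → 0# ≤ fromℕ k
  fromℕ-nonneg zero    = ≈⇒≤ refl
  fromℕ-nonneg (suc k) = +-nonneg (<⇒≤ 0<1) (fromℕ-nonneg k)

  fromℕ-pos : ∀ k → 0# < fromℕ (suc k)
  fromℕ-pos k = <-respˡ (+-identityˡ 0#) (+-mono-<-≤ 0<1 (fromℕ-nonneg k))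

  fromℕ-mono-< : ∀ {j k} → j ℕ.< k → fromℕ j < fromℕ k
  fromℕ-mono-< {zero}  {suc k} _ = fromℕ-pos k
  fromℕ-mono-< {suc j} {suc k} (ℕ.s≤s j<k) = <-respˡ (+-comm _ 1#) (<-respʳ (+-comm _ 1#) (+-monoˡ-< 1# (fromℕ-mono-< j<k)))

  fromℕ-mono-≤ : ∀ {j k} → j ℕ.≤ k → fromℕ j ≤ fromℕ k
  fromℕ-mono-≤ j≤k = case ℕ.m≤n⇒m<n∨m≡n j≤k of λ where
    (inj₁ j<k)    → <⇒≤ (fromℕ-mono-< j<k)
    (inj₂ ≡.refl) → ≈⇒≤ refl

  mix : Carrier → Carrier → Carrier → Carrier
  mix s a b = (1# - s) * a + s * b

  private
    mix-shift : ∀ s k a b → (1# - s) * (a - k) + s * (b - k) ≈ mix s a b - k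
    mix-shift s k a b = begin
      (1# - s) * (a - k) + s * (b - k)
        ≈⟨ solve 5 (λ u s k a b → (u :- s) :* (a :- k) :+ s :* (b :- k) := ((u :- s) :* a :+ s :* b) :- u :* k) refl 1# s k a b ⟩
      mix s a b - 1# * k
        ≈⟨ +-congˡ (-‿cong (*-identityˡ k)) ⟩
      mix s a b - k ∎

    mix-shift′ : ∀ s k a b → (1# - s) * (k - a) + s * (k - b) ≈ k - mix s a b
    mix-shift′ s k a b = begin
      (1# - s) * (k - a) + s * (k - b)
        ≈⟨ solve 5 (λ u s k a b → (u :- s) :* (k :- a) :+ s :* (k :- b) := u :* k :- ((u :- s) :* a :+ s :* b)) refl 1# s k a b ⟩
      1# * k - mix s a b
        ≈⟨ +-congʳ (*-identityˡ k) ⟩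
      k - mix s a b ∎

    mix-pos : ∀ {s x y} → 0# ≤ s → s ≤ 1# → 0# < x → 0# < y → 0# < (1# - s) * x + s * y
    mix-pos {s} 0≤s s≤1 0<x 0<y with <-cotrans 0<1 s
    ... | inj₁ 0<s = <-respˡ (+-identityˡ 0#) (<-respʳ (+-comm _ _)
            (+-mono-<-≤ (*-pos 0<s 0<y) (*-nonneg (x≤y⇒0≤y-x s≤1) (<⇒≤ 0<x))))
    ... | inj₂ s<1 = <-respˡ (+-identityˡ 0#)
            (+-mono-<-≤ (*-pos (x<y⇒0<y-x s<1) 0<x) (*-nonneg 0≤s (<⇒≤ 0<y)))

    pinned : ∀ {s d} → 0# ≤ s → 0# < d → s * d ≤ 0# → s ≈ 0#
    pinned 0≤s 0<d sd≤0 = ≤-antisym (λ 0<s → sd≤0 (*-pos 0<s 0<d)) 0≤s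

  mix-≤ : ∀ {s k a b} → 0# ≤ s → s ≤ 1# → a ≤ k → b ≤ k → mix s a b ≤ k
  mix-≤ {s} {k} {a} {b} 0≤s s≤1 a≤k b≤k = 0≤y-x⇒x≤y (≤-respʳ (mix-shift′ s k a b)
    (+-nonneg (*-nonneg (x≤y⇒0≤y-x s≤1) (x≤y⇒0≤y-x a≤k)) (*-nonneg 0≤s (x≤y⇒0≤y-x b≤k))))

  mix-> : ∀ {s k a b} → 0# ≤ s → s ≤ 1# → k < a → k < b → k < mix s a b
  mix-> {s} {k} {a} {b} 0≤s s≤1 k<a k<b = 0<y-x⇒x<y (<-respʳ (mix-shift s k a b)
    (mix-pos 0≤s s≤1 (x<y⇒0<y-x k<a) (x<y⇒0<y-x k<b)))

  mix-< : ∀ {s k a b} → 0# ≤ s → s ≤ 1# → a < k → b < k → mix s a b < k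
  mix-< {s} {k} {a} {b} 0≤s s≤1 a<k b<k = 0<y-x⇒x<y (<-respʳ (mix-shift′ s k a b)
    (mix-pos 0≤s s≤1 (x<y⇒0<y-x a<k) (x<y⇒0<y-x b<k)))

  -- The mixture exceeds a by s * (b - a), so s cannot be positive. This is how two segments on
  -- different sides of a line through a common end are shown to meet in that end only.
  pinned-≤ : ∀ {s a b} → 0# ≤ s → a < b → mix s a b ≤ a → s ≈ 0#
  pinned-≤ {s} {a} {b} 0≤s a<b le = pinned 0≤s (x<y⇒0<y-x a<b) (λ 0<sd → le (0<y-x⇒x<y (<-respʳ sd 0<sd)))
    where
    sd : s * (b - a) ≈ mix s a b - a
    sd = trans (solve 4 (λ u s a b → s :* (b :- a) := (u :- s) :* (a :- a) :+ s :* (b :- a)) refl 1# s a b) (mix-shift s a a b)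

  pinned-≥ : ∀ {s a b} → 0# ≤ s → b < a → a ≤ mix s a b → s ≈ 0#
  pinned-≥ {s} {a} {b} 0≤s b<a le = pinned 0≤s (x<y⇒0<y-x b<a) (λ 0<sd → le (0<y-x⇒x<y (<-respʳ sd 0<sd)))
    where
    sd : s * (a - b) ≈ a - mix s a b
    sd = trans (solve 4 (λ u s a b → s :* (a :- b) := (u :- s) :* (a :- a) :+ s :* (a :- b)) refl 1# s a b) (mix-shift′ s a a b)

  mix-zero : ∀ {s} a b → s ≈ 0# → mix s a b ≈ a
  mix-zero {s} a b s≈0 = begin
    (1# - s) * a + s * b     ≈⟨ +-cong (*-congʳ (+-congˡ (-‿cong s≈0))) (*-congʳ s≈0) ⟩
    (1# - 0#) * a + 0# * b   ≈⟨ solve 3 (λ u a b → (u :- con 0ℤ) :* a :+ con 0ℤ :* b := u :* a) refl 1# a b ⟩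
    1# * a                   ≈⟨ *-identityˡ a ⟩
    a                        ∎

  mix-flip : ∀ s a b → mix s a b ≈ mix (1# - s) b a
  mix-flip s a b = solve 4 (λ u s a b → (u :- s) :* a :+ s :* b := (u :- (u :- s)) :* b :+ (u :- s) :* a) refl 1# s a b

-- The drawing in the plane

Finite : Set → Set
Finite A = ∃ λ k → Fin k ↔ A

T-finite : ∀ b → Finite (T b)
T-finite true  = 1 , mk↔ₛ′ (const tt) (const zero) (λ _ → ≡.refl) (λ { zero → ≡.refl })
T-finite false = 0 , mk↔ₛ′ (λ ()) (λ ()) (λ ()) (λ ())

Σ-finite : ∀ {n} {B : Fin n → Set} → (∀ i → Finite (B i)) → Finite (Σ (Fin n) B)
Σ-finite {zero}  fin = 0 , mk↔ₛ′ (λ ()) (λ ()) (λ ()) (λ ())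
Σ-finite {suc n} {B} fin with fin zero | Σ-finite (fin ∘ suc)
... | j , f | k , g = j ℕ.+ k , ↔-trans Fin.+↔⊎ (mk↔ₛ′ fwd bwd
  (λ { (zero , y) → cong (zero ,_) (strictlyInverseˡ f y)
     ; (suc i , y) → cong (λ (i , y) → (suc i , y)) (strictlyInverseˡ g (i , y)) })
  (λ { (inj₁ a) → cong inj₁ (strictlyInverseʳ f a) ; (inj₂ b) → cong inj₂ (strictlyInverseʳ g b) }))
  where
  open Inverse
  fwd : Fin j ⊎ Fin k → Σ (Fin (suc n)) B
  fwd (inj₁ a) = zero , to f a
  fwd (inj₂ b) = let i , y = to g b in suc i , y
  bwd : Σ (Fin (suc n)) B → Fin j ⊎ Fin k
  bwd (zero  , y) = inj₁ (from f y)
  bwd (suc i , y) = inj₂ (from g (i , y))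

-- The three places around a node: the lone parent of a Λ-node or child of a V-node, which may lie
-- on either side, and the two neighbours in the opposite direction, which the wall separates into
-- left and right.
Slot : Set
Slot = Fin 3

pattern single = 0F
pattern left′  = 1F
pattern right′ = 2F

-- As a direction, Sign.+ is upwards.
dir : Sign → Slot → Sign
dir s single = s
dir s left′  = opposite s
dir s right′ = opposite s

Fits : ∀ {n} → Slot → Rel (Fin n) 0ℓ
Fits single i k = ⊤
Fits left′  i k = k Fin.< i
Fits right′ i k = i Fin.< k

module Slots {m : ℕ} (ε : Vector Sign (suc m)) (Y : Fin (suc m) → ℕ) (Y-injective : Injective _≡_ _≡_ Y) where

  open Gaps ε Y Y-injective

  Link : Sign → Rel (Fin n) 0ℓ
  Link Sign.+ i k = Edge i k
  Link Sign.- i k = Edge k i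

  InSlot : Fin n → Slot → Fin n → Set
  InSlot i s k = Link (dir (ε i) s) i k × Fits s i k

  link? : ∀ d i k → Dec (Link d i k)
  link? Sign.+ i k = edge? i k
  link? Sign.- i k = edge? k i

  fits? : ∀ s (i k : Fin n) → Dec (Fits s i k)
  fits? single i k = yes tt
  fits? left′  i k = k Fin.<? i
  fits? right′ i k = i Fin.<? k

  inSlot? : ∀ i s k → Dec (InSlot i s k)
  inSlot? i s k = link? (dir (ε i) s) i k ×-dec fits? s i k

  inSlot-unique : ∀ {i s k k′} → InSlot i s k → InSlot i s k′ → k ≡ k′
  inSlot-unique {i} {s} (l , f) (l′ , f′) with ε i in eq
  inSlot-unique {s = single} (l , f) (l′ , f′) | Sign.+ = Λ-parent-unique eq l l′
  inSlot-unique {s = left′}  (l , f) (l′ , f′) | Sign.+ = down-left-unique l l′ f f′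
  inSlot-unique {s = right′} (l , f) (l′ , f′) | Sign.+ = down-right-unique l l′ f f′
  inSlot-unique {s = single} (l , f) (l′ , f′) | Sign.- = V-child-unique eq l l′
  inSlot-unique {s = left′}  (l , f) (l′ , f′) | Sign.- = up-left-unique l l′ f f′
  inSlot-unique {s = right′} (l , f) (l′ , f′) | Sign.- = up-right-unique l l′ f f′

  linked-distinct : ∀ {i k} → Linked i k → i ≢ k
  linked-distinct (inj₁ e) ≡.refl = ℕ.<-irrefl ≡.refl (rise e)
  linked-distinct (inj₂ e) ≡.refl = ℕ.<-irrefl ≡.refl (rise e)

  slot-of : ∀ {i k} → Linked i k → ∃ λ s → InSlot i s k
  slot-of {i} {k} l with ε i | Fin.<-cmp k i | l
  ... | _      | tri≈ _ k≡i _ | _       = contradiction (≡.sym k≡i) (linked-distinct l)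
  ... | Sign.+ | _            | inj₁ e  = single , e , tt
  ... | Sign.+ | tri< k<i _ _ | inj₂ e  = left′ , e , k<i
  ... | Sign.+ | tri> _ _ i<k | inj₂ e  = right′ , e , i<k
  ... | Sign.- | _            | inj₂ e  = single , e , tt
  ... | Sign.- | tri< k<i _ _ | inj₁ e  = left′ , e , k<i
  ... | Sign.- | tri> _ _ i<k | inj₁ e  = right′ , e , i<k

  link⇒linked : ∀ d {i k} → Link d i k → Linked i k
  link⇒linked Sign.+ = inj₁
  link⇒linked Sign.- = inj₂

  inSlot⇒linked : ∀ {i s k} → InSlot i s k → Linked i k
  inSlot⇒linked {i} {s} (l , _) = link⇒linked (dir (ε i) s) l

  abstract
    -- A Boolean rather than a negated existence statement: its proofs are unique, so a leaf is
    -- determined by its node and slot, and the vertices can be enumerated.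
    vacant : Fin n → Slot → Bool
    vacant i s = not (does (Fin.any? (inSlot? i s)))

  present : Fin n → Fin 4 → Bool
  present i zero    = true
  present i (suc s) = vacant i s

  -- The internal nodes and, in every slot without an internal neighbour, a leaf.
  V : Set
  V = Σ (Fin n) λ i → Σ (Fin 4) λ s → T (present i s)

  pattern node i     = i , zero , tt
  pattern leaf i s f = i , suc s , f

  abstract
    V-finite : Finite V
    V-finite = Σ-finite λ i → Σ-finite λ s → T-finite (present i s)

  AdjV : Rel V 0ℓ
  AdjV (node i)     (node k)     = Linked i k
  AdjV (node i)     (leaf k _ _) = i ≡ k
  AdjV (leaf i _ _) (node k)     = i ≡ k
  AdjV (leaf _ _ _) (leaf _ _ _) = ⊥

  adjV? : Decidable AdjV
  adjV? (node i)     (node k)     = edge? i k ⊎-dec edge? k i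
  adjV? (node i)     (leaf k _ _) = i Fin.≟ k
  adjV? (leaf i _ _) (node k)     = i Fin.≟ k
  adjV? (leaf _ _ _) (leaf _ _ _) = no λ ()

  adjV-sym : ∀ u v → AdjV u v → AdjV v u
  adjV-sym (node i)     (node k)     l = linked-sym l
  adjV-sym (node i)     (leaf k _ _) l = ≡.sym l
  adjV-sym (leaf i _ _) (node k)     l = ≡.sym l

  adjV-irrefl : ∀ u → ¬ AdjV u u
  adjV-irrefl (node i) l = linked-distinct l ≡.refl

  leaf-cong : ∀ {i s f f′} → _≡_ {A = V} (leaf i s f) (leaf i s f′)
  leaf-cong {i} {s} {f} {f′} = cong (λ f → leaf i s f) (Bool.T-irrelevant f f′)

  data NbView (i : Fin n) (s : Slot) : V → Set where
    is-node : ∀ {k} → InSlot i s k → NbView i s (node k)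
    is-leaf : ∀ {f} → NbView i s (leaf i s f)

  abstract
    private
      choose : ∀ {i s} (d : Dec (∃ (InSlot i s))) → (does d ≡ false → T (vacant i s)) → V
      choose         (yes (k , _)) _    = node k
      choose {i} {s} (no _)        free = leaf i s (free ≡.refl)

    nb : Fin n → Slot → V
    nb i s = choose (Fin.any? (inSlot? i s)) λ free → subst (T ∘ not) (≡.sym free) tt

    nb-view : ∀ i s → NbView i s (nb i s)
    nb-view i s = view (Fin.any? (inSlot? i s)) _
      where
      view : (d : Dec (∃ (InSlot i s))) (free : does d ≡ false → T (vacant i s)) → NbView i s (choose d free)
      view (yes (k , inSlot)) _ = is-node inSlot
      view (no _)             _ = is-leaf

    leaf-free : ∀ {i s} → T (vacant i s) → ∀ k → ¬ InSlot i s k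
    leaf-free {i} {s} f k inSlot with does (Fin.any? (inSlot? i s)) | dec-true (Fin.any? (inSlot? i s)) (k , inSlot)
    ... | _ | ≡.refl = f

  node≡nb : ∀ {i s k} → InSlot i s k → node k ≡ nb i s
  node≡nb {i} {s} inSlot with nb i s | nb-view i s
  ... | _ | is-node inSlot′ = cong (λ k → node k) (inSlot-unique inSlot inSlot′)
  ... | _ | is-leaf {f}     = contradiction inSlot (leaf-free f _)

  leaf≡nb : ∀ {i s} f → leaf i s f ≡ nb i s
  leaf≡nb {i} {s} f with nb i s | nb-view i s
  ... | _ | is-node inSlot = contradiction inSlot (leaf-free f _)
  ... | _ | is-leaf        = leaf-cong

  adj-nb : ∀ i s → AdjV (node i) (nb i s)
  adj-nb i s with nb i s | nb-view i s
  ... | _ | is-node inSlot = inSlot⇒linked {s = s} inSlot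
  ... | _ | is-leaf        = ≡.refl

  nb-complete : ∀ i w → AdjV (node i) w → ∃ λ s → w ≡ nb i s
  nb-complete i (node k)      l      = let s , inSlot = slot-of l in s , node≡nb inSlot
  nb-complete i (leaf _ s f) ≡.refl = s , leaf≡nb f

  -- Coordinates, with the abscissae scaled by 3; leaf edges are so short that
  -- they meet nothing but the edges at their own node.
  ξ υ : V → ℕ
  ξ (node i)          = 3 ℕ.+ 3 ℕ.* toℕ i
  ξ (leaf i left′ _)  = 2 ℕ.+ 3 ℕ.* toℕ i
  -- A leaf in the single slot is moved aside as well, so that no other vertex has the abscissa of a
  -- node.
  ξ (leaf i _ _)      = 4 ℕ.+ 3 ℕ.* toℕ i
  -- Nodes have odd heights, which leaves an even one on either side for the leaves; the summand 1
  -- keeps the lower one in ℕ.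
  υ (node i)          = 1 ℕ.+ 2 ℕ.* Y i
  υ (leaf i s _) with dir (ε i) s
  ... | Sign.+ = 2 ℕ.+ 2 ℕ.* Y i
  ... | Sign.- = 2 ℕ.* Y i

  data Axis : Set where
    x-axis y-axis : Axis

  nat : Axis → V → ℕ
  nat x-axis = ξ
  nat y-axis = υ

  ξ-mono : ∀ {i k : Fin n} → i Fin.< k → 4 ℕ.+ 3 ℕ.* toℕ i ℕ.< 3 ℕ.+ 3 ℕ.* toℕ k
  ξ-mono {i} {k} i<k = ℕ.≤-trans (ℕ.≤-trans (ℕ.n≤1+n _) (ℕ.≤-reflexive (cong (3 ℕ.+_) (≡.sym (ℕ.*-suc 3 (toℕ i))))))
    (ℕ.+-monoʳ-≤ 3 (ℕ.*-monoʳ-≤ 3 i<k))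

  ξ-leaf-mono : ∀ {i k : Fin n} → i Fin.< k → 4 ℕ.+ 3 ℕ.* toℕ i ℕ.< 2 ℕ.+ 3 ℕ.* toℕ k
  ξ-leaf-mono {i} {k} i<k = ℕ.≤-trans (ℕ.≤-reflexive (cong (2 ℕ.+_) (≡.sym (ℕ.*-suc 3 (toℕ i)))))
    (ℕ.+-monoʳ-≤ 2 (ℕ.*-monoʳ-≤ 3 i<k))

  ξ-leaf-≤ : ∀ i s f → ξ (leaf i s f) ℕ.≤ 4 ℕ.+ 3 ℕ.* toℕ i
  ξ-leaf-≤ i single f = ℕ.≤-refl
  ξ-leaf-≤ i left′  f = ℕ.m≤n+m _ 2
  ξ-leaf-≤ i right′ f = ℕ.≤-refl

  ξ-leaf-≥ : ∀ i s f → 2 ℕ.+ 3 ℕ.* toℕ i ℕ.≤ ξ (leaf i s f)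
  ξ-leaf-≥ i single f = ℕ.m≤n+m _ 2
  ξ-leaf-≥ i left′  f = ℕ.≤-refl
  ξ-leaf-≥ i right′ f = ℕ.m≤n+m _ 2

  ξ-node-mono : ∀ {i k : Fin n} → i Fin.< k → ξ (node i) ℕ.< ξ (node k)
  ξ-node-mono {i} {k} i<k = ℕ.<-trans (ℕ.n<1+n _) (ξ-mono {i} {k} i<k)

  υ-mono : ∀ {i k} → Y i ℕ.< Y k → 2 ℕ.+ 2 ℕ.* Y i ℕ.< 1 ℕ.+ 2 ℕ.* Y k
  υ-mono {i} lt = s≤s (ℕ.≤-trans (ℕ.≤-reflexive (≡.sym (ℕ.*-suc 2 (Y i)))) (ℕ.*-monoʳ-≤ 2 lt))

  υ-mono′ : ∀ {i k} → Y i ℕ.< Y k → 1 ℕ.+ 2 ℕ.* Y i ℕ.< 2 ℕ.* Y k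
  υ-mono′ {i} lt = ℕ.≤-trans (ℕ.≤-reflexive (≡.sym (ℕ.*-suc 2 (Y i)))) (ℕ.*-monoʳ-≤ 2 lt)

  υ-leaf-≤ : ∀ i s f → υ (leaf i s f) ℕ.≤ 2 ℕ.+ 2 ℕ.* Y i
  υ-leaf-≤ i s f with dir (ε i) s
  ... | Sign.+ = ℕ.≤-refl
  ... | Sign.- = ℕ.m≤n+m _ 2

  υ-leaf-≥ : ∀ i s f → 2 ℕ.* Y i ℕ.≤ υ (leaf i s f)
  υ-leaf-≥ i s f with dir (ε i) s
  ... | Sign.+ = ℕ.m≤n+m _ 2
  ... | Sign.- = ℕ.≤-refl

  υ-node-mono : ∀ {i k} → Y i ℕ.< Y k → υ (node i) ℕ.< υ (node k)
  υ-node-mono {i} {k} lt = ℕ.<-trans (ℕ.n<1+n _) (υ-mono {i} {k} lt)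

  Precedes : Sign → Rel ℕ 0ℓ
  Precedes Sign.+ a b = a ℕ.< b
  Precedes Sign.- a b = b ℕ.< a

  link-υ : ∀ d {i k} → Link d i k → Precedes d (υ (node i)) (υ (node k))
  link-υ Sign.+ {i} {k} e = υ-node-mono {i} {k} (rise e)
  link-υ Sign.- {i} {k} e = υ-node-mono {k} {i} (rise e)

  nb-υ : ∀ i s → Precedes (dir (ε i) s) (υ (node i)) (υ (nb i s))
  nb-υ i s with nb i s | nb-view i s
  ... | _ | is-node inSlot = link-υ (dir (ε i) s) (proj₁ inSlot)
  ... | _ | is-leaf with dir (ε i) s
  ...   | Sign.+ = ℕ.≤-refl
  ...   | Sign.- = ℕ.≤-refl

  nb-left : ∀ i → ξ (nb i left′) ℕ.< ξ (node i)
  nb-left i with nb i left′ | nb-view i left′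
  ... | _ | is-node {k} inSlot = ξ-node-mono {k} {i} (proj₂ inSlot)
  ... | _ | is-leaf        = ℕ.≤-refl

  nb-right : ∀ i → ξ (node i) ℕ.< ξ (nb i right′)
  nb-right i with nb i right′ | nb-view i right′
  ... | _ | is-node {k} inSlot = ξ-node-mono {i} {k} (proj₂ inSlot)
  ... | _ | is-leaf        = ℕ.≤-refl

  -- Of any two edges at a node, a horizontal or a vertical line through the
  -- node separates one from the other.
  Splits : Axis → Fin n → V → V → Set
  Splits a i v w = (nat a v ℕ.< nat a (node i) × nat a (node i) ℕ.< nat a w) ⊎
                   (nat a w ℕ.< nat a (node i) × nat a (node i) ℕ.< nat a v)

  splits-y : ∀ d i v w → Precedes d (υ (node i)) (υ v) → Precedes (opposite d) (υ (node i)) (υ w) →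
             Splits y-axis i v w
  splits-y Sign.+ _ _ _ p q = inj₂ (q , p)
  splits-y Sign.- _ _ _ p q = inj₁ (p , q)

  fan : ∀ i s s′ → s ≢ s′ → ∃ λ a → Splits a i (nb i s) (nb i s′)
  fan i single single s≢s = contradiction ≡.refl s≢s
  fan i left′  left′  s≢s = contradiction ≡.refl s≢s
  fan i right′ right′ s≢s = contradiction ≡.refl s≢s
  fan i left′  right′ _   = x-axis , inj₁ (nb-left i , nb-right i)
  fan i right′ left′  _   = x-axis , inj₂ (nb-left i , nb-right i)
  fan i single left′  _   = y-axis , splits-y (ε i) i (nb i single) (nb i left′) (nb-υ i single) (nb-υ i left′)
  fan i single right′ _   = y-axis , splits-y (ε i) i (nb i single) (nb i right′) (nb-υ i single) (nb-υ i right′)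
  fan i left′  single _   = y-axis , Sum.swap (splits-y (ε i) i (nb i single) (nb i left′) (nb-υ i single) (nb-υ i left′))
  fan i right′ single _   = y-axis , Sum.swap (splits-y (ε i) i (nb i single) (nb i right′) (nb-υ i single) (nb-υ i right′))

  nb-injective : ∀ i s s′ → nb i s ≡ nb i s′ → s ≡ s′
  nb-injective i s s′ eq with s Fin.≟ s′
  ... | yes s≡s′ = s≡s′
  ... | no  s≢s′ with fan i s s′ s≢s′
  ...   | a , inj₁ (lt , lt′) = contradiction (cong (nat a) eq) (ℕ.<⇒≢ (ℕ.<-trans lt lt′))
  ...   | a , inj₂ (lt , lt′) = contradiction (cong (nat a) (≡.sym eq)) (ℕ.<⇒≢ (ℕ.<-trans lt lt′))

  data Oriented : V → V → Set where
    inner-edge : ∀ {p q} → Edge p q → Oriented (node p) (node q)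
    outer-edge : ∀ i s f → Oriented (node i) (leaf i s f)

  orient : ∀ u v → AdjV u v → Oriented u v ⊎ Oriented v u
  orient (node i)     (node k)     (inj₁ e) = inj₁ (inner-edge e)
  orient (node i)     (node k)     (inj₂ e) = inj₂ (inner-edge e)
  orient (node i)     (leaf k s f) ≡.refl   = inj₁ (outer-edge i s f)
  orient (leaf i s f) (node k)     ≡.refl   = inj₂ (outer-edge i s f)

  SamePair : V → V → V → V → Set
  SamePair u v u′ v′ = (u ≡ u′ × v ≡ v′) ⊎ (u ≡ v′ × v ≡ u′)

  Separates : (V → Bool) → V → V → Set
  Separates χ u v = χ u ≢ χ v × (∀ u′ v′ → AdjV u′ v′ → SamePair u v u′ v′ ⊎ χ u′ ≡ χ v′)

  -- For an inner edge the leaves follow their nodes; for a leaf edge the leaf alone is cut off.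
  -- These cuts are what makes the graph acyclic.
  oriented-cut : ∀ {u v} → Oriented u v → ∃ λ χ → Separates χ u v
  oriented-cut (inner-edge {p} {q} e) = χ , (λ eq → case ≡.trans (≡.sym (cut-lower cut)) (≡.trans eq (cut-upper cut)) of λ ()) , constant
    where
    cut = component-isCut e
    χ : V → Bool
    χ (i , _) = component e i
    constant : ∀ u′ v′ → AdjV u′ v′ → SamePair (node p) (node q) u′ v′ ⊎ χ u′ ≡ χ v′
    constant (node i)     (node k)     (inj₁ e′) with cut-constant cut e′
    ... | inj₁ (≡.refl , ≡.refl) = inj₁ (inj₁ (≡.refl , ≡.refl))
    ... | inj₂ eq                = inj₂ eq
    constant (node i)     (node k)     (inj₂ e′) with cut-constant cut e′
    ... | inj₁ (≡.refl , ≡.refl) = inj₁ (inj₂ (≡.refl , ≡.refl))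
    ... | inj₂ eq                = inj₂ (≡.sym eq)
    constant (node i)     (leaf k _ _) ≡.refl = inj₂ ≡.refl
    constant (leaf i _ _) (node k)     ≡.refl = inj₂ ≡.refl
  oriented-cut (outer-edge i s f) = χ , (λ eq → case ≡.trans eq (dec-true (isLeaf? (leaf i s f)) (≡.refl , ≡.refl)) of λ ()) , constant
    where
    isLeaf? : ∀ v → Dec (proj₁ v ≡ i × proj₁ (proj₂ v) ≡ suc s)
    isLeaf? (k , t , _) = k Fin.≟ i ×-dec t Fin.≟ suc s
    χ : V → Bool
    χ (node k)         = false
    χ v@(leaf _ _ _)   = does (isLeaf? v)
    constant : ∀ u′ v′ → AdjV u′ v′ → SamePair (node i) (leaf i s f) u′ v′ ⊎ χ u′ ≡ χ v′
    constant (node k) (node l) _ = inj₂ ≡.refl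
    constant (node k) v@(leaf k t f′) ≡.refl with isLeaf? v
    ... | yes (≡.refl , ≡.refl) = inj₁ (inj₁ (≡.refl , leaf-cong))
    ... | no  other             = inj₂ (≡.sym (dec-false (isLeaf? v) other))
    constant u@(leaf k t f′) (node k) ≡.refl with isLeaf? u
    ... | yes (≡.refl , ≡.refl) = inj₁ (inj₂ (≡.refl , leaf-cong))
    ... | no  other             = inj₂ (dec-false (isLeaf? u) other)

  adj-cut : ∀ u v → AdjV u v → ∃ λ χ → Separates χ u v
  adj-cut u v a with orient u v a
  ... | inj₁ o = oriented-cut o
  ... | inj₂ o with oriented-cut o
  ...   | χ , differ , constant = χ , differ ∘ ≡.sym , λ u′ v′ a′ → Sum.map₁ (Sum.map swap swap ∘ Sum.swap) (constant u′ v′ a′)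
    where
    swap : ∀ {A B : Set} → A × B → B × A
    swap (a , b) = b , a

  V-connected : ∀ u v → Star AdjV u v
  V-connected u v = to-node u ◅◅ Star.gmap (λ i → node i) id (connected (proj₁ u) (proj₁ v)) ◅◅ from-node v
    where
    to-node : ∀ u → Star AdjV u (node (proj₁ u))
    to-node (node i)     = nil
    to-node (leaf i s f) = ≡.refl ◅ nil
    from-node : ∀ v → Star AdjV (node (proj₁ v)) v
    from-node (node i)     = nil
    from-node (leaf i s f) = ≡.refl ◅ nil

-- Planarity: separating edges by horizontal and vertical lines

module Plane {c ℓ₁ ℓ₂} (𝓡 : RealNumbers c ℓ₁ ℓ₂)
  {m : ℕ} (ε : Vector Sign (suc m)) (Y : Fin (suc m) → ℕ) (Y-injective : Injective _≡_ _≡_ Y) where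

  open RealNumbers 𝓡 hiding (zero) renaming (Carrier to ℝ)
  open OrderedFieldProperties orderedField
  open Gaps ε Y Y-injective using (n; Linked; Edge; edge; start; end; lower; upper; rise; edges-overlap; edge-above-Λ; edge-below-V; StrictlyBetween; A; B)
  open Slots ε Y Y-injective

  abstract
    ⅓ : ℝ
    ⅓ = proj₁ (inverse (fromℕ-pos 2))

    0<⅓ : 0# < ⅓
    0<⅓ = proj₁ (proj₂ (inverse (fromℕ-pos 2)))

    3*⅓≈1 : fromℕ 3 * ⅓ ≈ 1#
    3*⅓≈1 = proj₂ (proj₂ (inverse (fromℕ-pos 2)))

  scale : Axis → ℕ → ℝ
  scale x-axis k = fromℕ k * ⅓
  scale y-axis k = fromℕ k

  scale-mono-< : ∀ a {j k} → j ℕ.< k → scale a j < scale a k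
  scale-mono-< x-axis j<k = *-monoʳ-< 0<⅓ (fromℕ-mono-< j<k)
  scale-mono-< y-axis j<k = fromℕ-mono-< j<k

  scale-mono-≤ : ∀ a {j k} → j ℕ.≤ k → scale a j ≤ scale a k
  scale-mono-≤ a j≤k = case ℕ.m≤n⇒m<n∨m≡n j≤k of λ where
    (inj₁ j<k)    → <⇒≤ (scale-mono-< a j<k)
    (inj₂ ≡.refl) → ≈⇒≤ refl

  scale-injective : ∀ a {j k} → scale a j ≈ scale a k → j ≡ k
  scale-injective a {j} {k} eq with ℕ.<-cmp j k
  ... | tri< j<k _ _ = contradiction (scale-mono-< a j<k) (<-irrefl eq)
  ... | tri≈ _ j≡k _ = j≡k
  ... | tri> _ _ k<j = contradiction (scale-mono-< a k<j) (<-irrefl (sym eq))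

  pt : V → Point 𝓡
  pt v = scale x-axis (ξ v) , scale y-axis (υ v)

  coord : Axis → Point 𝓡 → ℝ
  coord x-axis (x , y) = x
  coord y-axis (x , y) = y

  -- A record keeps the vertices u and v visible to unification, which the coordinates of their
  -- points would not.
  record Seg (u v : V) (P : Point 𝓡) : Set (c Level.⊔ ℓ₁ Level.⊔ ℓ₂) where
    constructor seg
    field on-segment : P ∈ Segment 𝓡 (pt u) (pt v)

  seg-sym : ∀ {u v P} → Seg u v P → Seg v u P
  seg-sym {u} {v} (seg (s , 0≤s , s≤1 , x≈ , y≈)) = seg
    (1# - s , x≤y⇒0≤y-x s≤1 ,
    0≤y-x⇒x≤y (≤-respʳ (solve 2 (λ u s → s := u :- (u :- s)) refl 1# s) 0≤s) ,
    trans x≈ (mix-flip s _ _) , trans y≈ (mix-flip s _ _))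

  private
    seg-coord : ∀ a {u v P} (σ : P ∈ Segment 𝓡 (pt u) (pt v)) → let s = proj₁ σ in
                coord a P ≈ mix s (scale a (nat a u)) (scale a (nat a v))
    seg-coord x-axis (_ , _ , _ , x≈ , _) = x≈
    seg-coord y-axis (_ , _ , _ , _ , y≈) = y≈

    at-start : ∀ {u v P} (σ : P ∈ Segment 𝓡 (pt u) (pt v)) → proj₁ σ ≈ 0# → _≈ₚ_ 𝓡 P (pt u)
    at-start (_ , _ , _ , x≈ , y≈) s≈0 = trans x≈ (mix-zero _ _ s≈0) , trans y≈ (mix-zero _ _ s≈0)

  seg-≤ : ∀ a {u v P k} → Seg u v P → nat a u ℕ.≤ k → nat a v ℕ.≤ k → coord a P ≤ scale a k
  seg-≤ a {u} {v} {P} (seg σ@(s , 0≤s , s≤1 , _)) u≤k v≤k =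
    ≤-respˡ (sym (seg-coord a {u} {v} {P} σ)) (mix-≤ 0≤s s≤1 (scale-mono-≤ a u≤k) (scale-mono-≤ a v≤k))

  seg-< : ∀ a {u v P k} → Seg u v P → nat a u ℕ.< k → nat a v ℕ.< k → coord a P < scale a k
  seg-< a {u} {v} {P} (seg σ@(s , 0≤s , s≤1 , _)) u<k v<k =
    <-respˡ (sym (seg-coord a {u} {v} {P} σ)) (mix-< 0≤s s≤1 (scale-mono-< a u<k) (scale-mono-< a v<k))

  seg-> : ∀ a {u v P k} → Seg u v P → k ℕ.< nat a u → k ℕ.< nat a v → scale a k < coord a P
  seg-> a {u} {v} {P} (seg σ@(s , 0≤s , s≤1 , _)) k<u k<v =
    <-respʳ (sym (seg-coord a {u} {v} {P} σ)) (mix-> 0≤s s≤1 (scale-mono-< a k<u) (scale-mono-< a k<v))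

  seg-start-≤ : ∀ a {u v P} → Seg u v P → nat a u ℕ.< nat a v → coord a P ≤ scale a (nat a u) → _≈ₚ_ 𝓡 P (pt u)
  seg-start-≤ a {u} {v} {P} (seg σ@(s , 0≤s , _)) u<v le =
    at-start {u} {v} {P} σ (pinned-≤ 0≤s (scale-mono-< a u<v) (≤-respˡ (seg-coord a {u} {v} {P} σ) le))

  seg-start-≥ : ∀ a {u v P} → Seg u v P → nat a v ℕ.< nat a u → scale a (nat a u) ≤ coord a P → _≈ₚ_ 𝓡 P (pt u)
  seg-start-≥ a {u} {v} {P} (seg σ@(s , 0≤s , _)) v<u le =
    at-start {u} {v} {P} σ (pinned-≥ 0≤s (scale-mono-< a v<u) (≤-respʳ (seg-coord a {u} {v} {P} σ) le))

  apart : ∀ a {k u v u′ v′ P} → nat a u ℕ.≤ k → nat a v ℕ.≤ k → k ℕ.< nat a u′ → k ℕ.< nat a v′ →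
          Seg u v P → ¬ Seg u′ v′ P
  apart a u≤k v≤k k<u′ k<v′ σ σ′ = seg-≤ a σ u≤k v≤k (seg-> a σ′ k<u′ k<v′)

  meet : ∀ a {w o o′ P} → nat a o′ ℕ.< nat a w → nat a w ℕ.< nat a o → Seg w o′ P → Seg w o P → _≈ₚ_ 𝓡 P (pt w)
  meet a o′<w w<o σ′ σ = seg-start-≤ a σ w<o (seg-≤ a σ′ ℕ.≤-refl (ℕ.<⇒≤ o′<w))

  Meets : V → V → V → V → Point 𝓡 → Set _
  Meets u v u′ v′ P = ∃ λ w → (w ≡ u ⊎ w ≡ v) × (w ≡ u′ ⊎ w ≡ v′) × _≈ₚ_ 𝓡 P (pt w)

  Ends : V → V → V → V → Set
  Ends w o u v = (w ≡ u × o ≡ v) ⊎ (w ≡ v × o ≡ u)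

  ends-seg : ∀ {w o u v P} → Ends w o u v → Seg u v P → Seg w o P
  ends-seg (inj₁ (≡.refl , ≡.refl)) σ = σ
  ends-seg (inj₂ (≡.refl , ≡.refl)) σ = seg-sym σ

  ends-∈ : ∀ {w o u v} → Ends w o u v → w ≡ u ⊎ w ≡ v
  ends-∈ (inj₁ (eq , _)) = inj₁ eq
  ends-∈ (inj₂ (eq , _)) = inj₂ eq

  -- Along the axis a the first edge ends at w and the second one begins at w′. If w comes first, a
  -- line separates the edges; otherwise the coordinates agree, and `same` turns w and w′ into a
  -- common end.
  stack : ∀ a {u v u′ v′ w o w′ o′ P} → Ends w o u v → Ends w′ o′ u′ v′ →
          nat a o ℕ.< nat a w → nat a w ℕ.≤ nat a w′ → nat a w′ ℕ.< nat a o′ →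
          (nat a w ≡ nat a w′ → w ≡ w′) → Seg u v P → Seg u′ v′ P → Meets u v u′ v′ P
  stack a e e′ o<w w≤w′ w′<o′ same σ σ′ with ℕ.m≤n⇒m<n∨m≡n w≤w′
  ... | inj₁ w<w′ = contradiction (ends-seg e′ σ′)
                      (apart a ℕ.≤-refl (ℕ.<⇒≤ o<w) w<w′ (ℕ.<-trans w<w′ w′<o′) (ends-seg e σ))
  ... | inj₂ eq with same eq
  ...   | ≡.refl = _ , ends-∈ e , ends-∈ e′ , meet a o<w w′<o′ (ends-seg e σ) (ends-seg e′ σ′)

  meets-sym : ∀ {u v u′ v′ P} → Meets u v u′ v′ P → Meets u′ v′ u v P
  meets-sym (w , a , b , eq) = w , b , a , eq

  node-ξ-injective : ∀ {i k : Fin n} → ξ (node i) ≡ ξ (node k) → i ≡ k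
  node-ξ-injective eq = Fin.toℕ-injective (ℕ.*-cancelˡ-≡ _ _ 3 (ℕ.+-cancelˡ-≡ 3 _ _ eq))

  node-υ-injective : ∀ {i k} → υ (node i) ≡ υ (node k) → i ≡ k
  node-υ-injective eq = Y-injective (ℕ.*-cancelˡ-≡ _ _ 2 (ℕ.suc-injective eq))

  MeetsOrSame : V → V → V → V → Set _
  MeetsOrSame u v u′ v′ = SamePair u v u′ v′ ⊎ (∀ P → Seg u v P → Seg u′ v′ P → Meets u v u′ v′ P)

  record Span {p q} (e : Edge p q) : Set where
    field
      {l r}  : Fin n
      l<r    : l Fin.< r
      ends   : Ends (node l) (node r) (node p) (node q)
      touchˡ : Gaps.Touch ε Y Y-injective (A e) (B e) l
      touchʳ : Gaps.Touch ε Y Y-injective (A e) (B e) r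

  open Span

  span : ∀ {p q} (e : Edge p q) → Span e
  span {p} {q} e with ℕ.<-cmp (toℕ p) (toℕ q)
  ... | tri< p<q _ _ = record { l<r = p<q ; ends = inj₁ (≡.refl , ≡.refl) ; touchˡ = start e ; touchʳ = end e }
  ... | tri> _ _ q<p = record { l<r = q<p ; ends = inj₂ (≡.refl , ≡.refl) ; touchˡ = end e ; touchʳ = start e }
  ... | tri≈ _ eq _  = contradiction (cong Y (Fin.toℕ-injective eq)) (ℕ.<⇒≢ (rise e))

  ends-flip : ∀ {w o u v} → Ends w o u v → Ends o w u v
  ends-flip (inj₁ (a , b)) = inj₂ (b , a)
  ends-flip (inj₂ (a , b)) = inj₁ (b , a)

  -- Edges whose abscissae or whose heights do not overlap can be stacked along that axis. If both
  -- overlap, the edges have a column in common and must be equal.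
  inner-inner : ∀ {p q p′ q′} → Edge p q → Edge p′ q′ → MeetsOrSame (node p) (node q) (node p′) (node q′)
  inner-inner {p} {q} {p′} {q′} e e′ with span e | span e′
  ... | S | S′ with r S Fin.≤? l S′ | r S′ Fin.≤? l S
  ... | yes r≤l′ | _ = inj₂ λ P → stack x-axis (ends-flip (ends S)) (ends S′) (ξ-node-mono (l<r S)) (ℕ.+-monoʳ-≤ 3 (ℕ.*-monoʳ-≤ 3 r≤l′)) (ξ-node-mono (l<r S′))
                             (cong (λ i → node i) ∘ node-ξ-injective)
  ... | no _ | yes r′≤l = inj₂ λ P σ σ′ → meets-sym (stack x-axis (ends-flip (ends S′)) (ends S) (ξ-node-mono (l<r S′)) (ℕ.+-monoʳ-≤ 3 (ℕ.*-monoʳ-≤ 3 r′≤l)) (ξ-node-mono (l<r S))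
                             (cong (λ i → node i) ∘ node-ξ-injective) σ′ σ)
  ... | no r≰l′ | no r′≰l with Y p ℕ.<? Y q′ | Y p′ ℕ.<? Y q
  ...   | no p≮q′ | _ = inj₂ λ P σ σ′ → meets-sym (stack y-axis (inj₂ (≡.refl , ≡.refl)) (inj₁ (≡.refl , ≡.refl)) (υ-node-mono (rise e′)) (ℕ.+-monoʳ-≤ 1 (ℕ.*-monoʳ-≤ 2 (ℕ.≮⇒≥ p≮q′))) (υ-node-mono (rise e))
                             (cong (λ i → node i) ∘ node-υ-injective) σ′ σ)
  ...   | yes _ | no p′≮q = inj₂ λ P → stack y-axis (inj₂ (≡.refl , ≡.refl)) (inj₁ (≡.refl , ≡.refl)) (υ-node-mono (rise e)) (ℕ.+-monoʳ-≤ 1 (ℕ.*-monoʳ-≤ 2 (ℕ.≮⇒≥ p′≮q))) (υ-node-mono (rise e′))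
                             (cong (λ i → node i) ∘ node-υ-injective)
  -- The column just to the right of both left ends lies on both edges, because neither edge ends
  -- before the other begins.
  ...   | yes p<q′ | yes p′<q with edges-overlap e e′ (suc (toℕ (l S) ℕ.⊔ toℕ (l S′)))
            (ℕ.≤-trans (proj₁ (touchˡ S)) (s≤s (ℕ.m≤m⊔n _ _)) , ℕ.≤-trans (ℕ.⊔-lub (l<r S) (ℕ.≰⇒> r≰l′)) (proj₂ (touchʳ S)))
            (ℕ.≤-trans (proj₁ (touchˡ S′)) (s≤s (ℕ.m≤n⊔m (toℕ (l S)) _)) , ℕ.≤-trans (ℕ.⊔-lub (ℕ.≰⇒> r′≰l) (l<r S′)) (proj₂ (touchʳ S′)))
            p<q′ p′<q
  ...     | ≡.refl , ≡.refl = inj₁ (inj₁ (≡.refl , ≡.refl))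

  at-node : ∀ i s s′ → s ≢ s′ → ∀ P → Seg (node i) (nb i s) P → Seg (node i) (nb i s′) P → _≈ₚ_ 𝓡 P (pt (node i))
  at-node i s s′ s≢s′ P σ σ′ with fan i s s′ s≢s′
  ... | a , inj₁ (lt , lt′) = meet a lt lt′ σ σ′
  ... | a , inj₂ (lt , lt′) = meet a lt lt′ σ′ σ

  outer-outer : ∀ i s f i′ s′ f′ → MeetsOrSame (node i) (leaf i s f) (node i′) (leaf i′ s′ f′)
  outer-outer i s f i′ s′ f′ with Fin.<-cmp i i′
  ... | tri< i<i′ _ _ = inj₂ λ P σ σ′ → contradiction σ′ (apart x-axis
          (ℕ.n≤1+n _) (ξ-leaf-≤ i s f) (ξ-mono {i} {i′} i<i′) (ℕ.≤-trans (ξ-leaf-mono {i} {i′} i<i′) (ξ-leaf-≥ i′ s′ f′)) σ)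
  ... | tri> _ _ i′<i = inj₂ λ P σ σ′ → contradiction σ (apart x-axis
          (ℕ.n≤1+n _) (ξ-leaf-≤ i′ s′ f′) (ξ-mono {i′} {i} i′<i) (ℕ.≤-trans (ξ-leaf-mono {i′} {i} i′<i) (ξ-leaf-≥ i s f)) σ′)
  ... | tri≈ _ ≡.refl _ with s Fin.≟ s′
  ...   | yes ≡.refl = inj₁ (inj₁ (≡.refl , leaf-cong))
  ...   | no  s≢s′ = inj₂ λ P σ σ′ → node i , inj₁ ≡.refl , inj₁ ≡.refl ,
          at-node i s s′ s≢s′ P (subst (λ w → Seg (node i) w P) (leaf≡nb f) σ) (subst (λ w → Seg (node i) w P) (leaf≡nb f′) σ′)

  inner-at : ∀ {i k} s f → Linked i k → ∀ P → Seg (node i) (node k) P → Seg (node i) (leaf i s f) P → _≈ₚ_ 𝓡 P (pt (node i))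
  inner-at {i} {k} s f l P σ σ′ with slot-of l
  ... | t , inSlot = at-node i t s (λ { ≡.refl → leaf-free f k inSlot }) P
          (subst (λ w → Seg (node i) w P) (node≡nb inSlot) σ) (subst (λ w → Seg (node i) w P) (leaf≡nb f) σ′)

  -- One coordinate suffices in every case: a node strictly between the ends is below both of them
  -- if it is a Λ-node and above both if it is a V-node.
  data Relative {p q} (e : Edge p q) (i : Fin n) : Set where
    is-lower : i ≡ p → Relative e i
    is-upper : i ≡ q → Relative e i
    to-left  : i Fin.< p → i Fin.< q → Relative e i
    to-right : p Fin.< i → q Fin.< i → Relative e i
    above    : ε i ≡ Sign.+ → Y i ℕ.< Y p → Relative e i
    below    : ε i ≡ Sign.- → Y q ℕ.< Y i → Relative e i

  relative : ∀ {p q} (e : Edge p q) i → Relative e i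
  relative {p} {q} e i with Fin.<-cmp i p | Fin.<-cmp i q
  ... | tri≈ _ eq _  | _            = is-lower eq
  ... | _            | tri≈ _ eq _  = is-upper eq
  ... | tri< i<p _ _ | tri< i<q _ _ = to-left i<p i<q
  ... | tri> _ _ p<i | tri> _ _ q<i = to-right p<i q<i
  ... | tri< i<p _ _ | tri> _ _ q<i = strictly (inj₂ (q<i , i<p))
    where
    strictly : StrictlyBetween p q i → Relative e i
    strictly b with ε i in eq
    ... | Sign.+ = above eq (edge-above-Λ e b eq)
    ... | Sign.- = below eq (edge-below-V e b eq)
  ... | tri> _ _ p<i | tri< i<q _ _ = strictly (inj₁ (p<i , i<q))
    where
    strictly : StrictlyBetween p q i → Relative e i
    strictly b with ε i in eq
    ... | Sign.+ = above eq (edge-above-Λ e b eq)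
    ... | Sign.- = below eq (edge-below-V e b eq)

  inner-outer : ∀ {p q} (e : Edge p q) i s f → ∀ P → Seg (node p) (node q) P → Seg (node i) (leaf i s f) P →
                Meets (node p) (node q) (node i) (leaf i s f) P
  inner-outer {p} {q} e i s f P σ σ′ with relative e i
  ... | is-lower ≡.refl = node i , inj₁ ≡.refl , inj₁ ≡.refl , inner-at s f (inj₁ e) P σ σ′
  ... | is-upper ≡.refl = node i , inj₂ ≡.refl , inj₁ ≡.refl , inner-at s f (inj₂ e) P (seg-sym σ) σ′
  ... | to-left i<p i<q = contradiction σ (apart x-axis (ℕ.n≤1+n _) (ξ-leaf-≤ i s f) (ξ-mono {i} {p} i<p) (ξ-mono {i} {q} i<q) σ′)
  -- This vertical line is to the left of i and all its leaves, and not to the left of any earlier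
  -- node.
  ... | to-right p<i q<i = contradiction σ′ (apart x-axis {k = 1 ℕ.+ 3 ℕ.* toℕ i} (left-of p p<i) (left-of q q<i)
          (ℕ.n≤1+n _) (ξ-leaf-≥ i s f) σ)
    where
    left-of : ∀ j → j Fin.< i → ξ (node j) ℕ.≤ 1 ℕ.+ 3 ℕ.* toℕ i
    left-of j j<i = ℕ.≤-trans (ℕ.n≤1+n _) (ℕ.≤-pred (ξ-leaf-mono {j} {i} j<i))
  ... | above Λ i<p = contradiction σ (apart y-axis (ℕ.n≤1+n _) (υ-leaf-≤ i s f) (υ-mono {i} {p} i<p)
                        (ℕ.<-trans (υ-mono {i} {p} i<p) (υ-node-mono {p} {q} (rise e))) σ′)
  ... | below V q<i = contradiction σ′ (apart y-axis (ℕ.<⇒≤ (υ-node-mono {p} {q} (rise e))) ℕ.≤-refl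
                        (ℕ.<-trans (υ-mono′ {q} {i} q<i) (ℕ.n<1+n _)) (ℕ.≤-trans (υ-mono′ {q} {i} q<i) (υ-leaf-≥ i s f)) σ)

module Realization {c ℓ₁ ℓ₂} (𝓡 : RealNumbers c ℓ₁ ℓ₂)
  {m : ℕ} (ε : Vector Sign (suc m)) (Y : Fin (suc m) → ℕ) (Y-injective : Injective _≡_ _≡_ Y) where

  open RealNumbers 𝓡 hiding (zero) renaming (Carrier to ℝ)
  open OrderedFieldProperties orderedField
  open Gaps ε Y Y-injective using (n; Edge; Linked; rise)
  open Slots ε Y Y-injective
  open Plane 𝓡 ε Y Y-injective

  oriented-meets : ∀ {u v u′ v′} → Oriented u v → Oriented u′ v′ → MeetsOrSame u v u′ v′
  oriented-meets (inner-edge e)       (inner-edge e′)        = inner-inner e e′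
  oriented-meets (inner-edge e)       (outer-edge i s f)     = inj₂ (inner-outer e i s f)
  oriented-meets (outer-edge i s f)   (inner-edge e)         = inj₂ λ P σ σ′ → meets-sym (inner-outer e i s f P σ′ σ)
  oriented-meets (outer-edge i s f)   (outer-edge i′ s′ f′)  = outer-outer i s f i′ s′ f′

  meets-flip : ∀ {u v u′ v′} → MeetsOrSame u v u′ v′ → MeetsOrSame v u u′ v′
  meets-flip (inj₁ (inj₁ (a , b))) = inj₁ (inj₂ (b , a))
  meets-flip (inj₁ (inj₂ (a , b))) = inj₁ (inj₁ (b , a))
  meets-flip (inj₂ f) = inj₂ λ P σ σ′ → let w , a , b , eq = f P (seg-sym σ) σ′ in w , Sum.swap a , b , eq

  meets-flip′ : ∀ {u v u′ v′} → MeetsOrSame u v u′ v′ → MeetsOrSame u v v′ u′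
  meets-flip′ (inj₁ same) = inj₁ (Sum.swap same)
  meets-flip′ (inj₂ f) = inj₂ λ P σ σ′ → let w , a , b , eq = f P σ (seg-sym σ′) in w , a , Sum.swap b , eq

  adj-meets : ∀ u v u′ v′ → AdjV u v → AdjV u′ v′ → MeetsOrSame u v u′ v′
  adj-meets u v u′ v′ a a′ with orient u v a | orient u′ v′ a′
  ... | inj₁ o | inj₁ o′ = oriented-meets o o′
  ... | inj₂ o | inj₁ o′ = meets-flip (oriented-meets o o′)
  ... | inj₁ o | inj₂ o′ = meets-flip′ (oriented-meets o o′)
  ... | inj₂ o | inj₂ o′ = meets-flip (meets-flip′ (oriented-meets o o′))

  node-leaf-ξ : ∀ i k s f → ξ (node i) ≢ ξ (leaf k s f)
  node-leaf-ξ i k s f eq with Fin.<-cmp i k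
  ... | tri< i<k _ _ = ℕ.<⇒≢ (ℕ.<-trans (ℕ.n<1+n _) (ℕ.<-≤-trans (ξ-leaf-mono {i} {k} i<k) (ξ-leaf-≥ k s f))) eq
  ... | tri> _ _ k<i = ℕ.<⇒≢ (ℕ.≤-<-trans (ξ-leaf-≤ k s f) (ξ-mono {k} {i} k<i)) (≡.sym eq)
  ... | tri≈ _ ≡.refl _ = same s f eq
    where
    same : ∀ s f → ξ (node i) ≢ ξ (leaf i s f)
    same single f eq = ℕ.1+n≢n (≡.sym eq)
    same left′  f eq = ℕ.1+n≢n eq
    same right′ f eq = ℕ.1+n≢n (≡.sym eq)

  coordinates-injective : ∀ u v → ξ u ≡ ξ v → υ u ≡ υ v → u ≡ v
  coordinates-injective (node i)     (node k)     eq _ = cong (λ i → node i) (node-ξ-injective eq)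
  coordinates-injective (node i)     (leaf k s f) eq _ = contradiction eq (node-leaf-ξ i k s f)
  coordinates-injective (leaf i s f) (node k)     eq _ = contradiction (≡.sym eq) (node-leaf-ξ k i s f)
  coordinates-injective (leaf i s f) (leaf k t g) ξ≡ υ≡ with Fin.<-cmp i k
  ... | tri< i<k _ _ = contradiction ξ≡ (ℕ.<⇒≢ (ℕ.≤-<-trans (ξ-leaf-≤ i s f) (ℕ.<-≤-trans (ξ-leaf-mono {i} {k} i<k) (ξ-leaf-≥ k t g))))
  ... | tri> _ _ k<i = contradiction (≡.sym ξ≡) (ℕ.<⇒≢ (ℕ.≤-<-trans (ξ-leaf-≤ k t g) (ℕ.<-≤-trans (ξ-leaf-mono {k} {i} k<i) (ξ-leaf-≥ i s f))))
  ... | tri≈ _ ≡.refl _ with s Fin.≟ t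
  ...   | yes ≡.refl = leaf-cong
  ...   | no  s≢t    = contradiction (fan i s t s≢t) λ where
            (a , inj₁ (lt , lt′)) → ℕ.<⇒≢ (ℕ.<-trans lt lt′) (nb-nat a)
            (a , inj₂ (lt , lt′)) → ℕ.<⇒≢ (ℕ.<-trans lt lt′) (≡.sym (nb-nat a))
    where
    leaf-nat : ∀ a → nat a (leaf i s f) ≡ nat a (leaf i t g)
    leaf-nat x-axis = ξ≡
    leaf-nat y-axis = υ≡
    nb-nat : ∀ a → nat a (nb i s) ≡ nat a (nb i t)
    nb-nat a = ≡.trans (cong (nat a) (≡.sym (leaf≡nb f))) (≡.trans (leaf-nat a) (cong (nat a) (leaf≡nb g)))

  pt-injective : ∀ u v → _≈ₚ_ 𝓡 (pt u) (pt v) → u ≡ v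
  pt-injective u v (x≈ , y≈) = coordinates-injective u v (scale-injective x-axis x≈) (scale-injective y-axis y≈)

  ξ-node : ∀ i v → ξ v ≡ ξ (node i) → v ≡ node i
  ξ-node i (node k)     eq = cong (λ i → node i) (node-ξ-injective eq)
  ξ-node i (leaf k s f) eq = contradiction (≡.sym eq) (node-leaf-ξ i k s f)

  -- The places where the drawing may meet the vertical line through a node: the node itself, or the
  -- half of the line opposite to its wall.
  data WallHit (i : Fin n) (P : Point 𝓡) : Set (ℓ₁ Level.⊔ ℓ₂) where
    hit   : _≈ₚ_ 𝓡 P (pt (node i)) → WallHit i P
    above : ε i ≡ Sign.+ → scale y-axis (υ (node i)) < proj₂ P → WallHit i P
    below : ε i ≡ Sign.- → proj₂ P < scale y-axis (υ (node i)) → WallHit i P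

  private
    start-hit : ∀ {i v P} → ξ (node i) ≢ ξ v → Seg (node i) v P → proj₁ P ≈ scale x-axis (ξ (node i)) → _≈ₚ_ 𝓡 P (pt (node i))
    start-hit {i} {v} {P} ξ≢ σ x≈ with ℕ.<-cmp (ξ (node i)) (ξ v)
    ... | tri< lt _ _ = seg-start-≤ x-axis {node i} {v} {P} σ lt (≈⇒≤ x≈)
    ... | tri≈ _ eq _ = contradiction eq ξ≢
    ... | tri> _ _ gt = seg-start-≥ x-axis {node i} {v} {P} σ gt (≈⇒≤ (sym x≈))

    linked-ξ : ∀ {i k} → Linked i k → ξ (node i) ≢ ξ (node k)
    linked-ξ l eq = linked-distinct l (node-ξ-injective eq)

  wall-hit : ∀ i {u v} P → Oriented u v → Seg u v P → proj₁ P ≈ scale x-axis (ξ (node i)) → WallHit i P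
  wall-hit i P (inner-edge {p} {q} e) σ x≈ with relative e i
  ... | is-lower ≡.refl  = hit (start-hit {i} {node q} {P} (linked-ξ (inj₁ e)) σ x≈)
  ... | is-upper ≡.refl  = hit (start-hit {i} {node p} {P} (linked-ξ (inj₂ e)) (seg-sym {node p} {node q} {P} σ) x≈)
  ... | to-left i<p i<q  = contradiction (seg-> x-axis {node p} {node q} {P} σ (ξ-node-mono {i} {p} i<p) (ξ-node-mono {i} {q} i<q)) (<-irrefl (sym x≈))
  ... | to-right p<i q<i = contradiction (seg-< x-axis {node p} {node q} {P} σ (ξ-node-mono {p} {i} p<i) (ξ-node-mono {q} {i} q<i)) (<-irrefl x≈)
  ... | above Λ i<p      = above Λ (seg-> y-axis {node p} {node q} {P} σ (υ-node-mono {i} {p} i<p) (υ-node-mono {i} {q} (ℕ.<-trans i<p (rise e))))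
  ... | below V q<i      = below V (seg-< y-axis {node p} {node q} {P} σ (υ-node-mono {p} {i} (ℕ.<-trans (rise e) q<i)) (υ-node-mono {q} {i} q<i))
  wall-hit i P (outer-edge k s f) σ x≈ with Fin.<-cmp i k
  ... | tri≈ _ ≡.refl _ = hit (start-hit {i} {leaf i s f} {P} (node-leaf-ξ i i s f) σ x≈)
  ... | tri< i<k _ _ = contradiction (seg-> x-axis {node k} {leaf k s f} {P} σ (ξ-node-mono {i} {k} i<k)
                         (ℕ.<-trans (ℕ.n<1+n _) (ℕ.<-≤-trans (ξ-leaf-mono {i} {k} i<k) (ξ-leaf-≥ k s f)))) (<-irrefl (sym x≈))
  ... | tri> _ _ k<i = contradiction (seg-< x-axis {node k} {leaf k s f} {P} σ (ξ-node-mono {k} {i} k<i)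
                         (ℕ.≤-<-trans (ξ-leaf-≤ k s f) (ξ-mono {k} {i} k<i))) (<-irrefl x≈)

  open Inverse (proj₂ V-finite) using (to; from; strictlyInverseˡ; strictlyInverseʳ)

  to-injective : ∀ {u v} → to u ≡ to v → u ≡ v
  to-injective {u} {v} eq = ≡.trans (≡.sym (strictlyInverseʳ u)) (≡.trans (cong from eq) (strictlyInverseʳ v))

  from-eq : ∀ {w u} → w ≡ to u → from w ≡ u
  from-eq ≡.refl = strictlyInverseʳ _

  private
    Adj : Rel (Fin (proj₁ V-finite)) 0ℓ
    Adj u v = AdjV (to u) (to v)

    adj-from : ∀ {u v} → AdjV u v → Adj (from u) (from v)
    adj-from {u} {v} = ≡.subst₂ AdjV (≡.sym (strictlyInverseˡ u)) (≡.sym (strictlyInverseˡ v))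

  tree : PlaneTree 𝓡
  tree = record
    { order     = proj₁ V-finite
    ; Adj       = Adj
    ; adj?      = λ u v → adjV? (to u) (to v)
    ; symmetric = λ {u} {v} → adjV-sym (to u) (to v)
    ; loopless  = λ { {u} ≡.refl → adjV-irrefl (to u) }
    ; connected = λ u v → ≡.subst₂ (Star Adj) (strictlyInverseʳ u) (strictlyInverseʳ v)
                    (Star.gmap from adj-from (V-connected (to u) (to v)))
    ; acyclic   = acyclic
    ; point     = λ u → pt (to u)
    ; point-injective = λ eq → to-injective (pt-injective _ _ eq)
    ; edges-meet = λ {u} {v} {u′} {v′} a a′ different P σ σ′ → edges-meet u v u′ v′ a a′ different P (seg σ) (seg σ′)
    }
    where
    -- A cut of the closing edge keeps its value along all other steps of the cycle and would thus
    -- be equal at the two ends of the closing edge.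
    acyclic : ∀ {k} (z : Fin (3 ℕ.+ k) → Fin _) → Injective _≡_ _≡_ z →
              (∀ i → Adj (z (inject₁ i)) (z (suc i))) → ¬ Adj (z (Fin.fromℕ (2 ℕ.+ k))) (z zero)
    acyclic {k} z z-injective step close with adj-cut _ _ close
    ... | χ , differ , constant = differ (≡.trans (same (Fin.fromℕ (2 ℕ.+ k))) ≡.refl)
      where
      step-same : ∀ i → χ (to (z (inject₁ i))) ≡ χ (to (z (suc i)))
      step-same i with constant _ _ (step i)
      ... | inj₂ eq = eq
      ... | inj₁ (inj₁ (_ , eq)) = contradiction (z-injective (to-injective eq)) λ ()
      -- The step would be the closing edge traversed backwards, from z 0 to z 1; the last index is
      -- at least 2, so this does not occur.
      ... | inj₁ (inj₂ (eq , eq′)) = contradiction (z-injective (to-injective eq)) (last≢ i (z-injective (to-injective eq′)))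
        where
        last≢ : ∀ i → zero ≡ inject₁ i → Fin.fromℕ (2 ℕ.+ k) ≢ suc i
        last≢ zero _ ()
      same : ∀ i → χ (to (z i)) ≡ χ (to (z zero))
      same = Fin.<-weakInduction _ ≡.refl λ i eq → ≡.trans (≡.sym (step-same i)) eq

    edges-meet : ∀ u v u′ v′ → Adj u v → Adj u′ v′ → ¬ ((u ≡ u′ × v ≡ v′) ⊎ (u ≡ v′ × v ≡ u′)) →
                 ∀ P → Seg (to u) (to v) P → Seg (to u′) (to v′) P →
                 ∃ λ w → (w ≡ u ⊎ w ≡ v) × (w ≡ u′ ⊎ w ≡ v′) × _≈ₚ_ 𝓡 P (pt (to w))
    edges-meet u v u′ v′ a a′ different P σ σ′ with adj-meets (to u) (to v) (to u′) (to v′) a a′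
    ... | inj₁ (inj₁ (eq , eq′)) = contradiction (inj₁ (to-injective eq , to-injective eq′)) different
    ... | inj₁ (inj₂ (eq , eq′)) = contradiction (inj₂ (to-injective eq , to-injective eq′)) different
    ... | inj₂ meets with meets P σ σ′
    ...   | w , w∈e , w∈e′ , eq = from w , Sum.map from-eq from-eq w∈e , Sum.map from-eq from-eq w∈e′ ,
              subst (λ w → _≈ₚ_ 𝓡 P (pt w)) (≡.sym (strictlyInverseˡ w)) eq

-- The axioms of a mixed cobinary tree

module MixedCobinary {c ℓ₁ ℓ₂} (𝓡 : RealNumbers c ℓ₁ ℓ₂)
  {m : ℕ} (ε : Vector Sign (suc m)) (H : Fin (suc m) → ℕ) (H-injective : Injective _≡_ _≡_ H) where

  open RealNumbers 𝓡 hiding (zero) renaming (Carrier to ℝ)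
  open OrderedFieldProperties orderedField
  open Gaps ε H H-injective using (n; Edge; Linked; rise; linked-sym)
  open Slots ε H H-injective
  open Plane 𝓡 ε H H-injective
  open Realization 𝓡 ε H H-injective
  open Inverse (proj₂ V-finite) using (to; from; strictlyInverseˡ; strictlyInverseʳ)
  open PlaneTree tree

  t : Fin n → Vertex
  t i = from (node i)

  to-t : ∀ i → to (t i) ≡ node i
  to-t i = strictlyInverseˡ (node i)

  nbr : Fin n → Slot → Vertex
  nbr i s = from (nb i s)

  nbr-injective : ∀ i s s′ → nbr i s ≡ nbr i s′ → s ≡ s′
  nbr-injective i s s′ eq = nb-injective i s s′
    (≡.trans (≡.sym (strictlyInverseˡ _)) (≡.trans (cong to eq) (strictlyInverseˡ _)))

  adj-nbr : ∀ i s → Adj (t i) (nbr i s)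
  adj-nbr i s = ≡.subst₂ AdjV (≡.sym (to-t i)) (≡.sym (strictlyInverseˡ (nb i s))) (adj-nb i s)

  nbr-complete : ∀ i {w} → Adj (t i) w → ∃ λ s → w ≡ nbr i s
  nbr-complete i {w} a with nb-complete i (to w) (subst (λ u → AdjV u (to w)) (to-t i) a)
  ... | s , eq = s , ≡.sym (from-eq (≡.sym eq))

  private
    val-mono : ∀ a {u v} → nat a u ℕ.< nat a v → scale a (nat a (to (from u))) < scale a (nat a (to (from v)))
    val-mono a {u} {v} lt = ≡.subst₂ (λ u v → scale a (nat a u) < scale a (nat a v))
      (≡.sym (strictlyInverseˡ u)) (≡.sym (strictlyInverseˡ v)) (scale-mono-< a lt)

  nbr-parent : ∀ i s → dir (ε i) s ≡ Sign.+ → Parent (t i) (nbr i s)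
  nbr-parent i s d = adj-nbr i s , val-mono y-axis {node i} {nb i s} (subst (λ d → Precedes d (υ (node i)) (υ (nb i s))) d (nb-υ i s))

  nbr-child : ∀ i s → dir (ε i) s ≡ Sign.- → Child (t i) (nbr i s)
  nbr-child i s d = adj-nbr i s , val-mono y-axis {nb i s} {node i} (subst (λ d → Precedes d (υ (node i)) (υ (nb i s))) d (nb-υ i s))

  parent-slot : ∀ i {w} → Parent (t i) w → ∃ λ s → w ≡ nbr i s × dir (ε i) s ≡ Sign.+
  parent-slot i (a , lt) with nbr-complete i a
  ... | s , ≡.refl = s , ≡.refl , sign (dir (ε i) s) ≡.refl
    where
    sign : ∀ d → dir (ε i) s ≡ d → d ≡ Sign.+
    sign Sign.+ _ = ≡.refl
    sign Sign.- d = contradiction lt (<-asym (proj₂ (nbr-child i s d)))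

  child-slot : ∀ i {w} → Child (t i) w → ∃ λ s → w ≡ nbr i s × dir (ε i) s ≡ Sign.-
  child-slot i (a , lt) with nbr-complete i a
  ... | s , ≡.refl = s , ≡.refl , sign (dir (ε i) s) ≡.refl
    where
    sign : ∀ d → dir (ε i) s ≡ d → d ≡ Sign.-
    sign Sign.- _ = ≡.refl
    sign Sign.+ d = contradiction lt (<-asym (proj₂ (nbr-parent i s d)))

  private
    pair : ∀ i {w s} → w ≡ nbr i s → s ≡ left′ ⊎ s ≡ right′ → w ≡ nbr i left′ ⊎ w ≡ nbr i right′
    pair i w≡ (inj₁ ≡.refl) = inj₁ w≡
    pair i w≡ (inj₂ ≡.refl) = inj₂ w≡

    single-slot : ∀ s e → dir e s ≡ e → s ≡ single
    single-slot single _ _ = ≡.refl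
    single-slot left′  Sign.+ ()
    single-slot left′  Sign.- ()
    single-slot right′ Sign.+ ()
    single-slot right′ Sign.- ()

  isΛ : ∀ {i} → ε i ≡ Sign.+ → IsΛ (t i)
  isΛ {i} Λ =
    (nbr i left′ , nbr i right′ , (λ eq → case nbr-injective i left′ right′ eq of λ ()) ,
      nbr-child i left′ (cong opposite Λ) , nbr-child i right′ (cong opposite Λ) ,
      λ {w} ch → let s , w≡ , d = child-slot i ch in
        pair i w≡ (two s (subst (λ e → dir e s ≡ Sign.-) Λ d))) ,
    (nbr i single , nbr-parent i single Λ ,
      λ {w} pa → let s , w≡ , d = parent-slot i pa in
        ≡.trans (cong (nbr i) (≡.sym (single-slot s Sign.+ (subst (λ e → dir e s ≡ Sign.+) Λ d)))) (≡.sym w≡))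
    where
    two : ∀ s → dir Sign.+ s ≡ Sign.- → s ≡ left′ ⊎ s ≡ right′
    two left′  _ = inj₁ ≡.refl
    two right′ _ = inj₂ ≡.refl

  isV : ∀ {i} → ε i ≡ Sign.- → IsV (t i)
  isV {i} V =
    (nbr i single , nbr-child i single V ,
      λ {w} ch → let s , w≡ , d = child-slot i ch in
        ≡.trans (cong (nbr i) (≡.sym (single-slot s Sign.- (subst (λ e → dir e s ≡ Sign.-) V d)))) (≡.sym w≡)) ,
    (nbr i left′ , nbr i right′ , (λ eq → case nbr-injective i left′ right′ eq of λ ()) ,
      nbr-parent i left′ (cong opposite V) , nbr-parent i right′ (cong opposite V) ,
      λ {w} pa → let s , w≡ , d = parent-slot i pa in
        pair i w≡ (two s (subst (λ e → dir e s ≡ Sign.+) V d)))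
    where
    two : ∀ s → dir Sign.- s ≡ Sign.+ → s ≡ left′ ⊎ s ≡ right′
    two left′  _ = inj₁ ≡.refl
    two right′ _ = inj₂ ≡.refl

  isΛ⇒Λ : ∀ {i} → IsΛ (t i) → ε i ≡ Sign.+
  isΛ⇒Λ {i} ((a , b , a≢b , ca , cb , _) , _) with ε i in eq
  ... | Sign.+ = ≡.refl
  ... | Sign.- with isV eq
  ...   | (x , _ , unique) , _ = contradiction (≡.trans (≡.sym (unique ca)) (unique cb)) a≢b

  isV⇒V : ∀ {i} → IsV (t i) → ε i ≡ Sign.-
  isV⇒V {i} (_ , (a , b , a≢b , pa , pb , _)) with ε i in eq
  ... | Sign.- = ≡.refl
  ... | Sign.+ with isΛ eq
  ...   | _ , (x , _ , unique) = contradiction (≡.trans (≡.sym (unique pa)) (unique pb)) a≢b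

  node-type : ∀ i (s : Sign) → ε i ≡ s → IsΛ (t i) ⊎ IsV (t i)
  node-type i Sign.+ Λ = inj₁ (isΛ Λ)
  node-type i Sign.- V = inj₂ (isV V)

  wall : ∀ i {P} → proj₁ P ≈ X (t i) → P ∈ Drawing → WallHit i P
  wall i {P} x≈ (inj₁ (v , P≈v)) = hit (subst (λ w → _≈ₚ_ 𝓡 P (pt w)) (ξ-node i (to v) ξ≡) P≈v)
    where
    ξ≡ : ξ (to v) ≡ ξ (node i)
    ξ≡ = ≡.trans (scale-injective x-axis (trans (sym (proj₁ P≈v)) x≈)) (cong ξ (to-t i))
  wall i {P} x≈ (inj₂ (u , v , a , σ)) with x≈′ ← trans x≈ (reflexive (cong (λ w → scale x-axis (ξ w)) (to-t i))) | orient (to u) (to v) a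
  ... | inj₁ o = wall-hit i P o (seg σ) x≈′
  ... | inj₂ o = wall-hit i P o (seg-sym (seg σ)) x≈′

  mct : MCT 𝓡 n
  mct = record
    { tree           = tree
    ; non-horizontal = λ {u} {v} → apart-heights (to u) (to v)
    ; t              = t
    ; t-internal     = λ i (w , _ , unique) → case nbr-injective i left′ right′
                         (≡.trans (≡.sym (unique (adj-nbr i left′))) (unique (adj-nbr i right′))) of λ ()
    ; t-onto         = λ v internal → t-onto v (to v) ≡.refl internal
    ; t-abscissa     = abscissa
    ; node-type      = λ i → node-type i (ε i) ≡.refl
    ; Λ-wall         = λ i Λ z z<y drawn → case wall i refl drawn of λ where
        (hit (_ , z≈y))  → <-irrefl (trans z≈y (sym (Y-t i))) z<y
        (above _ y<z)    → <-asym (<-respˡ (sym (Y-t i)) y<z) z<y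
        (below V _)      → case ≡.trans (≡.sym V) (isΛ⇒Λ Λ) of λ ()
    ; Λ-separate     = λ i Λ → nbr i left′ , nbr i right′ ,
        nbr-child i left′ (cong opposite (isΛ⇒Λ Λ)) , nbr-child i right′ (cong opposite (isΛ⇒Λ Λ)) ,
        val-mono x-axis {nb i left′} {node i} (nb-left i) , val-mono x-axis {node i} {nb i right′} (nb-right i)
    ; V-wall         = λ i V z y<z drawn → case wall i refl drawn of λ where
        (hit (_ , z≈y))  → <-irrefl (trans (Y-t i) (sym z≈y)) y<z
        (below _ z<y)    → <-asym (<-respʳ (sym (Y-t i)) z<y) y<z
        (above Λ _)      → case ≡.trans (≡.sym Λ) (isV⇒V V) of λ ()
    ; V-separate     = λ i V → nbr i left′ , nbr i right′ ,
        nbr-parent i left′ (cong opposite (isV⇒V V)) , nbr-parent i right′ (cong opposite (isV⇒V V)) ,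
        val-mono x-axis {nb i left′} {node i} (nb-left i) , val-mono x-axis {node i} {nb i right′} (nb-right i)
    }
    where
    Y-t : ∀ i → Y (t i) ≈ scale y-axis (υ (node i))
    Y-t i = reflexive (cong (λ w → scale y-axis (υ w)) (to-t i))

    nb-apart : ∀ d {a b} → Precedes d a b → scale y-axis a # scale y-axis b
    nb-apart Sign.+ lt = <⇒# (scale-mono-< y-axis lt)
    nb-apart Sign.- lt = #-sym (<⇒# (scale-mono-< y-axis lt))

    node-apart : ∀ i w → AdjV (node i) w → scale y-axis (υ (node i)) # scale y-axis (υ w)
    node-apart i w a with nb-complete i w a
    ... | s , ≡.refl = nb-apart (dir (ε i) s) (nb-υ i s)

    apart-heights : ∀ u v → AdjV u v → scale y-axis (υ u) # scale y-axis (υ v)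
    apart-heights (node i)       v          a = node-apart i v a
    apart-heights u@(leaf _ _ _) v@(node k) a = #-sym (node-apart k u (adjV-sym u v a))

    t-onto : ∀ v w → to v ≡ w → Internal v → ∃ λ i → t i ≡ v
    t-onto v (node i)       eq internal = i , from-eq (≡.sym eq)
    t-onto v u@(leaf i s f) eq internal = contradiction leaf-v internal
      where
      unique : ∀ w → AdjV u w → w ≡ node i
      unique (node k) ≡.refl = ≡.refl
      leaf-v : Leaf v
      leaf-v = t i , ≡.subst₂ AdjV (≡.sym eq) (≡.sym (to-t i)) ≡.refl ,
        λ {w} a → from-eq (≡.sym (unique (to w) (subst (λ u → AdjV u (to w)) eq a)))

    abscissa : ∀ i → X (t i) ≈ fromℕ (suc (toℕ i))
    abscissa i = begin
      scale x-axis (ξ (to (t i)))            ≡⟨ cong (scale x-axis ∘ ξ) (to-t i) ⟩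
      fromℕ (3 ℕ.+ 3 ℕ.* toℕ i) * ⅓          ≡⟨ cong (λ k → fromℕ k * ⅓) (≡.sym (ℕ.*-suc 3 (toℕ i))) ⟩
      fromℕ (3 ℕ.* suc (toℕ i)) * ⅓          ≈⟨ *-congʳ (trans (fromℕ-* 3 (suc (toℕ i))) (*-comm _ _)) ⟩
      fromℕ (suc (toℕ i)) * fromℕ 3 * ⅓      ≈⟨ *-assoc _ _ _ ⟩
      fromℕ (suc (toℕ i)) * (fromℕ 3 * ⅓)    ≈⟨ *-congˡ 3*⅓≈1 ⟩
      fromℕ (suc (toℕ i)) * 1#               ≈⟨ *-identityʳ _ ⟩
      fromℕ (suc (toℕ i))                    ∎
      where open import Relation.Binary.Reasoning.Setoid setoid

  signVector-mct : ∀ i → MCT.signVector mct i ≡ ε i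
  signVector-mct i = sign (ε i) ≡.refl
    where
    sign : ∀ s eq → [ const Sign.+ , const Sign.- ]′ (node-type i s eq) ≡ s
    sign Sign.+ _ = ≡.refl
    sign Sign.- _ = ≡.refl

  adjacent⇔linked : ∀ {p q} → (Adj (t p) (t q) → Linked p q) × (Linked p q → Adj (t p) (t q))
  adjacent⇔linked {p} {q} = ≡.subst₂ AdjV (to-t p) (to-t q) , ≡.subst₂ AdjV (≡.sym (to-t p)) (≡.sym (to-t q))

  edge-rises : ∀ {p q} → Edge p q → Y (t p) < Y (t q)
  edge-rises {p} {q} e = val-mono y-axis {node p} {node q} (υ-node-mono {p} {q} (rise e))

-- The Euler form

private
  module ℤ-Sum = SemiringSum ℤ.+-*-semiring

Σ-cong : ∀ {m} {f g : Vector ℤ m} → f ≗ g → Σℤ f ≡ Σℤ g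
Σ-cong = ℤ-Sum.sum-cong-≗

Σ-zero : ∀ {m} (f : Vector ℤ m) → (∀ i → f i ≡ 0ℤ) → Σℤ f ≡ 0ℤ
Σ-zero {zero}  f f≡0 = ≡.refl
Σ-zero {suc m} f f≡0 = cong₂ ℤ._+_ (f≡0 zero) (Σ-zero (f ∘ suc) (f≡0 ∘ suc))

-- The indicator of A ≤ k < B.
box : ℕ → ℕ → ℕ → ℤ
box zero    zero    k       = 0ℤ
box zero    (suc B) zero    = 1ℤ
box zero    (suc B) (suc k) = box zero B k
box (suc A) zero    k       = 0ℤ
box (suc A) (suc B) zero    = 0ℤ
box (suc A) (suc B) (suc k) = box A B k

box-in : ∀ {A B k} → A ℕ.≤ k → k ℕ.< B → box A B k ≡ 1ℤ
box-in {zero}  {suc B} {zero}  _       _         = ≡.refl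
box-in {zero}  {suc B} {suc k} _       (s≤s k<B) = box-in {zero} {B} {k} z≤n k<B
box-in {suc A} {suc B} {suc k} (s≤s l) (s≤s k<B) = box-in {A} {B} {k} l k<B

box-below : ∀ {A B k} → k ℕ.< A → box A B k ≡ 0ℤ
box-below {suc A} {zero}  {k}     _         = ≡.refl
box-below {suc A} {suc B} {zero}  _         = ≡.refl
box-below {suc A} {suc B} {suc k} (s≤s k<A) = box-below {A} {B} {k} k<A

box-above : ∀ {A B k} → B ℕ.≤ k → box A B k ≡ 0ℤ
box-above {zero}  {zero}  {k}     _         = ≡.refl
box-above {zero}  {suc B} {suc k} (s≤s B≤k) = box-above {zero} {B} {k} B≤k
box-above {suc A} {zero}  {k}     _         = ≡.refl
box-above {suc A} {suc B} {suc k} (s≤s B≤k) = box-above {A} {B} {k} B≤k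

β≡box : ∀ {m} (p q : Fin (suc m)) i → β p q i ≡ box (toℕ p) (toℕ q) (toℕ i)
β≡box p q i with toℕ p ℕ.≤? toℕ i | toℕ i ℕ.<? toℕ q
... | yes p≤i | yes i<q = ≡.trans (cong (if_then 1ℤ else 0ℤ) (dec-true (toℕ p ℕ.≤? toℕ i ×-dec toℕ i ℕ.<? toℕ q) (p≤i , i<q))) (≡.sym (box-in p≤i i<q))
... | no  p≰i | _       = ≡.trans (cong (if_then 1ℤ else 0ℤ) (dec-false (toℕ p ℕ.≤? toℕ i ×-dec toℕ i ℕ.<? toℕ q) (p≰i ∘ proj₁))) (≡.sym (box-below {toℕ p} {toℕ q} {toℕ i} (ℕ.≰⇒> p≰i)))
... | _       | no i≮q  = ≡.trans (cong (if_then 1ℤ else 0ℤ) (dec-false (toℕ p ℕ.≤? toℕ i ×-dec toℕ i ℕ.<? toℕ q) (i≮q ∘ proj₂))) (≡.sym (box-above {toℕ p} {toℕ q} {toℕ i} (ℕ.≮⇒≥ i≮q)))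

step : ∀ {m} → Vector ℤ (suc m) → Vector ℤ m
step x j = x (suc j) ℤ.- x (inject₁ j)

telescope : ∀ {m} (x : Vector ℤ (suc m)) (p q : Fin (suc m)) → p Fin.≤ q →
            Σℤ (λ j → step x j ℤ.* box (toℕ p) (toℕ q) (toℕ j)) ≡ x q ℤ.- x p
telescope x zero zero _ = ≡.trans
  (Σ-zero _ λ j → ≡.trans (cong (step x j ℤ.*_) (box-above {0} {0} {toℕ j} z≤n)) (ℤ.*-zeroʳ (step x j)))
  (≡.sym (ℤ.+-inverseʳ (x zero)))
telescope {suc m} x zero (suc q) _ = ≡.trans
  (cong₂ ℤ._+_ (ℤ.*-identityʳ (step x zero)) (telescope (x ∘ suc) zero q z≤n))
  (chain (x zero) (x (suc zero)) (x (suc q)))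
  where
  chain : ∀ a b c → (b ℤ.- a) ℤ.+ (c ℤ.- b) ≡ c ℤ.- a
  chain = solve-∀
telescope {suc m} x (suc p) (suc q) (s≤s p≤q) = ≡.trans
  (cong₂ ℤ._+_ (ℤ.*-zeroʳ (step x zero)) (telescope (x ∘ suc) p q p≤q))
  (ℤ.+-identityˡ _)

-- before and after are the contributions of the vertices j - 1 and j + 1 to
-- the j-th entry of E^t b.
minus-if : Sign → Sign → ℤ → ℤ
minus-if Sign.+ Sign.+ z = ℤ.- z
minus-if Sign.- Sign.- z = ℤ.- z
minus-if Sign.+ Sign.- z = 0ℤ
minus-if Sign.- Sign.+ z = 0ℤ

minus-if-0 : ∀ s s′ → minus-if s s′ 0ℤ ≡ 0ℤ
minus-if-0 Sign.+ Sign.+ = ≡.refl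
minus-if-0 Sign.- Sign.- = ≡.refl
minus-if-0 Sign.+ Sign.- = ≡.refl
minus-if-0 Sign.- Sign.+ = ≡.refl

before : ∀ {m} → Vector Sign (suc m) → (ℕ → ℤ) → Fin m → ℤ
before ε b zero    = 0ℤ
before ε b (suc j) = minus-if Sign.- (ε (suc (inject₁ j))) (b (toℕ j))

after : ∀ {m} → Vector Sign (suc m) → (ℕ → ℤ) → Fin m → ℤ
after ε b j = minus-if Sign.+ (ε (suc j)) (b (suc (toℕ j)))

-- Column j of the Euler matrix vanishes outside j - 1, j and j + 1. With b defined on all of ℕ,
-- dropping the first vertex is a shift and induction applies; `b m ≡ 0ℤ` silences the missing
-- neighbour after the last vertex.
euler-column : ∀ {m} (ε : Vector Sign (suc m)) (b : ℕ → ℤ) → b m ≡ 0ℤ → ∀ j →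
               Σℤ (λ i → euler ε i j ℤ.* b (toℕ i)) ≡ before ε b j ℤ.+ b (toℕ j) ℤ.+ after ε b j
euler-column {suc zero} ε b b₁≡0 zero = ≡.trans (unit (b 0)) (cong (λ z → 0ℤ ℤ.+ b 0 ℤ.+ z) (≡.sym vanish))
  where
  unit : ∀ z → 1ℤ ℤ.* z ℤ.+ 0ℤ ≡ 0ℤ ℤ.+ z ℤ.+ 0ℤ
  unit = solve-∀
  vanish : after ε b zero ≡ 0ℤ
  vanish = ≡.trans (cong (minus-if Sign.+ (ε (suc zero))) b₁≡0) (minus-if-0 Sign.+ (ε (suc zero)))
euler-column {suc (suc m)} ε b b≡0 zero = ≡.trans
  (cong₂ ℤ._+_ (ℤ.*-identityˡ (b 0)) (cong₂ ℤ._+_ (next (ε (suc zero)) ≡.refl) (Σ-zero {m} _ λ i → ℤ.*-zeroˡ (b (suc (suc (toℕ i)))))))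
  (arrange (b 0) (after ε b zero))
  where
  next : ∀ s → ε (suc zero) ≡ s → euler ε (suc zero) zero ℤ.* b 1 ≡ minus-if Sign.+ s (b 1)
  next Sign.+ eq rewrite eq = ℤ.-1*i≡-i (b 1)
  next Sign.- eq rewrite eq = ℤ.*-zeroˡ (b 1)
  arrange : ∀ x y → x ℤ.+ (y ℤ.+ 0ℤ) ≡ 0ℤ ℤ.+ x ℤ.+ y
  arrange = solve-∀
euler-column {suc (suc m)} ε b b≡0 (suc zero) = ≡.trans
  (cong₂ ℤ._+_ (previous (ε (suc zero)) ≡.refl) (euler-column (ε ∘ suc) (b ∘ suc) b≡0 zero))
  (arrange (before ε b (suc zero)) (b 1) (after ε b (suc zero)))
  where
  previous : ∀ s → ε (suc zero) ≡ s → euler ε zero (suc zero) ℤ.* b 0 ≡ minus-if Sign.- s (b 0)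
  previous Sign.+ eq rewrite eq = ℤ.*-zeroˡ (b 0)
  previous Sign.- eq rewrite eq = ℤ.-1*i≡-i (b 0)
  arrange : ∀ x y z → x ℤ.+ (0ℤ ℤ.+ y ℤ.+ z) ≡ x ℤ.+ y ℤ.+ z
  arrange = solve-∀
euler-column {suc (suc m)} ε b b≡0 (suc (suc j)) = ≡.trans
  (cong₂ ℤ._+_ (ℤ.*-zeroˡ (b 0)) (euler-column (ε ∘ suc) (b ∘ suc) b≡0 (suc j)))
  (ℤ.+-identityˡ _)

eulerᵗ : ∀ {m} → Vector Sign (suc m) → Vector ℤ m → Vector ℤ m
eulerᵗ ε v j = Σℤ λ i → euler ε i j ℤ.* v i

eulerForm-eulerᵗ : ∀ {m} (ε : Vector Sign (suc m)) v w → eulerForm ε v w ≡ Σℤ (λ j → eulerᵗ ε v j ℤ.* w j)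
eulerForm-eulerᵗ ε v w = ≡.trans (ℤ-Sum.∑-comm (λ i j → v i ℤ.* euler ε i j ℤ.* w j)) (Σ-cong λ j →
  ≡.trans (Σ-cong λ i → cong (ℤ._* w j) (ℤ.*-comm (v i) (euler ε i j))) (≡.sym (ℤ-Sum.*-distribʳ-sum (w j) (λ i → euler ε i j ℤ.* v i))))

Σ-identity : ∀ {m} (v : Vector ℤ m) k → Σℤ (λ i → v i ℤ.* identity i k) ≡ v k
Σ-identity v zero = ≡.trans (cong₂ ℤ._+_ (ℤ.*-identityʳ (v zero)) (Σ-zero _ λ i → ℤ.*-zeroʳ (v (suc i)))) (ℤ.+-identityʳ (v zero))
Σ-identity v (suc k) = ≡.trans (cong₂ ℤ._+_ (ℤ.*-zeroʳ (v zero)) (Σ-identity (v ∘ suc) k)) (ℤ.+-identityˡ _)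

-- Multiplying by the inverse recovers v, so E^t is injective as soon as an inverse is at hand.
eulerᵗ-inverse : ∀ {m} (ε : Vector Sign (suc m)) {Π} → IsInverse (euler ε) Π → ∀ v k →
                 Σℤ (λ l → eulerᵗ ε v l ℤ.* Π l k) ≡ v k
eulerᵗ-inverse ε {Π} (EΠ , _) v k = begin
  Σℤ (λ l → eulerᵗ ε v l ℤ.* Π l k)                       ≡⟨ Σ-cong (λ l → ℤ-Sum.*-distribʳ-sum (Π l k) (λ i → euler ε i l ℤ.* v i)) ⟩
  Σℤ (λ l → Σℤ λ i → euler ε i l ℤ.* v i ℤ.* Π l k)       ≡⟨ ℤ-Sum.∑-comm (λ l i → euler ε i l ℤ.* v i ℤ.* Π l k) ⟩
  Σℤ (λ i → Σℤ λ l → euler ε i l ℤ.* v i ℤ.* Π l k)       ≡⟨ Σ-cong (λ i → Σ-cong λ l → swap (euler ε i l) (v i) (Π l k)) ⟩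
  Σℤ (λ i → Σℤ λ l → v i ℤ.* (euler ε i l ℤ.* Π l k))     ≡⟨ Σ-cong (λ i → ≡.sym (ℤ-Sum.*-distribˡ-sum (v i) (λ l → euler ε i l ℤ.* Π l k))) ⟩
  Σℤ (λ i → v i ℤ.* Σℤ λ l → euler ε i l ℤ.* Π l k)       ≡⟨ Σ-cong (λ i → cong (v i ℤ.*_) (EΠ i k)) ⟩
  Σℤ (λ i → v i ℤ.* identity i k)                         ≡⟨ Σ-identity v k ⟩
  v k                                                     ∎
  where
  open ≡-Reasoning
  swap : ∀ a b c → a ℤ.* b ℤ.* c ≡ b ℤ.* (a ℤ.* c)
  swap = solve-∀

eulerᵗ-projective : ∀ {m} (ε : Vector Sign (suc m)) {Π} → IsInverse (euler ε) Π → ∀ {v} i → (∀ j → v j ≡ ℤ.- Π i j) →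
                    ∀ j → eulerᵗ ε v j ≡ ℤ.- identity i j
eulerᵗ-projective ε {Π} (_ , ΠE) {v} i v≡ j = begin
  Σℤ (λ k → euler ε k j ℤ.* v k)              ≡⟨ Σ-cong (λ k → ≡.trans (cong (euler ε k j ℤ.*_) (v≡ k)) (swap (euler ε k j) (Π i k))) ⟩
  Σℤ (λ k → -1ℤ ℤ.* (Π i k ℤ.* euler ε k j))  ≡⟨ ≡.sym (ℤ-Sum.*-distribˡ-sum -1ℤ (λ k → Π i k ℤ.* euler ε k j)) ⟩
  -1ℤ ℤ.* Σℤ (λ k → Π i k ℤ.* euler ε k j)    ≡⟨ ℤ.-1*i≡-i _ ⟩
  ℤ.- Σℤ (λ k → Π i k ℤ.* euler ε k j)        ≡⟨ cong ℤ.-_ (ΠE i j) ⟩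
  ℤ.- identity i j                            ∎
  where
  open ≡-Reasoning
  swap : ∀ a b → a ℤ.* (ℤ.- b) ≡ -1ℤ ℤ.* (b ℤ.* a)
  swap = solve-∀

-- Noncrossing diagonals

isΛ isV : Sign → Bool
isΛ Sign.+ = true
isΛ Sign.- = false
isV Sign.+ = false
isV Sign.- = true

true≢false : {A : Set} {b : Bool} → b ≡ true → b ≡ false → A
true≢false ≡.refl ()

isΛ-true : ∀ {s} → isΛ s ≡ true → s ≡ Sign.+
isΛ-true {Sign.+} _ = ≡.refl

isΛ-false : ∀ {s} → isΛ s ≡ false → s ≡ Sign.-
isΛ-false {Sign.-} _ = ≡.refl

isV-true : ∀ {s} → isV s ≡ true → s ≡ Sign.-
isV-true {Sign.-} _ = ≡.refl

isV-false : ∀ {s} → isV s ≡ false → s ≡ Sign.+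
isV-false {Sign.+} _ = ≡.refl

module Diagonals {m : ℕ} (ε : Vector Sign (suc m)) where

  private
    n = suc m

  -- F maps the indicator of this set to the image of β r s under E^t.
  rootSet : Fin n → Fin n → Fin n → Bool
  rootSet r s i with ℕ.<-cmp (toℕ i) (toℕ r) | ℕ.<-cmp (toℕ i) (toℕ s)
  ... | tri< _ _ _ | _          = isΛ (ε r)
  ... | tri≈ _ _ _ | _          = false
  ... | tri> _ _ _ | tri< _ _ _ = isV (ε i)
  ... | tri> _ _ _ | tri≈ _ _ _ = true
  ... | tri> _ _ _ | tri> _ _ _ = isΛ (ε s)

  data RootView (r s i : Fin n) (b : Bool) : Set where
    left  : i Fin.< r → b ≡ isΛ (ε r) → RootView r s i b
    at-r  : i ≡ r → b ≡ false → RootView r s i b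
    mid   : r Fin.< i → i Fin.< s → b ≡ isV (ε i) → RootView r s i b
    at-s  : i ≡ s → b ≡ true → RootView r s i b
    right : s Fin.< i → b ≡ isΛ (ε s) → RootView r s i b

  rootView : ∀ {r s} i → RootView r s i (rootSet r s i)
  rootView {r} {s} i with ℕ.<-cmp (toℕ i) (toℕ r) | ℕ.<-cmp (toℕ i) (toℕ s)
  ... | tri< i<r _ _ | _            = left i<r ≡.refl
  ... | tri≈ _ i≡r _ | _            = at-r (Fin.toℕ-injective i≡r) ≡.refl
  ... | tri> _ _ r<i | tri< i<s _ _ = mid r<i i<s ≡.refl
  ... | tri> _ _ _   | tri≈ _ i≡s _ = at-s (Fin.toℕ-injective i≡s) ≡.refl
  ... | tri> _ _ _   | tri> _ _ s<i = right s<i ≡.refl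

  rootView′ : ∀ {r s i b} → rootSet r s i ≡ b → RootView r s i b
  rootView′ {r} {s} {i} eq = subst (RootView r s i) eq (rootView i)

  module _ {r s : Fin n} (r<s : r Fin.< s) where

    root-left : ∀ {i} → i Fin.< r → rootSet r s i ≡ isΛ (ε r)
    root-left {i} i<r with rootView {r} {s} i
    ... | left _ eq      = eq
    ... | at-r ≡.refl _    = contradiction i<r (ℕ.<-irrefl ≡.refl)
    ... | mid r<i _ _    = contradiction i<r (ℕ.<-asym r<i)
    ... | at-s ≡.refl _    = contradiction i<r (ℕ.<-asym r<s)
    ... | right s<i _    = contradiction i<r (ℕ.<-asym (ℕ.<-trans r<s s<i))

    root-r : rootSet r s r ≡ false
    root-r with rootView {r} {s} r
    ... | left r<r _     = contradiction r<r (ℕ.<-irrefl ≡.refl)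
    ... | at-r _ eq      = eq
    ... | mid r<r _ _    = contradiction r<r (ℕ.<-irrefl ≡.refl)
    ... | at-s ≡.refl _    = contradiction r<s (ℕ.<-irrefl ≡.refl)
    ... | right s<r _    = contradiction r<s (ℕ.<-asym s<r)

    root-mid : ∀ {i} → r Fin.< i → i Fin.< s → rootSet r s i ≡ isV (ε i)
    root-mid {i} r<i i<s with rootView {r} {s} i
    ... | left i<r _     = contradiction i<r (ℕ.<-asym r<i)
    ... | at-r ≡.refl _    = contradiction r<i (ℕ.<-irrefl ≡.refl)
    ... | mid _ _ eq     = eq
    ... | at-s ≡.refl _    = contradiction i<s (ℕ.<-irrefl ≡.refl)
    ... | right s<i _    = contradiction i<s (ℕ.<-asym s<i)

    root-s : rootSet r s s ≡ true
    root-s with rootView {r} {s} s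
    ... | left s<r _     = contradiction r<s (ℕ.<-asym s<r)
    ... | at-r ≡.refl _    = contradiction r<s (ℕ.<-irrefl ≡.refl)
    ... | mid _ s<s _    = contradiction s<s (ℕ.<-irrefl ≡.refl)
    ... | at-s _ eq      = eq
    ... | right s<s _    = contradiction s<s (ℕ.<-irrefl ≡.refl)

    root-right : ∀ {i} → s Fin.< i → rootSet r s i ≡ isΛ (ε s)
    root-right {i} s<i with rootView {r} {s} i
    ... | left i<r _     = contradiction i<r (ℕ.<-asym (ℕ.<-trans r<s s<i))
    ... | at-r ≡.refl _    = contradiction r<s (ℕ.<-asym s<i)
    ... | mid _ i<s _    = contradiction i<s (ℕ.<-asym s<i)
    ... | at-s ≡.refl _    = contradiction s<i (ℕ.<-irrefl ≡.refl)
    ... | right _ eq     = eq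

  -- F maps the indicator of this set to minus a unit vector, the image of
  -- a negative projective root under E^t.
  projectiveSet : Fin m → Fin n → Bool
  projectiveSet i₀ i = does (toℕ i ℕ.≤? toℕ i₀)

  projective-true : ∀ {i₀ i} → toℕ i ℕ.≤ toℕ i₀ → projectiveSet i₀ i ≡ true
  projective-true {i₀} {i} le = dec-true (toℕ i ℕ.≤? toℕ i₀) le

  projective-false : ∀ {i₀ i} → toℕ i₀ ℕ.< toℕ i → projectiveSet i₀ i ≡ false
  projective-false {i₀} {i} lt = dec-false (toℕ i ℕ.≤? toℕ i₀) (ℕ.<⇒≱ lt)

  projective-≤ : ∀ {i₀ i} → projectiveSet i₀ i ≡ true → toℕ i ℕ.≤ toℕ i₀
  projective-≤ {i₀} {i} eq = ℕ.≮⇒≥ λ lt → true≢false eq (projective-false {i₀} {i} lt)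

  projective-> : ∀ {i₀ i} → projectiveSet i₀ i ≡ false → toℕ i₀ ℕ.< toℕ i
  projective-> {i₀} {i} eq = ℕ.≰⇒> λ le → true≢false (projective-true {i₀} {i} le) eq

  data Diagonal : Set where
    root       : (r s : Fin n) → r Fin.< s → Diagonal
    projective : Fin m → Diagonal

  setOf : Diagonal → Fin n → Bool
  setOf (root r s _)   = rootSet r s
  setOf (projective i) = projectiveSet i

  low high : Diagonal → Fin n
  low (root r s _)    = r
  low (projective i)  = suc i
  high (root r s _)   = s
  high (projective i) = inject₁ i

  -- The wall hanging from a Λ-node above the diagonal blocks it. The diagonal stays on one side of
  -- k, and all nodes on the other side are above it like k.
  Λ-extends : ∀ d {k} → ε k ≡ Sign.+ → setOf d k ≡ true →
              (∀ i → i Fin.< k → setOf d i ≡ true) ⊎ (∀ i → k Fin.< i → setOf d i ≡ true)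
  Λ-extends (projective i₀) {k} Λ k∈ = inj₁ λ i i<k → projective-true {i₀} {i} (ℕ.≤-trans (ℕ.<⇒≤ i<k) (projective-≤ {i₀} {k} k∈))
  Λ-extends (root r s r<s) {k} Λ k∈ with rootView′ {r} {s} k∈
  ... | left k<r eq  = inj₁ λ i i<k → ≡.trans (root-left r<s (ℕ.<-trans i<k k<r)) (≡.sym eq)
  ... | at-r _ ()
  ... | mid _ _ eq   = true≢false (≡.sym eq) (cong isV Λ)
  ... | at-s ≡.refl _  = inj₂ λ i s<i → ≡.trans (root-right r<s s<i) (cong isΛ Λ)
  ... | right s<k eq = inj₂ λ i k<i → ≡.trans (root-right r<s (ℕ.<-trans s<k k<i)) (≡.sym eq)

  V-extends : ∀ d {k} → ε k ≡ Sign.- → setOf d k ≡ false →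
              (∀ i → i Fin.< k → setOf d i ≡ false) ⊎ (∀ i → k Fin.< i → setOf d i ≡ false)
  V-extends (projective i₀) {k} V k∉ = inj₂ λ i k<i → projective-false {i₀} {i} (ℕ.<-trans (projective-> {i₀} {k} k∉) k<i)
  V-extends (root r s r<s) {k} V k∉ with rootView′ {r} {s} k∉
  ... | left k<r eq  = inj₁ λ i i<k → ≡.trans (root-left r<s (ℕ.<-trans i<k k<r)) (≡.sym eq)
  ... | at-r ≡.refl _  = inj₁ λ i i<r → ≡.trans (root-left r<s i<r) (cong isΛ V)
  ... | mid _ _ eq   = true≢false (cong isV V) (≡.sym eq)
  ... | at-s _ ()
  ... | right s<k eq = inj₂ λ i k<i → ≡.trans (root-right r<s (ℕ.<-trans s<k k<i)) (≡.sym eq)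

  -- U is the set of the nodes above a diagonal, that is a gap [A, B]; the node p
  -- is next to it from below and q from above.
  record Frame (U : Fin n → Bool) (p q : Fin n) : Set where
    field
      {A B} : ℕ
      A≤B   : A ℕ.≤ B
      B≤n   : B ℕ.≤ n
      inner     : ∀ i → A ℕ.≤ toℕ i → toℕ i ℕ.< B → U i ≡ isV (ε i)
      boundˡ    : ∀ a → suc (toℕ a) ≡ A → U a ≡ isΛ (ε a)
      boundʳ    : ∀ b → toℕ b ≡ B → U b ≡ isΛ (ε b)
      far-left  : ∀ i a → suc (toℕ a) ≡ A → i Fin.≤ a → U i ≡ U a
      far-right : ∀ i b → toℕ b ≡ B → b Fin.≤ i → U i ≡ U b
      touch-low  : A ℕ.≤ suc (toℕ p) × toℕ p ℕ.≤ B
      touch-high : A ℕ.≤ suc (toℕ q) × toℕ q ℕ.≤ B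
      low∉       : U p ≡ false
      high∈      : U q ≡ true

  private
    ≢+ : ∀ {s} → s ≢ Sign.+ → s ≡ Sign.-
    ≢+ {Sign.+} ne = contradiction ≡.refl ne
    ≢+ {Sign.-} _  = ≡.refl

    ≢- : ∀ {s} → s ≢ Sign.- → s ≡ Sign.+
    ≢- {Sign.-} ne = contradiction ≡.refl ne
    ≢- {Sign.+} _  = ≡.refl

  -- The left end of the gap of a root. The wall of a V-node r stops the gap at once. If r is a
  -- Λ-node, all nodes to its left count as above the diagonal, so only a Λ-wall can stop it, and
  -- the next one does.
  record Leftwards (r : Fin n) : Set where
    field
      {A}    : ℕ
      A≤     : A ℕ.≤ suc (toℕ r)
      inside : ∀ i → A ℕ.≤ toℕ i → i Fin.≤ r → ε r ≡ Sign.+ × (i Fin.< r → ε i ≡ Sign.-)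
      bound  : ∀ a → suc (toℕ a) ≡ A → (a ≡ r × ε r ≡ Sign.-) ⊎ (a Fin.< r × ε a ≡ Sign.+ × ε r ≡ Sign.+)

  leftwards : ∀ r → Leftwards r
  leftwards r with ε r in eq
  ... | Sign.- = record
    { A≤ = ℕ.≤-refl
    ; inside = λ i r<i i≤r → contradiction i≤r (ℕ.<⇒≱ r<i)
    ; bound = λ a a≡r → inj₁ (Fin.toℕ-injective (ℕ.suc-injective a≡r) , eq) }
  ... | Sign.+ with nearestˡ {P = λ i → ε i ≡ Sign.+} (λ i → ε i Sign.≟ Sign.+) (toℕ r) (ℕ.<⇒≤ (Fin.toℕ<n r))
  ...   | A , A≤r , inner , bound = record
    { A≤ = ℕ.m≤n⇒m≤1+n A≤r
    ; inside = λ i A≤i i≤r → eq , λ i<r → ≢+ (inner i A≤i i<r)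
    ; bound = λ a a≡A → inj₂ (subst (ℕ._≤ toℕ r) (≡.sym a≡A) A≤r , bound a a≡A , eq) }

  record Rightwards (s : Fin n) : Set where
    field
      {B}    : ℕ
      ≤B     : toℕ s ℕ.≤ B
      B≤n    : B ℕ.≤ n
      inside : ∀ i → toℕ i ℕ.< B → s Fin.≤ i → ε s ≡ Sign.- × (s Fin.< i → ε i ≡ Sign.+)
      bound  : ∀ b → toℕ b ≡ B → (b ≡ s × ε s ≡ Sign.+) ⊎ (s Fin.< b × ε b ≡ Sign.- × ε s ≡ Sign.-)

  rightwards : ∀ s → Rightwards s
  rightwards s with ε s in eq
  ... | Sign.+ = record
    { ≤B = ℕ.≤-refl
    ; B≤n = ℕ.<⇒≤ (Fin.toℕ<n s)
    ; inside = λ i i<s s≤i → contradiction s≤i (ℕ.<⇒≱ i<s)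
    ; bound = λ b b≡s → inj₁ (Fin.toℕ-injective b≡s , eq) }
  ... | Sign.- with nearestʳ {P = λ i → ε i ≡ Sign.-} (λ i → ε i Sign.≟ Sign.-) (n ℕ.∸ suc (toℕ s)) (suc (toℕ s)) (ℕ.m+[n∸m]≡n (Fin.toℕ<n s))
  ...   | B , s<B , B≤n , inner , bound = record
    { ≤B = ℕ.<⇒≤ s<B
    ; B≤n = B≤n
    ; inside = λ i i<B s≤i → eq , λ s<i → ≢- (inner i s<i i<B)
    ; bound = λ b b≡B → inj₂ (subst (toℕ s ℕ.<_) (≡.sym b≡B) s<B , bound b b≡B , eq) }

  root-frame : ∀ {r s} → r Fin.< s → Frame (rootSet r s) r s
  root-frame {r} {s} r<s = record
    { A≤B = ℕ.≤-trans L.A≤ (ℕ.≤-trans r<s R.≤B)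
    ; B≤n = R.B≤n
    ; inner = inner
    ; boundˡ = boundˡ
    ; boundʳ = boundʳ
    ; far-left = far-left
    ; far-right = far-right
    ; touch-low = L.A≤ , ℕ.≤-trans (ℕ.<⇒≤ r<s) R.≤B
    ; touch-high = ℕ.≤-trans L.A≤ (ℕ.m≤n⇒m≤1+n r<s) , R.≤B
    ; low∉ = root-r r<s
    ; high∈ = root-s r<s
    }
    where
    module L = Leftwards (leftwards r)
    module R = Rightwards (rightwards s)
    U = rootSet r s
    inner : ∀ i → L.A ℕ.≤ toℕ i → toℕ i ℕ.< R.B → U i ≡ isV (ε i)
    inner i A≤i i<B with rootView {r} {s} i
    ... | left i<r eq   = let Λ , V = L.inside i A≤i (ℕ.<⇒≤ i<r) in ≡.trans eq (≡.trans (cong isΛ Λ) (≡.sym (cong isV (V i<r))))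
    ... | at-r ≡.refl eq  = ≡.trans eq (≡.sym (cong isV (proj₁ (L.inside i A≤i ℕ.≤-refl))))
    ... | mid _ _ eq    = eq
    ... | at-s ≡.refl eq  = ≡.trans eq (≡.sym (cong isV (proj₁ (R.inside i i<B ℕ.≤-refl))))
    ... | right s<i eq  = let V , Λ = R.inside i i<B (ℕ.<⇒≤ s<i) in ≡.trans eq (≡.trans (cong isΛ V) (≡.sym (cong isV (Λ s<i))))
    boundˡ : ∀ a → suc (toℕ a) ≡ L.A → U a ≡ isΛ (ε a)
    boundˡ a a≡A with L.bound a a≡A
    ... | inj₁ (≡.refl , V)      = ≡.trans (root-r r<s) (≡.sym (cong isΛ V))
    ... | inj₂ (a<r , Λ , Λ′)  = ≡.trans (root-left r<s a<r) (cong isΛ (≡.trans Λ′ (≡.sym Λ)))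
    boundʳ : ∀ b → toℕ b ≡ R.B → U b ≡ isΛ (ε b)
    boundʳ b b≡B with R.bound b b≡B
    ... | inj₁ (≡.refl , Λ)      = ≡.trans (root-s r<s) (≡.sym (cong isΛ Λ))
    ... | inj₂ (s<b , V , V′)  = ≡.trans (root-right r<s s<b) (cong isΛ (≡.trans V′ (≡.sym V)))
    far-left : ∀ i a → suc (toℕ a) ≡ L.A → i Fin.≤ a → U i ≡ U a
    far-left i a a≡A i≤a with L.bound a a≡A
    ... | inj₂ (a<r , _) = ≡.trans (root-left r<s (ℕ.≤-<-trans i≤a a<r)) (≡.sym (root-left r<s a<r))
    ... | inj₁ (≡.refl , V) with ℕ.m≤n⇒m<n∨m≡n i≤a
    ...   | inj₁ i<r = ≡.trans (root-left r<s i<r) (≡.trans (cong isΛ V) (≡.sym (root-r r<s)))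
    ...   | inj₂ i≡r = cong U (Fin.toℕ-injective i≡r)
    far-right : ∀ i b → toℕ b ≡ R.B → b Fin.≤ i → U i ≡ U b
    far-right i b b≡B b≤i with R.bound b b≡B
    ... | inj₂ (s<b , _) = ≡.trans (root-right r<s (ℕ.<-≤-trans s<b b≤i)) (≡.sym (root-right r<s s<b))
    ... | inj₁ (≡.refl , Λ) with ℕ.m≤n⇒m<n∨m≡n b≤i
    ...   | inj₁ s<i = ≡.trans (root-right r<s s<i) (≡.trans (cong isΛ Λ) (≡.sym (root-s r<s)))
    ...   | inj₂ s≡i = cong U (≡.sym (Fin.toℕ-injective s≡i))

  -- The nodes up to i₀ are above the diagonal and the others below. From the column between them
  -- the gap reaches to the next Λ-wall on the left and the next V-wall on the right.
  projective-frame : ∀ i₀ → Frame (projectiveSet i₀) (suc i₀) (inject₁ i₀)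
  projective-frame i₀
    with nearestˡ {P = λ i → ε i ≡ Sign.+} (λ i → ε i Sign.≟ Sign.+) (suc (toℕ i₀)) (ℕ.<⇒≤ (s≤s (Fin.toℕ<n i₀)))
       | nearestʳ {P = λ i → ε i ≡ Sign.-} (λ i → ε i Sign.≟ Sign.-) (n ℕ.∸ suc (toℕ i₀)) (suc (toℕ i₀)) (ℕ.m+[n∸m]≡n (ℕ.<⇒≤ (s≤s (Fin.toℕ<n i₀))))
  ... | A , A≤c , innerˡ , boundˡ | B , c≤B , B≤n , innerʳ , boundʳ = record
    { A≤B = ℕ.≤-trans A≤c c≤B
    ; B≤n = B≤n
    ; inner = inner
    ; boundˡ = λ a a≡A → ≡.trans (U-true {a} (left-of a≡A)) (≡.sym (cong isΛ (boundˡ a a≡A)))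
    ; boundʳ = λ b b≡B → ≡.trans (U-false {b} (right-of b≡B)) (≡.sym (cong isΛ (boundʳ b b≡B)))
    ; far-left = λ i a a≡A i≤a → ≡.trans (U-true {i} (ℕ.≤-trans i≤a (left-of a≡A))) (≡.sym (U-true {a} (left-of a≡A)))
    ; far-right = λ i b b≡B b≤i → ≡.trans (U-false {i} (ℕ.≤-trans (right-of b≡B) b≤i)) (≡.sym (U-false {b} (right-of b≡B)))
    ; touch-low = ℕ.m≤n⇒m≤1+n A≤c , c≤B
    ; touch-high = subst (λ k → A ℕ.≤ suc k) (≡.sym (Fin.toℕ-inject₁ i₀)) A≤c , subst (ℕ._≤ B) (≡.sym (Fin.toℕ-inject₁ i₀)) (ℕ.<⇒≤ c≤B)
    ; low∉ = U-false {suc i₀} ℕ.≤-refl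
    ; high∈ = U-true {inject₁ i₀} (ℕ.≤-reflexive (Fin.toℕ-inject₁ i₀))
    }
    where
    U = projectiveSet i₀
    U-true : ∀ {i} → toℕ i ℕ.≤ toℕ i₀ → U i ≡ true
    U-true {i} = projective-true {i₀} {i}
    U-false : ∀ {i} → toℕ i₀ ℕ.< toℕ i → U i ≡ false
    U-false {i} = projective-false {i₀} {i}
    left-of : ∀ {a : Fin n} → suc (toℕ a) ≡ A → toℕ a ℕ.≤ toℕ i₀
    left-of a≡A = ℕ.≤-pred (subst (ℕ._≤ suc (toℕ i₀)) (≡.sym a≡A) A≤c)
    right-of : ∀ {b : Fin n} → toℕ b ≡ B → toℕ i₀ ℕ.< toℕ b
    right-of b≡B = subst (toℕ i₀ ℕ.<_) (≡.sym b≡B) c≤B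
    inner : ∀ i → A ℕ.≤ toℕ i → toℕ i ℕ.< B → U i ≡ isV (ε i)
    inner i A≤i i<B with toℕ i ℕ.≤? toℕ i₀
    ... | yes i≤i₀ = ≡.trans (U-true {i} i≤i₀) (≡.sym (cong isV (≢+ (innerˡ i A≤i (s≤s i≤i₀)))))
    ... | no  i≰i₀ = ≡.trans (U-false {i} (ℕ.≰⇒> i≰i₀)) (≡.sym (cong isV (≢- (innerʳ i (ℕ.≰⇒> i≰i₀) i<B))))

  frame : ∀ d → Frame (setOf d) (low d) (high d)
  frame (root r s r<s)  = root-frame r<s
  frame (projective i₀) = projective-frame i₀

  -- The numerical form of Ext¹(M′, M) = 0.
  Compatible : Diagonal → Diagonal → Set
  Compatible d′ (root r s _)   = setOf d′ r ≡ true → setOf d′ s ≡ true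
  Compatible d′ (projective _) = ⊤

  module _ (d : Diagonal) where
    private
      module Fr = Frame (frame d)
      U = setOf d

    Near : Fin n → Set
    Near i = Fr.A ℕ.≤ suc (toℕ i) × toℕ i ℕ.≤ Fr.B

    data Place (i : Fin n) : Set where
      inside   : Fr.A ℕ.≤ toℕ i → toℕ i ℕ.< Fr.B → Place i
      on-left  : suc (toℕ i) ≡ Fr.A → Place i
      on-right : toℕ i ≡ Fr.B → Place i

    place : ∀ {i} → Near i → Place i
    place (A≤1+i , i≤B) with ℕ.m≤n⇒m<n∨m≡n A≤1+i | ℕ.m≤n⇒m<n∨m≡n i≤B
    ... | inj₂ eq | _        = on-left (≡.sym eq)
    ... | inj₁ _  | inj₂ eq  = on-right eq
    ... | inj₁ (s≤s A≤i) | inj₁ i<B = inside A≤i i<B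

    private
      strictly-inside : ∀ {k l i} → Near k → Near i → k Fin.< l → l Fin.< i → U l ≡ isV (ε l)
      strictly-inside (A≤1+k , _) (_ , i≤B) k<l l<i = Fr.inner _ (ℕ.≤-trans A≤1+k k<l) (ℕ.<-≤-trans l<i i≤B)

      not-right : ∀ {k i : Fin n} → Near i → k Fin.< i → toℕ k ≢ Fr.B
      not-right (_ , i≤B) k<i k≡B = ℕ.<⇒≱ k<i (subst (_ ℕ.≤_) (≡.sym k≡B) i≤B)

      not-left : ∀ {k i : Fin n} → Near k → k Fin.< i → suc (toℕ i) ≢ Fr.A
      not-left (A≤1+k , _) k<i i≡A = ℕ.<⇒≱ (s≤s k<i) (subst (ℕ._≤ suc _) (≡.sym i≡A) A≤1+k)

      -- The ends of β r′ s′ contradict the compatibility of this root with d.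
      descent : ∀ {r′ s′} (r′<s′ : r′ Fin.< s′) {i k} → Near i → Near k → k Fin.< i → U i ≡ false → U k ≡ true →
                rootSet r′ s′ i ≡ true → rootSet r′ s′ k ≡ false → U r′ ≡ true × U s′ ≡ false
      descent {r′} {s′} r′<s′ {i} {k} ni nk k<i i∉ k∈ i∈′ k∉′ = from-k (rootView′ k∉′) , from-i (rootView′ i∈′)
        where
        r′<i : RootView r′ s′ i true → r′ Fin.< i
        r′<i (left i<r′ eq)   = true≢false (≡.trans (root-left r′<s′ (ℕ.<-trans k<i i<r′)) (≡.sym eq)) k∉′
        r′<i (at-r _ ())
        r′<i (mid r′<i _ _)   = r′<i
        r′<i (at-s ≡.refl _)    = r′<s′
        r′<i (right s′<i _)   = ℕ.<-trans r′<s′ s′<i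

        k<s′ : RootView r′ s′ k false → k Fin.< s′
        k<s′ (left k<r′ _)    = ℕ.<-trans k<r′ r′<s′
        k<s′ (at-r ≡.refl _)    = r′<s′
        k<s′ (mid _ k<s′ _)   = k<s′
        k<s′ (at-s _ ())
        k<s′ (right s′<k eq)  = true≢false i∈′ (≡.trans (root-right r′<s′ (ℕ.<-trans s′<k k<i)) (≡.sym eq))

        from-k : RootView r′ s′ k false → U r′ ≡ true
        from-k (left k<r′ eq) = ≡.trans (strictly-inside nk ni k<r′ (r′<i (rootView′ i∈′)))
                                  (cong isV (isΛ-false {ε r′} (≡.sym eq)))
        from-k (at-r ≡.refl _)  = k∈
        from-k (mid r′<k _ eq) with place nk
        ... | inside A≤k k<B = true≢false k∈ (≡.trans (Fr.inner k A≤k k<B) (≡.sym eq))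
        ... | on-left k≡A    = ≡.trans (Fr.far-left r′ k k≡A (ℕ.<⇒≤ r′<k)) k∈
        ... | on-right k≡B   = contradiction k≡B (not-right ni k<i)
        from-k (at-s _ ())
        from-k (right s′<k eq) = contradiction (k<s′ (right s′<k eq)) (ℕ.<-asym s′<k)

        from-i : RootView r′ s′ i true → U s′ ≡ false
        from-i (left i<r′ eq) = contradiction (r′<i (left i<r′ eq)) (ℕ.<-asym i<r′)
        from-i (at-r _ ())
        from-i (mid _ i<s′ eq) with place ni
        ... | inside A≤i i<B = true≢false (≡.trans (Fr.inner i A≤i i<B) (≡.sym eq)) i∉
        ... | on-left i≡A    = contradiction i≡A (not-left nk k<i)
        ... | on-right i≡B   = ≡.trans (Fr.far-right s′ i i≡B (ℕ.<⇒≤ i<s′)) i∉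
        from-i (at-s ≡.refl _)  = i∉
        from-i (right s′<i eq) = ≡.trans (strictly-inside nk ni (k<s′ (rootView′ k∉′)) s′<i)
                                   (cong isV (isΛ-true {ε s′} (≡.sym eq)))

    -- The order of i and k selects the condition to be used. If i < k, then d is a root: the
    -- membership of i in the set of d′ passes to r, by `compat` to s, and r and s leave no choice
    -- for k. If k < i, then d′ is a root, and `descent` refutes `compat′`. Consequently the number
    -- of sets containing a node grows across every diagonal.
    noncrossing : ∀ d′ → Compatible d′ d → Compatible d d′ → ∀ {i k} → Near i → Near k →
                  U i ≡ false → U k ≡ true → setOf d′ i ≡ true → setOf d′ k ≡ true
    noncrossing d′ compat compat′ {i} {k} ni nk i∉ k∈ i∈′ with setOf d′ k in k∉′
    ... | true  = ≡.refl
    ... | false with ℕ.<-cmp (toℕ i) (toℕ k)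
    ...   | tri≈ _ i≡k _ = true≢false k∈ (≡.trans (cong U (≡.sym (Fin.toℕ-injective i≡k))) i∉)
    ...   | tri< i<k _ _ = ascent d ≡.refl
      where
      ascent : ∀ d₁ → d₁ ≡ d → _
      ascent (projective i₀) ≡.refl =
        true≢false (projective-true {i₀} {i} (ℕ.≤-trans (ℕ.<⇒≤ i<k) (projective-≤ {i₀} {k} k∈))) i∉
      ascent (root r s r<s) ≡.refl = high-case (rootView′ k∈)
        where
        r∈′ : RootView r s i false → setOf d′ r ≡ true
        r∈′ (left i<r eq)   = true≢false
          (≡.trans (Fr.inner r (ℕ.≤-trans (proj₁ ni) i<r) (ℕ.<-≤-trans r<s (proj₂ Fr.touch-high)))
            (cong isV (isΛ-false {ε r} (≡.sym eq)))) (root-r r<s)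
        r∈′ (at-r ≡.refl _)   = i∈′
        r∈′ (mid r<i _ eq) with Λ-extends d′ (isV-false {ε i} (≡.sym eq)) i∈′
        ... | inj₁ ∈left  = ∈left r r<i
        ... | inj₂ ∈right = true≢false (∈right k i<k) k∉′
        r∈′ (at-s _ ())
        r∈′ (right s<i eq)  = true≢false k∈ (≡.trans (root-right r<s (ℕ.<-trans s<i i<k)) (≡.sym eq))

        s∈′ : setOf d′ s ≡ true
        s∈′ = compat (r∈′ (rootView′ i∉))

        high-case : RootView r s k true → _
        high-case (left k<r eq) = true≢false (≡.trans (root-left r<s (ℕ.<-trans i<k k<r)) (≡.sym eq)) i∉
        high-case (at-r _ ())
        high-case (mid r<k k<s eq) with V-extends d′ (isV-true {ε k} (≡.sym eq)) k∉′
        ... | inj₁ ∉left  = true≢false (r∈′ (rootView′ i∉)) (∉left r r<k)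
        ... | inj₂ ∉right = true≢false s∈′ (∉right s k<s)
        high-case (at-s ≡.refl _) = true≢false s∈′ k∉′
        high-case (right s<k eq) = true≢false (root-s r<s)
          (≡.trans (Fr.inner s (ℕ.≤-trans (proj₁ Fr.touch-low) r<s) (ℕ.<-≤-trans s<k (proj₂ nk)))
            (cong isV (isΛ-true {ε s} (≡.sym eq))))
    ...   | tri> _ _ k<i with d′
    ...     | projective i₀ = true≢false (projective-true {i₀} {k} (ℕ.≤-trans (ℕ.<⇒≤ k<i) (projective-≤ {i₀} {i} i∈′))) k∉′
    ...     | root r′ s′ r′<s′ with descent r′<s′ ni nk k<i i∉ k∈ i∈′ k∉′
    ...       | r′∈ , s′∉ = true≢false (compat′ r′∈) s′∉

count : ∀ {k} → (Fin k → Bool) → ℕ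
count {zero}  f = 0
count {suc k} f = (if f zero then 1 else 0) ℕ.+ count (f ∘ suc)

bit-mono : ∀ {a b} → (a ≡ true → b ≡ true) → (if a then 1 else 0) ℕ.≤ (if b then 1 else 0)
bit-mono {false} {b}     imp = z≤n
bit-mono {true}  {true}  imp = ℕ.≤-refl
bit-mono {true}  {false} imp = true≢false (imp ≡.refl) ≡.refl

count-mono : ∀ {k} {f g : Fin k → Bool} → (∀ j → f j ≡ true → g j ≡ true) → count f ℕ.≤ count g
count-mono {zero}  imp = z≤n
count-mono {suc k} imp = ℕ.+-mono-≤ (bit-mono (imp zero)) (count-mono (imp ∘ suc))

count-mono-< : ∀ {k} {f g : Fin k → Bool} → (∀ j → f j ≡ true → g j ≡ true) →
               ∀ j → f j ≡ false → g j ≡ true → count f ℕ.< count g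
count-mono-< {suc k} imp zero    f≡ g≡ rewrite f≡ | g≡ = s≤s (count-mono (imp ∘ suc))
count-mono-< {suc k} imp (suc j) f≡ g≡ = ℕ.+-mono-≤-< (bit-mono (imp zero)) (count-mono-< (imp ∘ suc) j f≡ g≡)

-- The heights are chosen in such a way that every diagonal of a noncrossing
-- family separates the nodes next to it; ties are broken by the position.
module Heights {m k : ℕ} (ε : Vector Sign (suc m)) (d : Fin k → Diagonals.Diagonal ε)
  (compatible : ∀ i j → Diagonals.Compatible ε (d i) (d j)) where

  open Diagonals ε

  private
    n = suc m

  rank : Fin n → ℕ
  rank i = count λ j → setOf (d j) i

  height : Fin n → ℕ
  -- Positions are below n, so a difference in rank outweighs them.
  height i = n ℕ.* rank i ℕ.+ toℕ i

  height-mono : ∀ {i k} → rank i ℕ.< rank k → height i ℕ.< height k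
  height-mono {i} {k} lt = begin-strict
    n ℕ.* rank i ℕ.+ toℕ i   <⟨ ℕ.+-monoʳ-< (n ℕ.* rank i) (Fin.toℕ<n i) ⟩
    n ℕ.* rank i ℕ.+ n       ≡⟨ ℕ.+-comm (n ℕ.* rank i) n ⟩
    n ℕ.+ n ℕ.* rank i       ≡⟨ ℕ.*-suc n (rank i) ⟨
    n ℕ.* suc (rank i)       ≤⟨ ℕ.*-monoʳ-≤ n lt ⟩
    n ℕ.* rank k             ≤⟨ ℕ.m≤m+n _ _ ⟩
    height k                 ∎
    where open ℕ.≤-Reasoning

  height-injective : Injective _≡_ _≡_ height
  height-injective {i} {k} eq with ℕ.<-cmp (rank i) (rank k)
  ... | tri< lt _ _ = contradiction eq (ℕ.<⇒≢ (height-mono {i} {k} lt))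
  ... | tri> _ _ gt = contradiction (≡.sym eq) (ℕ.<⇒≢ (height-mono {k} {i} gt))
  ... | tri≈ _ r≡ _ = Fin.toℕ-injective (ℕ.+-cancelˡ-≡ (n ℕ.* rank i) _ _
                        (≡.trans eq (cong (λ r → n ℕ.* r ℕ.+ toℕ k) (≡.sym r≡))))

  open Gaps ε height height-injective hiding (n)

  module _ (j : Fin k) where
    private
      module Fr = Frame (frame (d j))
      U = setOf (d j)

    separated : ∀ {i l} → Near (d j) i → Near (d j) l → U i ≡ false → U l ≡ true → height i ℕ.< height l
    separated {i} {l} ni nl i∉ l∈ = height-mono {i} {l} (count-mono-<
      (λ j′ → noncrossing (d j) (d j′) (compatible j′ j) (compatible j j′) ni nl i∉ l∈) j i∉ l∈)

    private
      lowest = least {P = λ i → Near (d j) i × U i ≡ true} (λ i → touch? Fr.A Fr.B i ×-dec U i Bool.≟ true) height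
      topmost = greatest {P = λ i → Near (d j) i × U i ≡ false} (λ i → touch? Fr.A Fr.B i ×-dec U i Bool.≟ false) height

      gap-at : ∀ h → (∀ i → Near (d j) i → U i ≡ true → h ℕ.≤ height i) →
               (∀ i → Near (d j) i → U i ≡ false → height i ℕ.< h) → Gap h Fr.A Fr.B
      gap-at h above below = gap Fr.A≤B Fr.B≤n
        (λ i A≤i i<B w → no-wall (ε i) (Fr.inner i A≤i i<B)
          (above i (ℕ.m≤n⇒m≤1+n A≤i , ℕ.<⇒≤ i<B)) (below i (ℕ.m≤n⇒m≤1+n A≤i , ℕ.<⇒≤ i<B)) w)
        (λ a a≡A → wall (ε a) (Fr.boundˡ a a≡A) (above a (nearˡ a≡A)) (below a (nearˡ a≡A)))
        (λ b b≡B → wall (ε b) (Fr.boundʳ b b≡B) (above b (nearʳ b≡B)) (below b (nearʳ b≡B)))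
        where
        nearˡ : ∀ {a} → suc (toℕ a) ≡ Fr.A → Near (d j) a
        nearˡ a≡A = ℕ.≤-reflexive (≡.sym a≡A) , ℕ.≤-trans (ℕ.n≤1+n _) (subst (ℕ._≤ Fr.B) (≡.sym a≡A) Fr.A≤B)
        nearʳ : ∀ {b} → toℕ b ≡ Fr.B → Near (d j) b
        nearʳ b≡B = ℕ.≤-trans Fr.A≤B (ℕ.m≤n⇒m≤1+n (ℕ.≤-reflexive (≡.sym b≡B))) , ℕ.≤-reflexive b≡B
        wall : ∀ s {y b} → b ≡ isΛ s → (b ≡ true → h ℕ.≤ y) → (b ≡ false → y ℕ.< h) → Wall s h y
        wall Sign.+ ≡.refl a b = a ≡.refl
        wall Sign.- ≡.refl a b = b ≡.refl
        no-wall : ∀ s {y b} → b ≡ isV s → (b ≡ true → h ℕ.≤ y) → (b ≡ false → y ℕ.< h) → ¬ Wall s h y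
        no-wall Sign.+ ≡.refl a b w = contradiction w (ℕ.<⇒≱ (b ≡.refl))
        no-wall Sign.- ≡.refl a b w = contradiction w (ℕ.≤⇒≯ (a ≡.refl))

    -- Every node next to the diagonal from below is lower than every one from above. So the gap of
    -- the frame is open from the highest of the former, p, to the lowest of the latter, q.
    strand : ∃₂ λ p q → ∃ λ (e : Edge p q) → IsCut e U
    strand with topmost | lowest
    ... | inj₁ none | _ = contradiction (Fr.touch-low , Fr.low∉) (none _)
    ... | _ | inj₁ none = contradiction (Fr.touch-high , Fr.high∈) (none _)
    ... | inj₂ (p , (np , p∉) , max) | inj₂ (q , (nq , q∈) , min) = p , q , e , record
      { near-above = λ i ni le → ¬-false λ i∉ → ℕ.<⇒≱ (separated ni nq i∉ q∈) le
      ; near-below = λ i ni lt → ¬-true λ i∈ → ℕ.<⇒≱ lt (min i (ni , i∈))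
      ; far-left   = Fr.far-left
      ; far-right  = Fr.far-right
      }
      where
      e : Edge p q
      e = edge
        (gap-at _ (λ i ni i∈ → separated np ni p∉ i∈) (λ i ni i∉ → s≤s (max i (ni , i∉))))
        (gap-at _ (λ i ni i∈ → min i (ni , i∈)) (λ i ni i∉ → separated ni nq i∉ q∈))
        np nq (separated np nq p∉ q∈)
      ¬-false : ∀ {b} → b ≢ false → b ≡ true
      ¬-false {true}  _  = ≡.refl
      ¬-false {false} ne = contradiction ≡.refl ne
      ¬-true : ∀ {b} → b ≢ true → b ≡ false
      ¬-true {false} _  = ≡.refl
      ¬-true {true}  ne = contradiction ≡.refl ne

-- Everything that the construction of the tree has to know about the heights.
SeparatingHeights : ∀ {m k} (ε : Vector Sign (suc m)) → (Fin k → Diagonals.Diagonal ε) → Set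
SeparatingHeights {m} ε d = ∃₂ λ (H : Fin (suc m) → ℕ) (H-injective : Injective _≡_ _≡_ H) →
  ∀ j → ∃₂ λ p q → ∃ λ (e : Gaps.Edge ε H H-injective p q) → Gaps.IsCut ε H H-injective e (Diagonals.setOf ε (d j))

separatingHeights : ∀ {m k} (ε : Vector Sign (suc m)) (d : Fin k → Diagonals.Diagonal ε) →
                    (∀ i j → Diagonals.Compatible ε (d i) (d j)) → SeparatingHeights ε d
separatingHeights ε d compatible = height , height-injective , strand
  where open Heights ε d compatible

ind : Bool → ℤ
ind b = if b then 1ℤ else 0ℤ

-- From almost positive roots to diagonals

module ClusterDiagonals {m : ℕ} (ε : Vector Sign (suc m)) where

  open Diagonals ε

  private
    n = suc m

    before-0 : ∀ (b : ℕ → ℤ) (k : Fin m) → (∀ l → suc l ≡ toℕ k → b l ≡ 0ℤ) → before ε b k ≡ 0ℤ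
    before-0 b zero    _  = ≡.refl
    before-0 b (suc k) b0 = ≡.trans (cong (minus-if Sign.- (ε (suc (inject₁ k)))) (b0 (toℕ k) ≡.refl)) (minus-if-0 Sign.- (ε (suc (inject₁ k))))

    before-1 : ∀ (b : ℕ → ℤ) (k : Fin m) l → suc l ≡ toℕ k → b l ≡ 1ℤ → before ε b k ≡ minus-if Sign.- (ε (inject₁ k)) 1ℤ
    before-1 b (suc k) _ ≡.refl b1 = cong (minus-if Sign.- (ε (suc (inject₁ k)))) b1

    after-0 : ∀ (b : ℕ → ℤ) (k : Fin m) → b (suc (toℕ k)) ≡ 0ℤ → after ε b k ≡ 0ℤ
    after-0 b k b0 = ≡.trans (cong (minus-if Sign.+ (ε (suc k))) b0) (minus-if-0 Sign.+ (ε (suc k)))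

    sum₃ : ∀ {a b c a′ b′ c′} → a ≡ a′ → b ≡ b′ → c ≡ c′ → a ℤ.+ b ℤ.+ c ≡ a′ ℤ.+ b′ ℤ.+ c′
    sum₃ ≡.refl ≡.refl ≡.refl = ≡.refl

    difference : ∀ {u u′ w w′} → u ≡ u′ → w ≡ w′ → ind w′ ℤ.- ind u′ ≡ ind w ℤ.- ind u
    difference ≡.refl ≡.refl = ≡.refl

    x-x : ∀ x → 0ℤ ≡ x ℤ.- x
    x-x x = ≡.sym (ℤ.+-inverseʳ x)

    minus-V : ∀ s → minus-if Sign.- s 1ℤ ≡ ℤ.- ind (isV s)
    minus-V Sign.+ = ≡.refl
    minus-V Sign.- = ≡.refl

    minus-Λ : ∀ s → minus-if Sign.+ s 1ℤ ≡ ind (isV s) ℤ.- 1ℤ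
    minus-Λ Sign.+ = ≡.refl
    minus-Λ Sign.- = ≡.refl

  -- The indicator of `rootSet` is constant on the nodes before r and on those after s, so both
  -- sides can be nonzero only for r - 1 ≤ k ≤ s. At the two extreme columns a single neighbour
  -- contributes.
  root-column : ∀ {r s} → r Fin.< s → ∀ k → let b = box (toℕ r) (toℕ s) in
                before ε b k ℤ.+ b (toℕ k) ℤ.+ after ε b k ≡ step (ind ∘ rootSet r s) k
  root-column {r} {s} r<s k = column (ℕ.<-cmp (suc (toℕ k)) (toℕ r)) (ℕ.<-cmp (toℕ k) (toℕ s))
   where
   b = box (toℕ r) (toℕ s)
   column : Tri (suc (toℕ k) ℕ.< toℕ r) (suc (toℕ k) ≡ toℕ r) (toℕ r ℕ.< suc (toℕ k)) →
            Tri (toℕ k ℕ.< toℕ s) (toℕ k ≡ toℕ s) (toℕ s ℕ.< toℕ k) →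
            before ε b k ℤ.+ b (toℕ k) ℤ.+ after ε b k ≡ step (ind ∘ rootSet r s) k
   column (tri< k+1<r _ _) _ = ≡.trans
    (sum₃ (before-0 b k λ l eq → box-below {toℕ r} {toℕ s} {l} (ℕ.<-trans (subst (l ℕ.<_) eq (ℕ.n<1+n l)) k<r))
          (box-below {toℕ r} {toℕ s} k<r) (after-0 b k (box-below {toℕ r} {toℕ s} k+1<r)))
    (≡.trans (x-x (ind (isΛ (ε r)))) (difference (root-left r<s (subst (ℕ._< toℕ r) (≡.sym (Fin.toℕ-inject₁ k)) k<r)) (root-left r<s k+1<r)))
    where
    k<r = ℕ.<-trans (ℕ.n<1+n _) k+1<r
   column (tri≈ _ k+1≡r _) _ = ≡.trans
    (sum₃ (before-0 b k λ l eq → box-below {toℕ r} {toℕ s} {l} (ℕ.<-trans (subst (l ℕ.<_) eq (ℕ.n<1+n l)) k<r))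
          (box-below {toℕ r} {toℕ s} k<r)
          (≡.trans (cong (minus-if Sign.+ (ε (suc k))) (box-in {toℕ r} {toℕ s} (ℕ.≤-reflexive (≡.sym k+1≡r)) (subst (ℕ._< toℕ s) (≡.sym k+1≡r) r<s)))
                 (cong (λ i → minus-if Sign.+ (ε i) 1ℤ) suc≡r)))
    (≡.trans (fall (ε r)) (difference (root-left r<s (subst (ℕ._< toℕ r) (≡.sym (Fin.toℕ-inject₁ k)) k<r)) (≡.trans (cong (rootSet r s) suc≡r) (root-r r<s))))
    where
    k<r = ℕ.≤-reflexive k+1≡r
    suc≡r : suc k ≡ r
    suc≡r = Fin.toℕ-injective k+1≡r
    fall : ∀ s → 0ℤ ℤ.+ 0ℤ ℤ.+ minus-if Sign.+ s 1ℤ ≡ ind false ℤ.- ind (isΛ s)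
    fall Sign.+ = ≡.refl
    fall Sign.- = ≡.refl
   -- Write u and w for the indicator at the nodes k and k + 1. The vertex before k contributes -u,
   -- the vertex k itself 1, and the vertex after it w - 1.
   column (tri> _ _ (s≤s r≤k)) (tri< k<s _ _) = ≡.trans
    (sum₃ before≡ (box-in {toℕ r} {toℕ s} r≤k k<s) after≡) (cancel (ind (rootSet r s (inject₁ k))) (ind (rootSet r s (suc k))))
    where
    toℕ-k = Fin.toℕ-inject₁ k
    cancel : ∀ u w → ℤ.- u ℤ.+ 1ℤ ℤ.+ (w ℤ.- 1ℤ) ≡ w ℤ.- u
    cancel = solve-∀
    before≡ : before ε (box (toℕ r) (toℕ s)) k ≡ ℤ.- ind (rootSet r s (inject₁ k))
    before≡ with ℕ.m≤n⇒m<n∨m≡n r≤k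
    ... | inj₂ r≡k = ≡.trans (before-0 b k λ l eq → box-below {toℕ r} {toℕ s} {l} (subst (l ℕ.<_) (≡.trans eq (≡.sym r≡k)) (ℕ.n<1+n l)))
                       (cong (ℤ.-_ ∘ ind) (≡.sym (≡.trans (cong (rootSet r s) (Fin.toℕ-injective (≡.trans toℕ-k (≡.sym r≡k)))) (root-r r<s))))
    ... | inj₁ r<k = ≡.trans (before-1 b k (ℕ.pred (toℕ k)) suc-pred (box-in {toℕ r} {toℕ s} (ℕ.≤-pred (subst (toℕ r ℕ.<_) (≡.sym suc-pred) r<k)) (ℕ.<-trans (subst (ℕ.pred (toℕ k) ℕ.<_) suc-pred (ℕ.n<1+n _)) k<s)))
                       (≡.trans (minus-V (ε (inject₁ k))) (cong (ℤ.-_ ∘ ind) (≡.sym (root-mid r<s (subst (toℕ r ℕ.<_) (≡.sym toℕ-k) r<k) (subst (ℕ._< toℕ s) (≡.sym toℕ-k) k<s)))))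
      where
      suc-pred : suc (ℕ.pred (toℕ k)) ≡ toℕ k
      suc-pred = ℕ.suc-pred (toℕ k) {{ℕ.>-nonZero (ℕ.≤-<-trans z≤n r<k)}}
    after≡ : after ε (box (toℕ r) (toℕ s)) k ≡ ind (rootSet r s (suc k)) ℤ.- 1ℤ
    after≡ with ℕ.m≤n⇒m<n∨m≡n k<s
    ... | inj₁ k+1<s = ≡.trans (cong (minus-if Sign.+ (ε (suc k))) (box-in {toℕ r} {toℕ s} (ℕ.m≤n⇒m≤1+n r≤k) k+1<s))
                         (≡.trans (minus-Λ (ε (suc k))) (cong (λ b → ind b ℤ.- 1ℤ) (≡.sym (root-mid r<s (s≤s r≤k) k+1<s))))
    ... | inj₂ k+1≡s = ≡.trans (after-0 b k (box-above {toℕ r} {toℕ s} (ℕ.≤-reflexive (≡.sym k+1≡s))))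
                         (cong (λ b → ind b ℤ.- 1ℤ) (≡.sym (≡.trans (cong (rootSet r s) (Fin.toℕ-injective k+1≡s)) (root-s r<s))))
   column (tri> _ _ (s≤s r≤k)) (tri≈ _ k≡s _) = ≡.trans
    (sum₃ (before-1 b k (ℕ.pred (toℕ k)) suc-pred (box-in {toℕ r} {toℕ s}
              (ℕ.≤-pred (subst (toℕ r ℕ.<_) (≡.trans (≡.sym k≡s) (≡.sym suc-pred)) r<s))
              (subst (ℕ.pred (toℕ k) ℕ.<_) (≡.trans suc-pred k≡s) (ℕ.n<1+n _))))
          (box-above {toℕ r} {toℕ s} (ℕ.≤-reflexive (≡.sym k≡s))) (after-0 b k (box-above {toℕ r} {toℕ s} (ℕ.m≤n⇒m≤1+n (ℕ.≤-reflexive (≡.sym k≡s))))))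
    (≡.trans (fall (ε (inject₁ k))) (difference (≡.trans (cong (rootSet r s) inject≡s) (root-s r<s))
      (≡.trans (root-right r<s (s≤s (ℕ.≤-reflexive (≡.sym k≡s)))) (cong (isΛ ∘ ε) (≡.sym inject≡s)))))
    where
    inject≡s : inject₁ k ≡ s
    inject≡s = Fin.toℕ-injective (≡.trans (Fin.toℕ-inject₁ k) k≡s)
    suc-pred : suc (ℕ.pred (toℕ k)) ≡ toℕ k
    suc-pred = ℕ.suc-pred (toℕ k) {{ℕ.>-nonZero (ℕ.≤-<-trans z≤n (subst (toℕ r ℕ.<_) (≡.sym k≡s) r<s))}}
    fall : ∀ s → minus-if Sign.- s 1ℤ ℤ.+ 0ℤ ℤ.+ 0ℤ ≡ ind (isΛ s) ℤ.- ind true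
    fall Sign.+ = ≡.refl
    fall Sign.- = ≡.refl
   column (tri> _ _ _) (tri> _ _ s<k) = ≡.trans
    (sum₃ (before-0 b k λ l eq → box-above {toℕ r} {toℕ s} {l} (ℕ.≤-pred (subst (toℕ s ℕ.<_) (≡.sym eq) s<k)))
          (box-above {toℕ r} {toℕ s} (ℕ.<⇒≤ s<k)) (after-0 b k (box-above {toℕ r} {toℕ s} (ℕ.m≤n⇒m≤1+n (ℕ.<⇒≤ s<k)))))
    (≡.trans (x-x (ind (isΛ (ε s)))) (difference (root-right r<s (subst (toℕ s ℕ.<_) (≡.sym (Fin.toℕ-inject₁ k)) s<k)) (root-right r<s (ℕ.m≤n⇒m≤1+n s<k))))

  projective-column : ∀ i₀ k → ℤ.- identity i₀ k ≡ step (ind ∘ projectiveSet i₀) k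
  projective-column i₀ k with Fin.<-cmp k i₀
  ... | tri< k<i₀ k≢i₀ _ = ≡.trans (cong (λ b → ℤ.- ind b) (dec-false (i₀ Fin.≟ k) (k≢i₀ ∘ ≡.sym)))
    (difference (projective-true {i₀} {inject₁ k} (subst (ℕ._≤ toℕ i₀) (≡.sym (Fin.toℕ-inject₁ k)) (ℕ.<⇒≤ k<i₀))) (projective-true {i₀} {suc k} k<i₀))
  ... | tri≈ _ ≡.refl _ = ≡.trans (cong (λ b → ℤ.- ind b) (dec-true (k Fin.≟ k) ≡.refl))
    (difference (projective-true {k} {inject₁ k} (ℕ.≤-reflexive (Fin.toℕ-inject₁ k))) (projective-false {k} {suc k} ℕ.≤-refl))
  ... | tri> _ k≢i₀ i₀<k = ≡.trans (cong (λ b → ℤ.- ind b) (dec-false (i₀ Fin.≟ k) (k≢i₀ ∘ ≡.sym)))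
    (difference (projective-false {i₀} {inject₁ k} (subst (toℕ i₀ ℕ.<_) (≡.sym (Fin.toℕ-inject₁ k)) i₀<k)) (projective-false {i₀} {suc k} (ℕ.m≤n⇒m≤1+n i₀<k)))

  toDiagonal : ∀ {w : Vector ℤ m} → IsAlmostPositiveRoot ε w → Diagonal
  toDiagonal (inj₁ (r , s , r<s , _))   = root r s r<s
  toDiagonal (inj₂ (_ , _ , (i , _)))   = projective i

  diagonal-step : ∀ {w : Vector ℤ m} (a : IsAlmostPositiveRoot ε w) k → eulerᵗ ε w k ≡ step (ind ∘ setOf (toDiagonal a)) k
  diagonal-step {w} (inj₁ (r , s , r<s , w≗β)) k = begin
    eulerᵗ ε w k                                                ≡⟨ Σ-cong (λ i → cong (euler ε i k ℤ.*_) (≡.trans (w≗β i) (β≡box r s i))) ⟩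
    Σℤ (λ i → euler ε i k ℤ.* box (toℕ r) (toℕ s) (toℕ i))      ≡⟨ euler-column ε (box (toℕ r) (toℕ s)) (box-above {toℕ r} {toℕ s} (Fin.toℕ≤pred[n] s)) k ⟩
    _                                                           ≡⟨ root-column r<s k ⟩
    step (ind ∘ rootSet r s) k                                  ∎
    where open ≡-Reasoning
  diagonal-step (inj₂ (Π , inv , (i , w≡))) k = ≡.trans (eulerᵗ-projective ε inv i w≡ k) (projective-column i k)

  euler-β : ∀ {v w : Vector ℤ m} (a : IsAlmostPositiveRoot ε v) {r s} → r Fin.< s → w ≗ β r s →
            eulerForm ε v w ≡ ind (setOf (toDiagonal a) s) ℤ.- ind (setOf (toDiagonal a) r)
  euler-β {v} {w} a {r} {s} r<s w≗β = begin
    eulerForm ε v w                                              ≡⟨ eulerForm-eulerᵗ ε v w ⟩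
    Σℤ (λ j → eulerᵗ ε v j ℤ.* w j)                              ≡⟨ Σ-cong (λ j → cong₂ ℤ._*_ (diagonal-step a j) (≡.trans (w≗β j) (β≡box r s j))) ⟩
    Σℤ (λ j → step U j ℤ.* box (toℕ r) (toℕ s) (toℕ j))          ≡⟨ telescope U r s (ℕ.<⇒≤ r<s) ⟩
    U s ℤ.- U r                                                  ∎
    where
    open ≡-Reasoning
    U = ind ∘ setOf (toDiagonal a)

  compatible-diagonals : ∀ {v w : Vector ℤ m} (a : IsAlmostPositiveRoot ε v) (b : IsAlmostPositiveRoot ε w) →
    (IsPositiveRoot w → 0ℤ ℤ.≤ eulerForm ε v w) → Compatible (toDiagonal a) (toDiagonal b)
  compatible-diagonals a (inj₂ _) _ = tt
  compatible-diagonals {v} {w} a (inj₁ (r , s , r<s , w≗β)) nonneg r∈ with setOf (toDiagonal a) s in s∉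
  ... | true  = ≡.refl
  ... | false with subst (0ℤ ℤ.≤_) (≡.trans (euler-β a r<s w≗β) (cong₂ (λ x y → ind x ℤ.- ind y) s∉ r∈)) (nonneg (r , s , r<s , w≗β))
  ...   | ()

  -- If r < r′, the value at r makes r′ a V-node, and nodes before r′ are outside the set. But a
  -- V-node between r and s belongs to it, and so does s.
  root-r-unique : ∀ {r s r′ s′} → r Fin.< s → r′ Fin.< s′ → (∀ i → rootSet r s i ≡ rootSet r′ s′ i) → ¬ r Fin.< r′
  root-r-unique {r} {s} {r′} {s′} r<s r′<s′ same r<r′ = go (rootView′ (≡.trans (same r′) (root-r r′<s′)))
    where
    Λ∉ : isΛ (ε r′) ≡ false
    Λ∉ = ≡.trans (≡.sym (root-left r′<s′ r<r′)) (≡.trans (≡.sym (same r)) (root-r r<s))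
    go : ¬ RootView r s r′ false
    go (left r′<r _)     = ℕ.<-asym r<r′ r′<r
    go (at-r ≡.refl _)     = ℕ.<-irrefl ≡.refl r<r′
    go (mid _ _ eq)      = true≢false (cong isV (isΛ-false {ε r′} Λ∉)) (≡.sym eq)
    go (at-s _ ())
    go (right s<r′ _)    = true≢false (≡.trans (≡.sym (same s)) (root-s r<s)) (≡.trans (root-left r′<s′ s<r′) Λ∉)

  root-s-unique : ∀ {r s s′} → r Fin.< s → r Fin.< s′ → (∀ i → rootSet r s i ≡ rootSet r s′ i) → ¬ s Fin.< s′
  root-s-unique {r} {s} {s′} r<s r<s′ same s<s′ = true≢false
    (≡.trans (≡.sym (same s)) (root-s r<s)) (≡.trans (root-mid r<s′ r<s s<s′) (cong isV (isΛ-true {ε s} Λ∈)))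
    where
    Λ∈ : isΛ (ε s) ≡ true
    Λ∈ = ≡.trans (≡.sym (root-right r<s s<s′)) (≡.trans (same s′) (root-s r<s′))

  root-unique : ∀ {r s r′ s′} → r Fin.< s → r′ Fin.< s′ → (∀ i → rootSet r s i ≡ rootSet r′ s′ i) → r ≡ r′ × s ≡ s′
  root-unique {r} {s} {r′} {s′} r<s r′<s′ same with Fin.<-cmp r r′
  ... | tri< lt _ _ = contradiction lt (root-r-unique r<s r′<s′ same)
  ... | tri> _ _ gt = contradiction gt (root-r-unique r′<s′ r<s (≡.sym ∘ same))
  ... | tri≈ _ ≡.refl _ with Fin.<-cmp s s′
  ...   | tri< lt _ _ = contradiction lt (root-s-unique r<s r′<s′ same)
  ...   | tri> _ _ gt = contradiction gt (root-s-unique r′<s′ r<s (≡.sym ∘ same))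
  ...   | tri≈ _ ≡.refl _ = ≡.refl , ≡.refl

  -- Equal sets have equal images under E^t. A negative projective root brings along an inverse of
  -- the Euler matrix, which recovers both vectors; for two positive roots the sets determine the
  -- ends.
  diagonal-injective : ∀ {v w : Vector ℤ m} (a : IsAlmostPositiveRoot ε v) (b : IsAlmostPositiveRoot ε w) →
    (∀ i → setOf (toDiagonal a) i ≡ setOf (toDiagonal b) i) → v ≗ w
  diagonal-injective {v} {w} a b same = go a b ≡.refl ≡.refl
    where
    eulerᵗ-same : ∀ k → eulerᵗ ε v k ≡ eulerᵗ ε w k
    eulerᵗ-same k = ≡.trans (diagonal-step a k) (≡.trans
      (cong₂ (λ x y → ind x ℤ.- ind y) (same (suc k)) (same (inject₁ k))) (≡.sym (diagonal-step b k)))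
    by-inverse : ∀ {Π} → IsInverse (euler ε) Π → v ≗ w
    by-inverse {Π} inv k = ≡.trans (≡.sym (eulerᵗ-inverse ε inv v k)) (≡.trans
      (Σ-cong λ l → cong (ℤ._* Π l k) (eulerᵗ-same l)) (eulerᵗ-inverse ε inv w k))
    go : (a′ : IsAlmostPositiveRoot ε v) (b′ : IsAlmostPositiveRoot ε w) → a′ ≡ a → b′ ≡ b → v ≗ w
    go (inj₂ (_ , inv , _)) _ _ _ = by-inverse inv
    go _ (inj₂ (_ , inv , _)) _ _ = by-inverse inv
    go (inj₁ (r , s , r<s , v≗β)) (inj₁ (r′ , s′ , r′<s′ , w≗β)) ≡.refl ≡.refl with root-unique r<s r′<s′ same
    ... | ≡.refl , ≡.refl = λ k → ≡.trans (v≗β k) (≡.sym (w≗β k))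

-- The number of edges

injective⇒surjective : ∀ {k} {f : Fin k → Fin k} → Injective _≡_ _≡_ f → ∀ y → ∃ λ x → f x ≡ y
injective⇒surjective {suc k} {f} f-injective y with Fin.any? (λ x → f x Fin.≟ y)
... | yes found = found
... | no  none  = contradiction (Fin.injective⇒≤ {f = λ x → Fin.punchOut (missed x)}
    (λ {x} {x′} eq → f-injective (Fin.punchOut-injective (missed x) (missed x′) eq))) ℕ.1+n≰n
  where
  missed : ∀ x → y ≢ f x
  missed x eq = none (x , ≡.sym eq)

module EdgeCount {m : ℕ} (ε : Vector Sign (suc m)) (Y : Fin (suc m) → ℕ) (Y-injective : Injective _≡_ _≡_ Y) where

  open Gaps ε Y Y-injective

  -- The end of an edge on the other side of its cut than the node zero.
  far : (Fin n → Bool) → Fin n → Fin n → Fin n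
  far χ p q = if χ zero then p else q

  module _ {p q χ} {e : Edge p q} (cut : IsCut e χ) where

    far≢zero : zero ≢ far χ p q
    far≢zero 0≡far with χ zero in eq
    ... | true  = case ≡.trans (≡.sym (cut-lower cut)) (≡.trans (cong χ (≡.sym 0≡far)) eq) of λ ()
    ... | false = case ≡.trans (≡.sym (cut-upper cut)) (≡.trans (cong χ (≡.sym 0≡far)) eq) of λ ()

    χ-far : χ (far χ p q) ≢ χ zero
    χ-far χ≡ with χ zero
    ... | true  = case ≡.trans (≡.sym (cut-lower cut)) χ≡ of λ ()
    ... | false = case ≡.trans (≡.sym (cut-upper cut)) χ≡ of λ ()

    -- The alternatives are that a is the far end, or that it is the near end and shares with the
    -- far end whatever is constant along the edge.
    end-cases : ∀ {a} → a ≡ p ⊎ a ≡ q → χ a ≢ χ zero ⊎ (∀ (χ′ : Fin n → Bool) → χ′ p ≡ χ′ q → χ′ a ≡ χ′ (far χ p q))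
    end-cases {a} a∈ with χ zero | cut-lower cut | cut-upper cut | a∈
    ... | true  | p∉ | q∈ | inj₁ ≡.refl = inj₁ λ eq → case ≡.trans (≡.sym p∉) eq of λ ()
    ... | true  | p∉ | q∈ | inj₂ ≡.refl = inj₂ λ χ′ eq → ≡.sym eq
    ... | false | p∉ | q∈ | inj₁ ≡.refl = inj₂ λ χ′ eq → eq
    ... | false | p∉ | q∈ | inj₂ ≡.refl = inj₁ λ eq → case ≡.trans (≡.sym q∈) eq of λ ()

  far-unique : ∀ {p q χ p′ q′ χ′} {e : Edge p q} {e′ : Edge p′ q′} → IsCut e χ → IsCut e′ χ′ →
               far χ p q ≡ far χ′ p′ q′ → p ≡ p′ × q ≡ q′
  far-unique {p} {q} {χ} {p′} {q′} {χ′} {e} {e′} cut cut′ far≡ with p Fin.≟ p′ ×-dec q Fin.≟ q′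
  ... | yes same  = same
  ... | no  other = contradiction (proj₁ (reach (connected zero (far χ p q)) (≡.refl , ≡.refl))) (χ-far cut)
    where
    -- Of the four values of (χ, χ′), the common far end and the two near ends
    -- take the other three, so that no edge leads away from Near.
    Near : Fin n → Set
    Near a = χ a ≡ χ zero × χ′ a ≡ χ′ zero
    χ-same : χ p′ ≡ χ q′
    χ-same with cut-constant cut e′
    ... | inj₁ same = contradiction same other
    ... | inj₂ eq   = eq
    χ′-same : χ′ p ≡ χ′ q
    χ′-same with cut-constant cut′ e
    ... | inj₁ (≡.refl , ≡.refl) = contradiction (≡.refl , ≡.refl) other
    ... | inj₂ eq            = eq
    not-end : ∀ {a} → Near a → ¬ (a ≡ p ⊎ a ≡ q)
    not-end {a} (χa , χ′a) a∈ with end-cases cut a∈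
    ... | inj₁ χ≢ = χ≢ χa
    ... | inj₂ χ′≡ = χ-far cut′ (≡.trans (cong χ′ (≡.sym far≡)) (≡.trans (≡.sym (χ′≡ χ′ χ′-same)) χ′a))
    not-end′ : ∀ {a} → Near a → ¬ (a ≡ p′ ⊎ a ≡ q′)
    not-end′ {a} (χa , χ′a) a∈ with end-cases cut′ a∈
    ... | inj₁ χ′≢ = χ′≢ χ′a
    ... | inj₂ χ≡ = χ-far cut (≡.trans (cong χ far≡) (≡.trans (≡.sym (χ≡ χ χ-same)) χa))
    transfer : ∀ {a x y} → Near a → a ≡ x ⊎ a ≡ y → Edge x y → χ x ≡ χ y × χ′ x ≡ χ′ y
    transfer near a∈ d with cut-constant cut d | cut-constant cut′ d
    ... | inj₁ (≡.refl , ≡.refl) | _ = contradiction a∈ (not-end near)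
    ... | inj₂ _ | inj₁ (≡.refl , ≡.refl) = contradiction a∈ (not-end′ near)
    ... | inj₂ eq | inj₂ eq′ = eq , eq′
    reach : ∀ {a b} → Path a b → Near a → Near b
    reach nil near = near
    reach (inj₁ d ◅ path) near@(χa , χ′a) = let eq , eq′ = transfer near (inj₁ ≡.refl) d in
      reach path (≡.trans (≡.sym eq) χa , ≡.trans (≡.sym eq′) χ′a)
    reach (inj₂ d ◅ path) near@(χa , χ′a) = let eq , eq′ = transfer near (inj₂ ≡.refl) d in
      reach path (≡.trans eq χa , ≡.trans eq′ χ′a)

  -- Both cuts take prescribed values at p and q and change along no other edge, so their agreement
  -- spreads over the connected graph.
  cut-unique : ∀ {p q χ χ′} {e e′ : Edge p q} → IsCut e χ → IsCut e′ χ′ → ∀ i → χ i ≡ χ′ i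
  cut-unique {p} {q} {χ} {χ′} cut cut′ i = agree (connected p i) (≡.trans (cut-lower cut) (≡.sym (cut-lower cut′)))
    where
    same-edge : χ p ≡ χ′ p × χ q ≡ χ′ q
    same-edge = ≡.trans (cut-lower cut) (≡.sym (cut-lower cut′)) , ≡.trans (cut-upper cut) (≡.sym (cut-upper cut′))
    along : ∀ {x y} → Edge x y → (χ x ≡ χ′ x → χ y ≡ χ′ y) × (χ y ≡ χ′ y → χ x ≡ χ′ x)
    along d with cut-constant cut d | cut-constant cut′ d
    ... | inj₁ (≡.refl , ≡.refl) | _ = (λ _ → proj₂ same-edge) , (λ _ → proj₁ same-edge)
    ... | _ | inj₁ (≡.refl , ≡.refl) = (λ _ → proj₂ same-edge) , (λ _ → proj₁ same-edge)
    ... | inj₂ eq | inj₂ eq′ = (λ z → ≡.trans (≡.sym eq) (≡.trans z eq′)) , (λ z → ≡.trans eq (≡.trans z (≡.sym eq′)))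
    agree : ∀ {a b} → Path a b → χ a ≡ χ′ a → χ b ≡ χ′ b
    agree nil eq = eq
    agree (inj₁ d ◅ path) eq = agree path (proj₁ (along d) eq)
    agree (inj₂ d ◅ path) eq = agree path (proj₂ (along d) eq)

  -- There are only m edges, because the far ends of different edges are different.
  module _ (p q : Fin m → Fin n) (e : ∀ j → Edge (p j) (q j)) (U : Fin m → Fin n → Bool)
           (cut : ∀ j → IsCut (e j) (U j)) (distinct : ∀ i j → (∀ k → U i k ≡ U j k) → i ≡ j) where

    private
      end′ : Fin m → Fin m
      end′ j = Fin.punchOut (far≢zero (cut j))

      end′-injective : Injective _≡_ _≡_ end′
      end′-injective {i} {j} eq = distinct i j (cuts-agree (far-unique (cut i) (cut j) (Fin.punchOut-injective (far≢zero (cut i)) (far≢zero (cut j)) eq)))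
        where
        cuts-agree : p i ≡ p j × q i ≡ q j → ∀ k → U i k ≡ U j k
        cuts-agree (p≡ , q≡) = go (e j) (cut j) p≡ q≡
          where
          go : ∀ {p′ q′} (e′ : Edge p′ q′) → IsCut e′ (U j) → p i ≡ p′ → q i ≡ q′ → ∀ k → U i k ≡ U j k
          go e′ cut′ ≡.refl ≡.refl = cut-unique (cut i) cut′

    edges-exhausted : ∀ {x y} → Edge x y → ∃ λ j → p j ≡ x × q j ≡ y
    edges-exhausted d with injective⇒surjective end′-injective (Fin.punchOut (far≢zero (component-isCut d)))
    ... | j , eq = j , far-unique (cut j) (component-isCut d)
                         (Fin.punchOut-injective (far≢zero (cut j)) (far≢zero (component-isCut d)) eq)

-- The closed region

module ClosedRegion {c ℓ₁ ℓ₂} (𝓡 : RealNumbers c ℓ₁ ℓ₂) where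

  open RealNumbers 𝓡 hiding (zero) renaming (Carrier to ℝ)
  open OrderedFieldProperties orderedField

  -- Directing the internal edges upwards absorbs both the condition p < q and the sign of the slope
  -- in the definition of `R`.
  Rises : ∀ {n} → MCT 𝓡 n → Rel (Fin n) ℓ₂
  Rises T p q = Adj (t p) (t q) × Y (t p) < Y (t q)
    where open MCT T

  private
    slope : ∀ {a b} {A : Set a} {B : Set b} → A ⊎ B → Sign
    slope = [ const Sign.+ , const Sign.- ]′

    negate-difference : ∀ x y → - (x - y) ≈ y - x
    negate-difference = solve 2 (λ x y → :- (x :- y) := y :- x) refl

    rising : ∀ {a b x y} (s : a < b ⊎ b < a) → 0# < _⊙_ 𝓡 (slope s) (y - x) → a < b → x < y
    rising (inj₁ _)   0<  _   = 0<y-x⇒x<y 0<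
    rising (inj₂ b<a) _   a<b = contradiction b<a (<-asym a<b)

    falling : ∀ {a b x y} (s : a < b ⊎ b < a) → 0# < _⊙_ 𝓡 (slope s) (y - x) → b < a → y < x
    falling (inj₁ a<b) _  b<a = contradiction a<b (<-asym b<a)
    falling (inj₂ _)   0< _   = 0<y-x⇒x<y (<-respʳ (negate-difference _ _) 0<)

    unslope : ∀ {a b x y} (s : a < b ⊎ b < a) → (a < b → x < y) → (b < a → y < x) →
              0# < _⊙_ 𝓡 (slope s) (y - x)
    unslope (inj₁ a<b) up down = x<y⇒0<y-x (up a<b)
    unslope (inj₂ b<a) up down = <-respʳ (sym (negate-difference _ _)) (x<y⇒0<y-x (down b<a))

  module _ {n} (T : MCT 𝓡 n) where
    open MCT T

    region-rises : ∀ {x : Vector ℝ n} → x ∈ R 𝓡 T → ∀ {p q} → Rises T p q → x p < x q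
    region-rises {x} x∈R {p} {q} (a , lt) with Fin.<-cmp p q
    ... | tri< p<q _ _    = rising (Equivalence.to #⇔<⊎> (non-horizontal a)) (x∈R p<q a) lt
    ... | tri≈ _ ≡.refl _ = contradiction a (loopless ≡.refl)
    ... | tri> _ _ q<p    = falling (Equivalence.to #⇔<⊎> (non-horizontal (symmetric a))) (x∈R q<p (symmetric a)) lt

    rises-region : ∀ {x : Vector ℝ n} → (∀ {p q} → Rises T p q → x p < x q) → x ∈ R 𝓡 T
    rises-region rises p<q a = unslope (Equivalence.to #⇔<⊎> (non-horizontal a))
      (λ lt → rises (a , lt)) (λ lt → rises (symmetric a , lt))

    -- If x p exceeded x q by d, a point of the region within d/2 of x would still have these
    -- coordinates in the wrong order.
    closure-rises : ∀ {x : Vector ℝ n} → x ∈ closure 𝓡 (R 𝓡 T) → ∀ {p q} → Rises T p q → x p ≤ x q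
    closure-rises {x} x∈ {p} {q} e xq<xp =
      <-asym (region-rises y∈R e) (0<y-x⇒x<y (<-respʳ rearrange (x<y⇒0<y-x sum)))
      where
      d ½ : ℝ
      d = x p - x q
      ½ = proj₁ (inverse (fromℕ-pos 1))
      close : ∃ λ y → y ∈ R 𝓡 T × (∀ i → Within (d * ½) (x i) (y i))
      close = x∈ (d * ½) (*-pos (x<y⇒0<y-x xq<xp) (proj₁ (proj₂ (inverse (fromℕ-pos 1)))))
      y : Vector ℝ n
      y = proj₁ close
      y∈R : y ∈ R 𝓡 T
      y∈R = proj₁ (proj₂ close)
      near : ∀ i → Within (d * ½) (x i) (y i)
      near = proj₂ (proj₂ close)
      sum : (x p - y p) + (y q - x q) < d
      sum = <-respʳ halves (+-mono-< (proj₁ (near p)) (proj₂ (near q)))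
        where
        halves : d * ½ + d * ½ ≈ d
        halves = trans (solve 2 (λ d h → d :* h :+ d :* h := d :* (con (+ 2) :* h)) refl d ½)
                   (trans (*-congˡ (proj₂ (proj₂ (inverse (fromℕ-pos 1))))) (*-identityʳ d))
      rearrange : d - ((x p - y p) + (y q - x q)) ≈ y p - y q
      rearrange = solve 4 (λ a b c e → (a :- b) :- ((a :- c) :+ (e :- b)) := c :- e) refl (x p) (x q) (y p) (y q)

    private
      bound : ∀ {k} (f : Vector ℝ k) → ∃ λ K → ∀ i → f i < fromℕ K
      bound {zero}  f = 0 , λ ()
      bound {suc k} f with archimedean (f zero) | bound (f ∘ suc)
      ... | K , lt | L , below = K ℕ.+ L , λ where
        zero    → <-≤-trans lt (fromℕ-mono-≤ (ℕ.m≤m+n K L))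
        (suc i) → <-≤-trans (below i) (fromℕ-mono-≤ (ℕ.m≤n+m L K))

    -- The heights of the tree increase strictly along its edges; a small multiple of them added to
    -- x makes all inequalities strict.
    rises-closure : ∀ {x : Vector ℝ n} → (∀ {p q} → Rises T p q → x p ≤ x q) → x ∈ closure 𝓡 (R 𝓡 T)
    rises-closure {x} rises δ 0<δ = y , rises-region strict , λ i → near₁ i , near₂ i
      where
      h : Vector ℝ n
      h i = Y (t i)
      above = bound h
      below = bound (λ i → - h i)
      -- K bounds all heights and their negatives; the successor makes it invertible.
      K = suc (proj₁ above ℕ.+ proj₁ below)
      inv = inverse (fromℕ-pos (proj₁ above ℕ.+ proj₁ below))
      η = δ * proj₁ inv
      0<η : 0# < η
      0<η = *-pos 0<δ (proj₁ (proj₂ inv))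
      ηK≈δ : fromℕ K * η ≈ δ
      ηK≈δ = trans (solve 3 (λ k d i → k :* (d :* i) := d :* (k :* i)) refl (fromℕ K) δ (proj₁ inv))
        (trans (*-congˡ (proj₂ (proj₂ inv))) (*-identityʳ δ))
      y : Vector ℝ n
      y i = x i + h i * η
      strict : ∀ {p q} → Rises T p q → y p < y q
      strict e = <-respˡ (+-comm _ _) (<-respʳ (+-comm _ _) (+-mono-<-≤ (*-monoʳ-< 0<η (proj₂ e)) (rises e)))
      near₁ : ∀ i → x i - y i < δ
      near₁ i = <-respˡ (solve 3 (λ x h e → (:- h) :* e := x :- (x :+ h :* e)) refl (x i) (h i) η)
        (<-respʳ ηK≈δ (*-monoʳ-< 0<η (<-≤-trans (proj₂ below i)
          (fromℕ-mono-≤ (ℕ.m≤n⇒m≤1+n (ℕ.m≤n+m (proj₁ below) (proj₁ above)))))))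
      near₂ : ∀ i → y i - x i < δ
      near₂ i = <-respˡ (solve 3 (λ x h e → h :* e := (x :+ h :* e) :- x) refl (x i) (h i) η)
        (<-respʳ ηK≈δ (*-monoʳ-< 0<η (<-≤-trans (proj₂ above i)
          (fromℕ-mono-≤ (ℕ.m≤n⇒m≤1+n (ℕ.m≤m+n (proj₁ above) (proj₁ below)))))))

-- The cone of a cluster in the coordinates of the tree

module ConeAlgebra {c ℓ₁ ℓ₂} (𝓡 : RealNumbers c ℓ₁ ℓ₂) where

  open RealNumbers 𝓡 hiding (zero) renaming (Carrier to ℝ)
  open OrderedFieldProperties orderedField
  open import Relation.Binary.Reasoning.Setoid setoid

  fromℤ-Σ : ∀ {k} (f : Vector ℤ k) → fromℤ (Σℤ f) ≈ ∑ (fromℤ ∘ f)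
  fromℤ-Σ {zero}  f = refl
  fromℤ-Σ {suc k} f = trans (fromℤ-+ (f zero) (Σℤ (f ∘ suc))) (+-congˡ (fromℤ-Σ (f ∘ suc)))

  ∑-zero : ∀ {k} (f : Vector ℝ k) → (∀ i → f i ≈ 0#) → ∑ f ≈ 0#
  ∑-zero {zero}  f f≈0 = refl
  ∑-zero {suc k} f f≈0 = trans (+-cong (f≈0 zero) (∑-zero (f ∘ suc) (f≈0 ∘ suc))) (+-identityˡ 0#)

  ∑-single : ∀ {k} (f : Vector ℝ k) j → (∀ i → i ≢ j → f i ≈ 0#) → ∑ f ≈ f j
  ∑-single f zero    f≈0 = trans (+-congˡ (∑-zero (f ∘ suc) λ i → f≈0 (suc i) λ ())) (+-identityʳ _)
  ∑-single f (suc j) f≈0 = trans (+-cong (f≈0 zero λ ()) (∑-single (f ∘ suc) j λ i i≢j → f≈0 (suc i) (i≢j ∘ Fin.suc-injective))) (+-identityˡ _)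

  ∑-difference : ∀ {k} (f g : Vector ℝ k) → ∑ (λ i → f i - g i) ≈ ∑ f - ∑ g
  ∑-difference {zero}  f g = sym (-‿inverseʳ 0#)
  ∑-difference {suc k} f g = trans (+-congˡ (∑-difference (f ∘ suc) (g ∘ suc)))
    (solve 4 (λ a b c d → (a :- b) :+ (c :- d) := (a :+ c) :- (b :+ d)) refl _ _ _ _)

  ᵗ∙-combination : ∀ {m} (E : Matrix m) (v : Fin m → Vector ℤ m) (a : Vector ℝ m) {w : Vector ℝ m} →
    (∀ l → w l ≈ ∑ λ i → a i * fromℤ (v i l)) →
    ∀ k → _ᵗ∙_ 𝓡 E w k ≈ ∑ λ i → a i * fromℤ (Σℤ λ l → E l k ℤ.* v i l)
  ᵗ∙-combination E v a {w} w≈ k = begin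
    ∑ (λ l → fromℤ (E l k) * w l)                                  ≈⟨ sum-cong-≋ (λ l → *-congˡ (w≈ l)) ⟩
    ∑ (λ l → fromℤ (E l k) * ∑ λ i → a i * fromℤ (v i l))          ≈⟨ sum-cong-≋ (λ l → *-distribˡ-sum (fromℤ (E l k)) (λ i → a i * fromℤ (v i l))) ⟩
    ∑ (λ l → ∑ λ i → fromℤ (E l k) * (a i * fromℤ (v i l)))        ≈⟨ ∑-comm (λ l i → fromℤ (E l k) * (a i * fromℤ (v i l))) ⟩
    ∑ (λ i → ∑ λ l → fromℤ (E l k) * (a i * fromℤ (v i l)))        ≈⟨ sum-cong-≋ (λ i → sum-cong-≋ λ l → swap (E l k) (a i) (v i l)) ⟩
    ∑ (λ i → ∑ λ l → a i * fromℤ (E l k ℤ.* v i l))                ≈⟨ sum-cong-≋ (λ i → sym (*-distribˡ-sum (a i) (λ l → fromℤ (E l k ℤ.* v i l)))) ⟩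
    ∑ (λ i → a i * ∑ λ l → fromℤ (E l k ℤ.* v i l))                ≈⟨ sum-cong-≋ (λ i → *-congˡ (sym (fromℤ-Σ λ l → E l k ℤ.* v i l))) ⟩
    ∑ (λ i → a i * fromℤ (Σℤ λ l → E l k ℤ.* v i l))               ∎
    where
    swap : ∀ x a y → fromℤ x * (a * fromℤ y) ≈ a * fromℤ (x ℤ.* y)
    swap x a y = trans (solve 3 (λ x a y → x :* (a :* y) := a :* (x :* y)) refl (fromℤ x) a (fromℤ y))
                   (*-congˡ (sym (fromℤ-* x y)))

  module Combinations {m} (ε : Vector Sign (suc m)) (v : Fin m → Vector ℤ m) (U : Fin m → Fin (suc m) → Bool)
           (image : ∀ j k → eulerᵗ ε (v j) k ≡ step (ind ∘ U j) k) where

    combine : Vector ℝ m → Vector ℝ (suc m)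
    combine a i = ∑ λ j → a j * fromℤ (ind (U j i))

    combine-difference : ∀ a i k → combine a k - combine a i ≈ ∑ λ j → a j * (fromℤ (ind (U j k)) - fromℤ (ind (U j i)))
    combine-difference a i k = trans (sym (∑-difference (λ j → a j * fromℤ (ind (U j k))) (λ j → a j * fromℤ (ind (U j i)))))
      (sum-cong-≋ λ j → solve 3 (λ a x y → a :* x :- a :* y := a :* (x :- y)) refl (a j) _ _)

    combine-step : ∀ a k → combine a (suc k) - combine a (inject₁ k) ≈ ∑ λ j → a j * fromℤ (eulerᵗ ε (v j) k)
    combine-step a k = trans (combine-difference a (inject₁ k) (suc k)) (sum-cong-≋ λ j → *-congˡ (sym (begin
      fromℤ (eulerᵗ ε (v j) k)                                       ≡⟨ cong fromℤ (image j k) ⟩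
      fromℤ (ind (U j (suc k)) ℤ.- ind (U j (inject₁ k)))            ≈⟨ fromℤ-+ (ind (U j (suc k))) _ ⟩
      fromℤ (ind (U j (suc k))) + fromℤ (ℤ.- ind (U j (inject₁ k)))  ≈⟨ +-congˡ (fromℤ-neg (ind (U j (inject₁ k)))) ⟩
      fromℤ (ind (U j (suc k))) - fromℤ (ind (U j (inject₁ k)))      ∎)))

    cone⇒combination : ∀ {x} → F 𝓡 x ∈ EᵗS 𝓡 ε v →
      ∃ λ a → (∀ j → 0# ≤ a j) × (∀ k → F 𝓡 x k ≈ combine a (suc k) - combine a (inject₁ k))
    cone⇒combination (w , (a , 0≤a , w≈) , y≈) = a , 0≤a , λ k →
      trans (y≈ k) (trans (ᵗ∙-combination (euler ε) v a w≈ k) (sym (combine-step a k)))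

    combination⇒cone : ∀ {x} a → (∀ j → 0# ≤ a j) → (∀ k → F 𝓡 x k ≈ combine a (suc k) - combine a (inject₁ k)) →
      F 𝓡 x ∈ EᵗS 𝓡 ε v
    combination⇒cone a 0≤a Fx≈ = (λ l → ∑ λ i → a i * fromℤ (v i l)) , (a , 0≤a , λ _ → refl) , λ k →
      trans (Fx≈ k) (trans (combine-step a k) (sym (ᵗ∙-combination (euler ε) v a (λ _ → refl) k)))

    module Edges (p q : Fin m → Fin (suc m))
             (lower : ∀ j → U j (p j) ≡ false) (upper : ∀ j → U j (q j) ≡ true)
             (other : ∀ i j → i ≢ j → U i (p j) ≡ U i (q j))
             (path : ∀ i → Star (λ a b → ∃ λ j → (p j ≡ a × q j ≡ b) ⊎ (p j ≡ b × q j ≡ a)) zero i) where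

      -- Along the edge j the set U j is the only one that changes, so a single coefficient
      -- survives: the cone is simplicial, and its coordinates are the differences along the edges.
      combine-edge : ∀ a j → combine a (q j) - combine a (p j) ≈ a j
      combine-edge a j = begin
        combine a (q j) - combine a (p j)                                            ≈⟨ combine-difference a (p j) (q j) ⟩
        ∑ (λ i → a i * (fromℤ (ind (U i (q j))) - fromℤ (ind (U i (p j)))))          ≈⟨ ∑-single _ j vanish ⟩
        a j * (fromℤ (ind (U j (q j))) - fromℤ (ind (U j (p j))))                    ≡⟨ ≡.cong₂ (λ b b′ → a j * (fromℤ (ind b) - fromℤ (ind b′))) (upper j) (lower j) ⟩
        a j * (fromℤ 1ℤ - fromℤ 0ℤ)                                                  ≈⟨ *-congˡ (trans (+-congˡ -0#≈0#) (trans (+-identityʳ _) fromℤ-1)) ⟩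
        a j * 1#                                                                     ≈⟨ *-identityʳ (a j) ⟩
        a j                                                                          ∎
        where
        vanish : ∀ i → i ≢ j → a i * (fromℤ (ind (U i (q j))) - fromℤ (ind (U i (p j)))) ≈ 0#
        vanish i i≢j = begin
          a i * (fromℤ (ind (U i (q j))) - fromℤ (ind (U i (p j))))  ≡⟨ cong (λ b → a i * (fromℤ (ind (U i (q j))) - fromℤ (ind b))) (other i j i≢j) ⟩
          a i * (fromℤ (ind (U i (q j))) - fromℤ (ind (U i (q j))))  ≈⟨ *-congˡ (-‿inverseʳ _) ⟩
          a i * 0#                                                   ≈⟨ solve 1 (λ a → a :* con 0ℤ := con 0ℤ) refl (a i) ⟩
          0#                                                         ∎

      -- With the differences along the edges as coefficients, `x - combine a` is constant along
      -- each edge, hence constant, and F does not see constants.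
      edges⇒cone : ∀ {x} → (∀ j → x (p j) ≤ x (q j)) → F 𝓡 x ∈ EᵗS 𝓡 ε v
      edges⇒cone {x} rises = combination⇒cone {x} a (λ j → x≤y⇒0≤y-x (rises j)) λ k → begin
        x (suc k) - x (inject₁ k)                          ≈⟨ swap (x (suc k)) (x (inject₁ k)) (z (suc k)) (z (inject₁ k)) (trans (same (suc k)) (sym (same (inject₁ k)))) ⟩
        z (suc k) - z (inject₁ k)                          ∎
        where
        a : Vector ℝ m
        a j = x (q j) - x (p j)
        z = combine a
        swap : ∀ x x′ z z′ → x - z ≈ x′ - z′ → x - x′ ≈ z - z′
        swap x x′ z z′ eq = begin
          x - x′                      ≈⟨ solve 3 (λ x x′ z → x :- x′ := (x :- z) :+ (z :- x′)) refl x x′ z ⟩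
          (x - z) + (z - x′)          ≈⟨ +-congʳ eq ⟩
          (x′ - z′) + (z - x′)        ≈⟨ solve 3 (λ x′ z z′ → (x′ :- z′) :+ (z :- x′) := z :- z′) refl x′ z z′ ⟩
          z - z′                      ∎
        edge-same : ∀ j → x (q j) - z (q j) ≈ x (p j) - z (p j)
        edge-same j = swap (x (q j)) (z (q j)) (x (p j)) (z (p j)) (sym (combine-edge a j))
        along : ∀ {i k} → Star (λ a b → ∃ λ j → (p j ≡ a × q j ≡ b) ⊎ (p j ≡ b × q j ≡ a)) i k → x k - z k ≈ x i - z i
        along nil = refl
        along ((j , inj₁ (≡.refl , ≡.refl)) ◅ rest) = trans (along rest) (edge-same j)
        along ((j , inj₂ (≡.refl , ≡.refl)) ◅ rest) = trans (along rest) (sym (edge-same j))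
        same : ∀ i → x i - z i ≈ x zero - z zero
        same i = along (path i)

      cone⇒edges : ∀ {x} → F 𝓡 x ∈ EᵗS 𝓡 ε v → ∀ j → x (p j) ≤ x (q j)
      cone⇒edges {x} x∈ j with cone⇒combination {x} x∈
      ... | a , 0≤a , Fx≈ = 0≤y-x⇒x≤y (≤-respʳ (sym xq-xp≈a) (0≤a j))
        where
        z = combine a
        swap : ∀ x x′ z z′ → x - x′ ≈ z - z′ → x - z ≈ x′ - z′
        swap x x′ z z′ eq = begin
          x - z                       ≈⟨ solve 3 (λ x x′ z → x :- z := (x :- x′) :+ (x′ :- z)) refl x x′ z ⟩
          (x - x′) + (x′ - z)         ≈⟨ +-congʳ eq ⟩
          (z - z′) + (x′ - z)         ≈⟨ solve 3 (λ x′ z z′ → (z :- z′) :+ (x′ :- z) := x′ :- z′) refl x′ z z′ ⟩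
          x′ - z′                     ∎
        same : ∀ i → x i - z i ≈ x zero - z zero
        same = Fin.<-weakInduction _ refl λ k eq → trans (swap (x (suc k)) (x (inject₁ k)) (z (suc k)) (z (inject₁ k)) (Fx≈ k)) eq
        xq-xp≈a : x (q j) - x (p j) ≈ a j
        xq-xp≈a = trans (swap (x (q j)) (z (q j)) (x (p j)) (z (p j)) (trans (same (q j)) (sym (same (p j))))) (combine-edge a j)

-- Uniqueness

-- Reachability by rising edges is not shown to be decidable. Its indicator only serves to reach a
-- contradiction, for which a decision under a double negation is enough.
¬¬-decide : ∀ {ℓ n} {P : Fin n → Set ℓ} → ¬ ¬ (∀ i → Dec (P i))
¬¬-decide {n = zero}  no-dec = no-dec λ ()
¬¬-decide {n = suc n} no-dec = ¬¬-excluded-middle λ P₀ → ¬¬-decide λ P₊ →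
  no-dec λ { zero → P₀ ; (suc i) → P₊ i }

length : ∀ {a ℓ} {A : Set a} {R : Rel A ℓ} {x y} → Star R x y → ℕ
length nil      = 0
length (_ ◅ xs) = suc (length xs)

visit : ∀ {a ℓ} {A : Set a} {R : Rel A ℓ} {x y} (xs : Star R x y) → Fin (suc (length xs)) → A
visit {x = x} xs       zero    = x
visit         (_ ◅ xs) (suc i) = visit xs i

visit-step : ∀ {a ℓ} {A : Set a} {R : Rel A ℓ} {x y} (xs : Star R x y) i →
             R (visit xs (inject₁ i)) (visit xs (suc i))
visit-step (r ◅ nil)    zero    = r
visit-step (r ◅ _ ◅ xs) zero    = r
visit-step (r ◅ xs)     (suc i) = visit-step xs i

visit-last : ∀ {a ℓ} {A : Set a} {R : Rel A ℓ} {x y} (xs : Star R x y) → visit xs (Fin.fromℕ (length xs)) ≡ y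
visit-last nil      = ≡.refl
visit-last (r ◅ xs) = visit-last xs

module Uniqueness {c ℓ₁ ℓ₂} (𝓡 : RealNumbers c ℓ₁ ℓ₂) where

  open RealNumbers 𝓡 hiding (zero) renaming (Carrier to ℝ)
  open OrderedFieldProperties orderedField
  open ClosedRegion 𝓡

  module _ {n} (T : MCT 𝓡 n) where
    open MCT T

    rises-irrefl : ∀ {i} → ¬ Rises T i i
    rises-irrefl (a , _) = loopless ≡.refl a

    rises? : ∀ i k → Dec (Rises T i k)
    rises? i k with adj? (t i) (t k)
    ... | no ¬a = no (¬a ∘ proj₁)
    ... | yes a with Equivalence.to #⇔<⊎> (non-horizontal a)
    ...   | inj₁ lt = yes (a , lt)
    ...   | inj₂ gt = no λ (_ , lt) → <-asym lt gt

    visit-rises : ∀ {x y} (xs : Star (Rises T) x y) {i j} → i Fin.< j → Y (t (visit xs i)) < Y (t (visit xs j))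
    visit-rises ((_ , x<y) ◅ nil)      {zero} {suc zero} _ = x<y
    visit-rises ((_ , x<y) ◅ xs@(_ ◅ _)) {zero} {suc zero} _ = x<y
    visit-rises ((_ , x<y) ◅ xs@(_ ◅ _)) {zero} {suc (suc j)} _ = <-trans x<y (visit-rises xs {zero} {suc j} ℕ.z<s)
    visit-rises (_ ◅ xs) {suc i} {suc j} (s≤s i<j) = visit-rises xs i<j

    visit-injective : ∀ {x y} (xs : Star (Rises T) x y) → Injective _≡_ _≡_ (λ i → t (visit xs i))
    visit-injective xs {i} {j} eq with Fin.<-cmp i j
    ... | tri< i<j _ _ = contradiction (visit-rises xs i<j) (<-irrefl (reflexive (cong Y eq)))
    ... | tri≈ _ i≡j _ = i≡j
    ... | tri> _ _ j<i = contradiction (visit-rises xs j<i) (<-irrefl (reflexive (cong Y (≡.sym eq))))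

    -- The path has at least two steps, so together with the edge it visits at least three vertices,
    -- which differ because the heights increase.
    no-cycle : ∀ {i j l k} → Adj (t i) (t k) → Rises T i j → Rises T j l → Star (Rises T) l k → ⊥
    no-cycle {i} {k = k} a r s xs = acyclic (t ∘ visit path) (visit-injective path) (proj₁ ∘ visit-step path)
      (subst (λ k → Adj (t k) (t i)) (≡.sym (visit-last path)) (symmetric a))
      where
      path : Star (Rises T) i k
      path = r ◅ s ◅ xs

    -- Edges are covering relations, because a longer rising path would close to a cycle.
    no-detour : ∀ {i k l} → Rises T i k → i ≢ l → l ≢ k → Star (Rises T) i l → Star (Rises T) l k → ⊥
    no-detour _ i≢l _ nil _ = i≢l ≡.refl
    no-detour _ _ l≢k _ nil = l≢k ≡.refl
    no-detour {i} {k} (a , _) _ _ (r ◅ nil) (s ◅ ys) = no-cycle a r s ys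
    no-detour {i} {k} (a , _) _ _ (r ◅ s ◅ xs) ys@(_ ◅ _) = no-cycle a r s (xs ◅◅ ys)

  indicator : ∀ {ℓ} {P : Set ℓ} → Dec P → ℝ
  indicator (yes _) = 1#
  indicator (no  _) = 0#

  module _ {n} (T T′ : MCT 𝓡 n) where

    -- The indicators of the sets which are closed under rising lie in the closed region.
    rises-path : closure 𝓡 (R 𝓡 T′) ⊆ closure 𝓡 (R 𝓡 T) → ∀ {i k} → Rises T i k → ¬ ¬ Star (Rises T′) i k
    rises-path incl {i} {k} e no-path = ¬¬-decide {P = Star (Rises T′) i} λ reach? →
      compare (reach? i) (reach? k) (closure-rises T (incl (rises-closure T′ {indicator ∘ reach?} (monotone reach?))) e)
      where
      compare : (d : Dec (Star (Rises T′) i i)) (d′ : Dec (Star (Rises T′) i k)) → ¬ (indicator d ≤ indicator d′)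
      compare (yes _) (no _) 1≤0 = 1≤0 0<1
      compare (no ¬p) _      _   = ¬p nil
      compare (yes _) (yes p) _  = no-path p
      monotone : (reach? : ∀ k → Dec (Star (Rises T′) i k)) → ∀ {p q} → Rises T′ p q → indicator (reach? p) ≤ indicator (reach? q)
      monotone reach? {p} {q} r with reach? p | reach? q
      ... | yes _ | yes _ = ≈⇒≤ refl
      ... | yes p | no ¬q = contradiction (p ◅◅ r ◅ nil) ¬q
      ... | no _  | yes _ = <⇒≤ 0<1
      ... | no _  | no _  = ≈⇒≤ refl

  paths : ∀ {n} (T T′ : MCT 𝓡 n) → closure 𝓡 (R 𝓡 T′) ⊆ closure 𝓡 (R 𝓡 T) → ∀ {i k} →
          Star (Rises T) i k → ¬ ¬ Star (Rises T′) i k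
  paths T T′ incl nil      no-path = no-path nil
  paths T T′ incl (r ◅ rs) no-path = rises-path T T′ incl r λ p → paths T T′ incl rs λ ps → no-path (p ◅◅ ps)

  -- An edge of T becomes a path of T′. If its first step does not lead to k, both parts of the path
  -- return to T as a detour around the edge, which is excluded. The double negations disappear
  -- because `Rises` is decidable.
  rises-transfer : ∀ {n} (T T′ : MCT 𝓡 n) → closure 𝓡 (R 𝓡 T′) ⊆ closure 𝓡 (R 𝓡 T) → closure 𝓡 (R 𝓡 T) ⊆ closure 𝓡 (R 𝓡 T′) →
                   ∀ {i k} → Rises T i k → Rises T′ i k
  rises-transfer T T′ incl incl′ {i} {k} e = decidable-stable (rises? T′ i k) λ no-edge →
    rises-path T T′ incl e λ where
      nil → rises-irrefl T e
      (_◅_ {j = l} r rs) → case l Fin.≟ k of λ where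
        (yes ≡.refl) → no-edge r
        (no  l≢k)    → paths T′ T incl′ (r ◅ nil) λ p → paths T′ T incl′ rs λ q →
          no-detour T e (λ { ≡.refl → rises-irrefl T′ r }) l≢k p q

-- Naming the vertices of an arbitrary mixed cobinary tree

module Neighbourhoods {c ℓ₁ ℓ₂} (𝓡 : RealNumbers c ℓ₁ ℓ₂) {m : ℕ} (T : MCT 𝓡 (suc m)) where

  open RealNumbers 𝓡 hiding (zero) renaming (Carrier to ℝ)
  open OrderedFieldProperties orderedField
  open ClosedRegion 𝓡
  open Uniqueness 𝓡
  open MCT T

  private
    n = suc m

    nbOf : ∀ i → IsΛ (t i) ⊎ IsV (t i) → Slot → Vertex
    nbOf i (inj₁ Λ) single = proj₁ (proj₂ Λ)
    nbOf i (inj₁ Λ) left′  = proj₁ (Λ-separate i Λ)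
    nbOf i (inj₁ Λ) right′ = proj₁ (proj₂ (Λ-separate i Λ))
    nbOf i (inj₂ V) single = proj₁ (proj₁ V)
    nbOf i (inj₂ V) left′  = proj₁ (V-separate i V)
    nbOf i (inj₂ V) right′ = proj₁ (proj₂ (V-separate i V))

    signOf : ∀ {i} → IsΛ (t i) ⊎ IsV (t i) → Sign
    signOf = [ const Sign.+ , const Sign.- ]′

    Vertical : Sign → Fin n → Vertex → Set ℓ₂
    Vertical Sign.+ i = Parent (t i)
    Vertical Sign.- i = Child (t i)

    nbOf-vertical : ∀ i ty s → Vertical (dir (signOf {i} ty) s) i (nbOf i ty s)
    nbOf-vertical i (inj₁ Λ) single = proj₁ (proj₂ (proj₂ Λ))
    nbOf-vertical i (inj₁ Λ) left′  = proj₁ (proj₂ (proj₂ (Λ-separate i Λ)))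
    nbOf-vertical i (inj₁ Λ) right′ = proj₁ (proj₂ (proj₂ (proj₂ (Λ-separate i Λ))))
    nbOf-vertical i (inj₂ V) single = proj₁ (proj₂ (proj₁ V))
    nbOf-vertical i (inj₂ V) left′  = proj₁ (proj₂ (proj₂ (V-separate i V)))
    nbOf-vertical i (inj₂ V) right′ = proj₁ (proj₂ (proj₂ (proj₂ (V-separate i V))))

    nbOf-x : ∀ i ty → X (nbOf i ty left′) < X (t i) × X (t i) < X (nbOf i ty right′)
    nbOf-x i (inj₁ Λ) = proj₂ (proj₂ (proj₂ (proj₂ (Λ-separate i Λ))))
    nbOf-x i (inj₂ V) = proj₂ (proj₂ (proj₂ (proj₂ (V-separate i V))))

    left≢right : ∀ i ty → nbOf i ty left′ ≢ nbOf i ty right′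
    left≢right i ty eq = <-irrefl (reflexive (cong X eq)) (<-trans (proj₁ (nbOf-x i ty)) (proj₂ (nbOf-x i ty)))

    -- The two neighbours on the wall side of a node are given twice, by its type and by the
    -- separation axiom. Both pairs are the same, so the neighbours can be told apart as left and
    -- right.
    two : ∀ {a b l r w : Vertex} → l ≢ r → l ≡ a ⊎ l ≡ b → r ≡ a ⊎ r ≡ b → w ≡ a ⊎ w ≡ b → w ≡ l ⊎ w ≡ r
    two l≢r (inj₁ ≡.refl) (inj₁ ≡.refl) _ = contradiction ≡.refl l≢r
    two l≢r (inj₂ ≡.refl) (inj₂ ≡.refl) _ = contradiction ≡.refl l≢r
    two l≢r (inj₁ ≡.refl) (inj₂ ≡.refl) w = w
    two l≢r (inj₂ ≡.refl) (inj₁ ≡.refl) w = Sum.swap w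

    nbOf-complete : ∀ i ty {w} → Adj (t i) w → ∃ λ s → w ≡ nbOf i ty s
    nbOf-complete i ty {w} a with Equivalence.to #⇔<⊎> (non-horizontal a)
    nbOf-complete i (inj₁ Λ) a | inj₁ up = single , ≡.sym (proj₂ (proj₂ (proj₂ Λ)) (a , up))
    nbOf-complete i (inj₂ V) a | inj₂ down = single , ≡.sym (proj₂ (proj₂ (proj₁ V)) (a , down))
    nbOf-complete i ty@(inj₁ Λ@((_ , _ , _ , _ , _ , only) , _)) a | inj₂ down
      with two (left≢right i ty) (only (nbOf-vertical i ty left′)) (only (nbOf-vertical i ty right′)) (only (a , down))
    ... | inj₁ eq = left′ , eq
    ... | inj₂ eq = right′ , eq
    nbOf-complete i ty@(inj₂ V@(_ , (_ , _ , _ , _ , _ , only))) a | inj₁ up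
      with two (left≢right i ty) (only (nbOf-vertical i ty left′)) (only (nbOf-vertical i ty right′)) (only (a , up))
    ... | inj₁ eq = left′ , eq
    ... | inj₂ eq = right′ , eq

  nb : Fin n → Slot → Vertex
  nb i = nbOf i (node-type i)

  nb-complete : ∀ {i w} → Adj (t i) w → ∃ λ s → w ≡ nb i s
  nb-complete {i} = nbOf-complete i (node-type i)

  private
    vertical-adj : ∀ d {i w} → Vertical d i w → Adj (t i) w
    vertical-adj Sign.+ = proj₁
    vertical-adj Sign.- = proj₁

    opposite-vertical : ∀ d {i w} → Vertical d i w → ¬ Vertical (opposite d) i w
    opposite-vertical Sign.+ (_ , up) (_ , down) = <-asym up down
    opposite-vertical Sign.- (_ , down) (_ , up) = <-asym up down

  nb-vertical : ∀ i s → Vertical (dir (signVector i) s) i (nb i s)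
  nb-vertical i = nbOf-vertical i (node-type i)

  adj-nb : ∀ i s → Adj (t i) (nb i s)
  adj-nb i s = vertical-adj (dir (signVector i) s) (nb-vertical i s)

  nb-injective : ∀ i s s′ → nb i s ≡ nb i s′ → s ≡ s′
  nb-injective i single single _  = ≡.refl
  nb-injective i left′  left′  _  = ≡.refl
  nb-injective i right′ right′ _  = ≡.refl
  nb-injective i left′  right′ eq = contradiction eq (left≢right i (node-type i))
  nb-injective i right′ left′  eq = contradiction (≡.sym eq) (left≢right i (node-type i))
  nb-injective i single left′  eq = contradiction (subst (Vertical (opposite (signVector i)) i) (≡.sym eq) (nb-vertical i left′)) (opposite-vertical (signVector i) (nb-vertical i single))
  nb-injective i single right′ eq = contradiction (subst (Vertical (opposite (signVector i)) i) (≡.sym eq) (nb-vertical i right′)) (opposite-vertical (signVector i) (nb-vertical i single))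
  nb-injective i left′  single eq = contradiction (subst (Vertical (opposite (signVector i)) i) eq (nb-vertical i left′)) (opposite-vertical (signVector i) (nb-vertical i single))
  nb-injective i right′ single eq = contradiction (subst (Vertical (opposite (signVector i)) i) eq (nb-vertical i right′)) (opposite-vertical (signVector i) (nb-vertical i single))

  Link : Sign → Rel (Fin n) ℓ₂
  Link Sign.+ i k = Rises T i k
  Link Sign.- i k = Rises T k i

  InSlot : Fin n → Slot → Fin n → Set ℓ₂
  InSlot i s k = Link (dir (signVector i) s) i k × Fits s i k

  private
    X-reflects : ∀ {i k} → X (t i) < X (t k) → i Fin.< k
    X-reflects {i} {k} lt = ℕ.≰⇒> λ k≤i → fromℕ-mono-≤ (s≤s k≤i)
      (<-respˡ (t-abscissa i) (<-respʳ (t-abscissa k) lt))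

    link : ∀ d {i k} → Vertical d i (t k) → Link d i k
    link Sign.+ r = r
    link Sign.- (a , lt) = symmetric a , lt

    link-adj : ∀ d {i k} → Link d i k → Adj (t i) (t k)
    link-adj Sign.+ = proj₁
    link-adj Sign.- = symmetric ∘ proj₁

    opposite-link : ∀ d {i k} → Link d i k → ¬ Link (opposite d) i k
    opposite-link Sign.+ (_ , lt) (_ , gt) = <-asym lt gt
    opposite-link Sign.- (_ , lt) (_ , gt) = <-asym lt gt

    fits : ∀ i s {k} → nb i s ≡ t k → Fits s i k
    fits i single eq = tt
    fits i left′  eq = X-reflects (subst (λ v → X v < X (t i)) eq (proj₁ (nbOf-x i (node-type i))))
    fits i right′ eq = X-reflects (subst (λ v → X (t i) < X v) eq (proj₂ (nbOf-x i (node-type i))))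

    inSlot-disjoint : ∀ {i k} s s′ → InSlot i s k → InSlot i s′ k → s ≡ s′
    inSlot-disjoint single single _ _ = ≡.refl
    inSlot-disjoint left′  left′  _ _ = ≡.refl
    inSlot-disjoint right′ right′ _ _ = ≡.refl
    inSlot-disjoint left′  right′ (_ , lt) (_ , gt) = contradiction gt (ℕ.<-asym lt)
    inSlot-disjoint right′ left′  (_ , lt) (_ , gt) = contradiction gt (ℕ.<-asym lt)
    inSlot-disjoint {i} single left′  (l , _) (l′ , _) = contradiction l′ (opposite-link (signVector i) l)
    inSlot-disjoint {i} single right′ (l , _) (l′ , _) = contradiction l′ (opposite-link (signVector i) l)
    inSlot-disjoint {i} left′  single (l′ , _) (l , _) = contradiction l′ (opposite-link (signVector i) l)
    inSlot-disjoint {i} right′ single (l′ , _) (l , _) = contradiction l′ (opposite-link (signVector i) l)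

  nb⇒inSlot : ∀ i s {k} → nb i s ≡ t k → InSlot i s k
  nb⇒inSlot i s eq = link (dir (signVector i) s) (subst (Vertical (dir (signVector i) s) i) eq (nb-vertical i s)) , fits i s eq

  inSlot⇒nb : ∀ i s {k} → InSlot i s k → nb i s ≡ t k
  inSlot⇒nb i s {k} inSlot with nb-complete (link-adj (dir (signVector i) s) (proj₁ inSlot))
  ... | s′ , eq with inSlot-disjoint s′ s (nb⇒inSlot i s′ (≡.sym eq)) inSlot
  ...   | ≡.refl = ≡.sym eq

  t-injective : ∀ {i k} → t i ≡ t k → i ≡ k
  t-injective {i} {k} eq with Fin.<-cmp i k
  ... | tri< i<k _ _ = contradiction (<-respˡ (sym (t-abscissa i)) (<-respʳ (sym (t-abscissa k)) (fromℕ-mono-< (s≤s i<k)))) (<-irrefl (reflexive (cong X eq)))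
  ... | tri≈ _ i≡k _ = i≡k
  ... | tri> _ _ k<i = contradiction (<-respˡ (sym (t-abscissa k)) (<-respʳ (sym (t-abscissa i)) (fromℕ-mono-< (s≤s k<i)))) (<-irrefl (reflexive (cong X (≡.sym eq))))

  Outer : Vertex → Set
  Outer v = ∀ i → t i ≢ v

  -- Being internal is a negation, so `t-onto` can only refute a second neighbour; decidable
  -- equality of vertices turns this into a proof of equality.
  outer-neighbour-unique : ∀ {v w w′} → Outer v → Adj v w → Adj v w′ → w ≡ w′
  outer-neighbour-unique {v} {w} {w′} outer a a′ = decidable-stable (w Fin.≟ w′) λ w≢w′ →
    let i , eq = t-onto v (λ (_ , _ , unique) → w≢w′ (≡.trans (≡.sym (unique a)) (unique a′))) in outer i eq

  -- Two adjacent leaves would form a connected component.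
  outer-neighbour-internal : ∀ {v w} → Outer v → Adj v w → ¬ Outer w
  outer-neighbour-internal {v} {w} outer a outer′ = trapped (connected v (t zero)) (inj₁ ≡.refl)
    where
    trapped : ∀ {u} → Star Adj u (t zero) → ¬ (u ≡ v ⊎ u ≡ w)
    trapped nil (inj₁ eq) = outer zero eq
    trapped nil (inj₂ eq) = outer′ zero eq
    trapped (b ◅ path) (inj₁ ≡.refl) = trapped path (inj₂ (outer-neighbour-unique outer b a))
    trapped (b ◅ path) (inj₂ ≡.refl) = trapped path (inj₁ (outer-neighbour-unique outer′ b (symmetric a)))

  -- The names refer to positions only, so they can be carried over to another tree; the tree
  -- decides which slots are occupied by leaves.
  data Name : Set where
    node : Fin n → Name
    slot : Fin n → Slot → Name

  Valid : Name → Set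
  Valid (node i)   = ⊤
  Valid (slot i s) = Outer (nb i s)

  vertex : Name → Vertex
  vertex (node i)   = t i
  vertex (slot i s) = nb i s

  -- A vertex that is no `t i` has a neighbour by connectedness. This neighbour is some `t i`, and
  -- the vertex occupies one of its slots.
  name-of : ∀ v → ∃ λ nm → Valid nm × vertex nm ≡ v
  name-of v with Fin.any? (λ i → t i Fin.≟ v)
  ... | yes (i , eq) = node i , tt , eq
  ... | no  none with connected v (t zero)
  ...   | nil = contradiction (zero , ≡.refl) none
  ...   | _◅_ {j = w} a _ with Fin.any? (λ i → t i Fin.≟ w)
  ...     | no  none′ = contradiction (λ i eq → none′ (i , eq)) (outer-neighbour-internal (λ i eq → none (i , eq)) a)
  ...     | yes (i , ≡.refl) with nb-complete (symmetric a)
  ...       | s , ≡.refl = slot i s , (λ k eq → none (k , eq)) , ≡.refl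

  vertex-injective : ∀ nm nm′ → Valid nm → Valid nm′ → vertex nm ≡ vertex nm′ → nm ≡ nm′
  vertex-injective (node i)   (node k)    _  _  eq = cong node (t-injective eq)
  vertex-injective (node i)   (slot k s)  _  o  eq = contradiction eq (o i)
  vertex-injective (slot i s) (node k)    o  _  eq = contradiction (≡.sym eq) (o k)
  vertex-injective (slot i s) (slot k s′) o  o′ eq
    with t-injective (outer-neighbour-unique o (symmetric (adj-nb i s)) (subst (λ v → Adj v (t k)) (≡.sym eq) (symmetric (adj-nb k s′))))
  ... | ≡.refl = cong (slot i) (nb-injective i s s′ eq)

  AdjName : Name → Name → Set ℓ₂
  AdjName (node i)   (node k)   = Rises T i k ⊎ Rises T k i
  AdjName (node i)   (slot k _) = Level.Lift ℓ₂ (i ≡ k)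
  AdjName (slot i _) (node k)   = Level.Lift ℓ₂ (i ≡ k)
  AdjName (slot _ _) (slot _ _) = Level.Lift ℓ₂ ⊥

  adj⇒name : ∀ nm nm′ → Valid nm → Valid nm′ → Adj (vertex nm) (vertex nm′) → AdjName nm nm′
  adj⇒name (node i) (node k) _ _ a = Sum.map (a ,_) (symmetric a ,_) (Equivalence.to #⇔<⊎> (non-horizontal a))
  adj⇒name (node i) (slot k s) _ o a = Level.lift (t-injective (outer-neighbour-unique o (symmetric a) (symmetric (adj-nb k s))))
  adj⇒name (slot i s) (node k) o _ a = Level.lift (t-injective (outer-neighbour-unique o (symmetric (adj-nb i s)) a))
  adj⇒name (slot i s) (slot k s′) o o′ a = contradiction o′ (outer-neighbour-internal o a)

  name⇒adj : ∀ nm nm′ → AdjName nm nm′ → Adj (vertex nm) (vertex nm′)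
  name⇒adj (node i)   (node k)   (inj₁ (a , _)) = a
  name⇒adj (node i)   (node k)   (inj₂ (a , _)) = symmetric a
  name⇒adj (node i)   (slot k s) (Level.lift ≡.refl) = adj-nb i s
  name⇒adj (slot i s) (node k)   (Level.lift ≡.refl) = symmetric (adj-nb i s)

module Isomorphisms {c ℓ₁ ℓ₂} (𝓡 : RealNumbers c ℓ₁ ℓ₂) {m : ℕ} where

  open RealNumbers 𝓡 hiding (zero) renaming (Carrier to ℝ)
  open ClosedRegion 𝓡
  open Uniqueness 𝓡

  module Translate (T T′ : MCT 𝓡 (suc m)) (signs : ∀ i → MCT.signVector T i ≡ MCT.signVector T′ i)
                   (rises : ∀ {i k} → Rises T i k → Rises T′ i k) (rises′ : ∀ {i k} → Rises T′ i k → Rises T i k) where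
    private
      module N  = Neighbourhoods 𝓡 T
      module N′ = Neighbourhoods 𝓡 T′

    translate : N.Name → N′.Name
    translate (N.node i)   = N′.node i
    translate (N.slot i s) = N′.slot i s

    private
      link : ∀ d {i k} → N′.Link d i k → N.Link d i k
      link Sign.+ = rises′
      link Sign.- = rises′

    -- An internal node in this slot of T′ would, by its edge and its position, fill the same slot
    -- of T.
    translate-valid : ∀ nm → N.Valid nm → N′.Valid (translate nm)
    translate-valid (N.node i)   _ = tt
    translate-valid (N.slot i s) o k eq = o k (≡.sym (N.inSlot⇒nb i s
      (link _ (subst (λ d → N′.Link (dir d s) i k) (≡.sym (signs i)) (proj₁ inSlot)) , proj₂ inSlot)))
      where inSlot = N′.nb⇒inSlot i s (≡.sym eq)

    translate-adj : ∀ nm nm′ → N.AdjName nm nm′ → N′.AdjName (translate nm) (translate nm′)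
    translate-adj (N.node i)   (N.node k)   a = Sum.map rises rises a
    translate-adj (N.node i)   (N.slot k s) a = a
    translate-adj (N.slot i s) (N.node k)   a = a
    translate-adj (N.slot i s) (N.slot k _) a = a

    to : MCT.Vertex T → MCT.Vertex T′
    to v = N′.vertex (translate (proj₁ (N.name-of v)))

    to-vertex : ∀ nm → N.Valid nm → to (N.vertex nm) ≡ N′.vertex (translate nm)
    to-vertex nm o = let nm′ , o′ , eq = N.name-of (N.vertex nm) in
      cong (N′.vertex ∘ translate) (N.vertex-injective nm′ nm o′ o eq)

    to-adj : ∀ u v → MCT.Adj T u v → MCT.Adj T′ (to u) (to v)
    to-adj u v a with N.name-of u | N.name-of v
    ... | nm , o , ≡.refl | nm′ , o′ , ≡.refl = N′.name⇒adj _ _ (translate-adj nm nm′ (N.adj⇒name nm nm′ o o′ a))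

  isomorphic : ∀ (T T′ : MCT 𝓡 (suc m)) → (∀ i → MCT.signVector T i ≡ MCT.signVector T′ i) →
               (∀ {i k} → Rises T i k → Rises T′ i k) → (∀ {i k} → Rises T′ i k → Rises T i k) → Isomorphic 𝓡 T T′
  isomorphic T T′ signs rises rises′ = record
    { φ         = mk↔ₛ′ A.to B.to to-from from-to
    ; adjacency = λ u v → mk⇔ (A.to-adj u v) λ a → ≡.subst₂ (MCT.Adj T) (from-to u) (from-to v) (B.to-adj _ _ a)
    ; leftRight = λ i → A.to-vertex (N.node i) tt
    ; bottomTop = λ i j → mk⇔ (Star.map (child T T′ rises)) (Star.map (child T′ T rises′))
    }
    where
    module N  = Neighbourhoods 𝓡 T
    module N′ = Neighbourhoods 𝓡 T′
    module A = Translate T T′ signs rises rises′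
    module B = Translate T′ T (λ i → ≡.sym (signs i)) rises′ rises
    back : ∀ nm → B.translate (A.translate nm) ≡ nm
    back (N.node i)   = ≡.refl
    back (N.slot i s) = ≡.refl
    forth : ∀ nm → A.translate (B.translate nm) ≡ nm
    forth (N′.node i)   = ≡.refl
    forth (N′.slot i s) = ≡.refl
    from-to : ∀ v → B.to (A.to v) ≡ v
    from-to v with N.name-of v
    ... | nm , o , ≡.refl = ≡.trans (B.to-vertex (A.translate nm) (A.translate-valid nm o)) (cong N.vertex (back nm))
    to-from : ∀ v → A.to (B.to v) ≡ v
    to-from v with N′.name-of v
    ... | nm , o , ≡.refl = ≡.trans (A.to-vertex (B.translate nm) (B.translate-valid nm o)) (cong N′.vertex (forth nm))
    child : ∀ (T T′ : MCT 𝓡 (suc m)) → (∀ {i k} → Rises T i k → Rises T′ i k) → ∀ {i j} →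
            MCT.Child T (MCT.t T j) (MCT.t T i) → MCT.Child T′ (MCT.t T′ j) (MCT.t T′ i)
    child T T′ rises (a , lt) with rises (MCT.symmetric T a , lt)
    ... | a′ , lt′ = MCT.symmetric T′ a′ , lt′

-- The tree of a cluster

module TreeOfCuts {c ℓ₁ ℓ₂} (𝓡 : RealNumbers c ℓ₁ ℓ₂) {m : ℕ}
  (ε : Vector Sign (suc m)) (H : Fin (suc m) → ℕ) (H-injective : Injective _≡_ _≡_ H)
  (U : Fin m → Fin (suc m) → Bool) (U-injective : ∀ i j → (∀ k → U i k ≡ U j k) → i ≡ j)
  (strand : ∀ j → ∃₂ λ p q → ∃ λ (e : Gaps.Edge ε H H-injective p q) → Gaps.IsCut ε H H-injective e (U j)) where

  open Gaps ε H H-injective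
  open EdgeCount ε H H-injective
  open MixedCobinary 𝓡 ε H H-injective
  open ClosedRegion 𝓡
  open RealNumbers 𝓡 using () renaming (_≤_ to _≤ᴿ_)

  private
    p q : Fin m → Fin (suc m)
    p j = proj₁ (strand j)
    q j = proj₁ (proj₂ (strand j))

    e : ∀ j → Edge (p j) (q j)
    e j = proj₁ (proj₂ (proj₂ (strand j)))

    cut : ∀ j → IsCut (e j) (U j)
    cut j = proj₂ (proj₂ (proj₂ (strand j)))

    exhausted : ∀ {x y} → Edge x y → ∃ λ j → p j ≡ x × q j ≡ y
    exhausted = edges-exhausted p q e U cut U-injective

    -- If the cut i changed along the edge j, both cuts would belong to one edge and agree.
    other : ∀ i j → i ≢ j → U i (p j) ≡ U i (q j)
    other i j i≢j with cut-constant (cut i) (e j)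
    ... | inj₂ eq = eq
    ... | inj₁ (p≡ , q≡) = contradiction (U-injective i j (same (e j) (cut j) p≡ q≡)) i≢j
      where
      same : ∀ {x y} (e′ : Edge x y) → IsCut e′ (U j) → p i ≡ x → q i ≡ y → ∀ k → U i k ≡ U j k
      same e′ cut′ ≡.refl ≡.refl = cut-unique (cut i) cut′

    path : ∀ i → Star (λ a b → ∃ λ j → (p j ≡ a × q j ≡ b) ⊎ (p j ≡ b × q j ≡ a)) zero i
    path i = Star.map link (connected zero i)
      where
      link : ∀ {a b} → Linked a b → ∃ λ j → (p j ≡ a × q j ≡ b) ⊎ (p j ≡ b × q j ≡ a)
      link (inj₁ d) = let j , ends = exhausted d in j , inj₁ ends
      link (inj₂ d) = let j , ends = exhausted d in j , inj₂ ends

    edge⇒rises : ∀ {i k} → Edge i k → Rises mct i k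
    edge⇒rises {i} {k} d = proj₂ (adjacent⇔linked {i} {k}) (inj₁ d) , edge-rises d

    rises⇒edge : ∀ {i k} → Rises mct i k → Edge i k
    rises⇒edge {i} {k} (a , lt) with proj₁ (adjacent⇔linked {i} {k}) a
    ... | inj₁ d = d
    ... | inj₂ d = contradiction (edge-rises d) (OrderedFieldProperties.<-asym (RealNumbers.orderedField 𝓡) lt)

  -- The m strands are all the internal edges, so the inequalities of the closed region say exactly
  -- that the m coefficients are nonnegative.
  closed-region : (v : Fin m → Vector ℤ m) → (∀ j k → eulerᵗ ε (v j) k ≡ step (ind ∘ U j) k) →
                  closure 𝓡 (R 𝓡 mct) ≐ (F 𝓡 ⊢ EᵗS 𝓡 ε v)
  closed-region v image =
    (λ {x} x∈ → edges⇒cone {x} λ j → closure-rises mct x∈ (edge⇒rises (e j))) ,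
    λ {x} x∈ → rises-closure mct λ r → along {x} (exhausted (rises⇒edge r)) (cone⇒edges {x} x∈)
    where
    open ConeAlgebra.Combinations.Edges 𝓡 ε v U image p q (λ j → cut-lower (cut j)) (λ j → cut-upper (cut j)) other path
    along : ∀ {x : Vector _ (suc m)} {i k} → (∃ λ j → p j ≡ i × q j ≡ k) → (∀ j → x (p j) ≤ᴿ x (q j)) → x i ≤ᴿ x k
    along (j , ≡.refl , ≡.refl) rises = rises j

  tree-of-cuts : (v : Fin m → Vector ℤ m) → (∀ j k → eulerᵗ ε (v j) k ≡ step (ind ∘ U j) k) →
                 ∃ λ (T : MCT 𝓡 (suc m)) → (MCT.signVector T ≗ ε) × (closure 𝓡 (R 𝓡 T) ≐ (F 𝓡 ⊢ EᵗS 𝓡 ε v))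
  tree-of-cuts v image = mct , signVector-mct , closed-region v image

tree-of-cluster : ∀ {c ℓ₁ ℓ₂} (𝓡 : RealNumbers c ℓ₁ ℓ₂) {m} (ε : Vector Sign (suc m)) (v : Fin m → Vector ℤ m) →
  IsCluster ε v → ∃ λ (T : MCT 𝓡 (suc m)) → (MCT.signVector T ≗ ε) × (closure 𝓡 (R 𝓡 T) ≐ (F 𝓡 ⊢ EᵗS 𝓡 ε v))
tree-of-cluster 𝓡 {m} ε v cluster = tree separated
  where
  open IsCluster cluster
  open Diagonals ε
  open ClusterDiagonals ε
  diagonal : Fin m → Diagonal
  diagonal j = toDiagonal (almostPositive j)
  separated : SeparatingHeights ε diagonal
  separated = separatingHeights ε diagonal λ i j →
    compatible-diagonals (almostPositive i) (almostPositive j) (compatible i j)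
  injective : ∀ i j → (∀ k → setOf (diagonal i) k ≡ setOf (diagonal j) k) → i ≡ j
  injective i j same = distinct {i} {j} (diagonal-injective (almostPositive i) (almostPositive j) same)
  tree : SeparatingHeights ε diagonal →
         ∃ λ (T : MCT 𝓡 (suc m)) → (MCT.signVector T ≗ ε) × (closure 𝓡 (R 𝓡 T) ≐ (F 𝓡 ⊢ EᵗS 𝓡 ε v))
  tree (H , H-injective , strand) = TreeOfCuts.tree-of-cuts 𝓡 ε H H-injective (λ j → setOf (diagonal j))
    injective strand v (λ j → diagonal-step (almostPositive j))

mct-unique : ∀ {c ℓ₁ ℓ₂} (𝓡 : RealNumbers c ℓ₁ ℓ₂) {m} (T T′ : MCT 𝓡 (suc m)) → MCT.signVector T ≗ MCT.signVector T′ →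
  closure 𝓡 (R 𝓡 T) ⊆ closure 𝓡 (R 𝓡 T′) → closure 𝓡 (R 𝓡 T′) ⊆ closure 𝓡 (R 𝓡 T) → Isomorphic 𝓡 T T′
mct-unique 𝓡 T T′ signs incl incl′ = Isomorphisms.isomorphic 𝓡 T T′ signs
  (rises-transfer T T′ incl′ incl) (rises-transfer T′ T incl incl′)
  where open Uniqueness 𝓡

theorem4 : ∀ {c ℓ₁ ℓ₂} (𝓡 : RealNumbers c ℓ₁ ℓ₂)
    (m : ℕ) → 2 ℕ.≤ suc m →
    (ε : Vector Sign (suc m)) (v : Fin m → Vector ℤ m) → IsCluster ε v →
    ∃! (Isomorphic 𝓡) λ (T : MCT 𝓡 (suc m)) →
    (MCT.signVector T ≗ ε) ×
    (closure 𝓡 (R 𝓡 T) ≐ (F 𝓡 ⊢ EᵗS 𝓡 ε v))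
theorem4 𝓡 m _ ε v cluster = unique (tree-of-cluster 𝓡 ε v cluster)
  where
  HasRegion : MCT 𝓡 (suc m) → Set _
  HasRegion T = (MCT.signVector T ≗ ε) × (closure 𝓡 (R 𝓡 T) ≐ (F 𝓡 ⊢ EᵗS 𝓡 ε v))
  unique : ∃ HasRegion → ∃! (Isomorphic 𝓡) HasRegion
  unique (T , signs , cone) = T , (signs , cone) , λ {T′} (signs′ , cone′) →
    mct-unique 𝓡 T T′ (λ i → ≡.trans (signs i) (≡.sym (signs′ i)))
      (λ {x} x∈ → proj₂ cone′ {x} (proj₁ cone {x} x∈)) (λ {x} x∈ → proj₂ cone {x} (proj₁ cone′ {x} x∈))
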